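{- For a connected chordal building set $\mathcal{B}$ on $[n]$, the $\gamma$-polynomial of the extended nestohedron $\mathcal{P}^{\square}(\mathcal{B})$ is $$\gamma_{\mathcal{P}^{\square}(\mathcal{B})}(t)=\sum_{w\in\widehat{\mathfrak{S}}_{n+1}\cap\mathfrak{S}^{\square}_{n+1}(\mathcal{B})}t^{\operatorname{des}(w)}.$$
   Context: A building set on $[n]$ is a collection $\mathcal{B}$ of nonempty subsets of $[n]$ containing all singletons and such that $I\cup J\in\mathcal{B}$ whenever $I,J\in\mathcal{B}$, $I\cap J\neq\varnothing$; it is connected if $[n]\in\mathcal{B}$, and chordal if for every $I=\{i_1<\dots<i_r\}\in\mathcal{B}$ and $s\in[r]$, $\{i_s,\dots,i_r\}\in\mathcal{B}$. For $Y\subseteq[n]$, $a,b\in Y$ lie in the same connected component of $\mathcal{B}|_Y=\{J\in\mathcal{B}:J\subseteq Y\}$ if some $J\in\mathcal{B}$, $J\subseteq Y$, contains both. A $\mathcal{B}$-partial permutation is a word $(a_1,\dots,a_k)$ of distinct elements of $[n]$ ($0\le k\le n$) such that for each $i\in[k]$, $a_i$ and $\max\{a_1,\dots,a_i\}$ lie in the same connected component of $\mathcal{B}|_{\{a_1,\dots,a_i\}}$. $\varphi_n(w)\in\mathfrak{S}_{n+1}$ is obtained by appending $[n+1]\setminus\{a_1,\dots,a_k\}$ to $w$ in decreasing order; $\mathfrak{S}^{\square}_{n+1}(\mathcal{B})$ is the set of all $\varphi_n(w)$. For $u\in\mathfrak{S}_{n+1}$, $\operatorname{des}(u)=|\{i\in[n]:u(i)>u(i+1)\}|$.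 $\widehat{\mathfrak{S}}_{n+1}$ is the set of $u\in\mathfrak{S}_{n+1}$ with no double descent (no $i$ with $u(i)>u(i+1)>u(i+2)$) and no final descent ($u(n)<u(n+1)$). An extended nested collection is a set $\{I_1,\dots,I_m,x_{i_1},\dots,x_{i_r}\}$ with $I_j\in\mathcal{B}$ and formal symbols $x_i$ ($i\in[n]$) such that the $I_j$ are pairwise nested or disjoint, no union of $k\ge2$ pairwise disjoint $I_j$'s lies in $\mathcal{B}$, and no $i_\ell$ lies in any $I_j$. $\mathcal{P}^{\square}(\mathcal{B})$ is an $n$-dimensional simple polytope with $f_i$ ($i$-faces) equal to the number of extended nested collections of cardinality $n-i$; $h$ is defined by $\sum_i f_it^i=h(t+1)$, and the $\gamma$-polynomial $\gamma(t)=\sum_i\gamma_it^i$ by $h(t)=\sum_{i=0}^{\lfloor n/2\rfloor}\gamma_it^i(1+t)^{n-2i}$. -}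

module Defs where

open import Data.Bool using (Bool; true; false; _∧_; _∨_; not; if_then_else_)
open import Data.Nat using (ℕ; zero; suc; _+_; _*_; _∸_; _≤_; _<_; _≡ᵇ_; _<ᵇ_; _≤ᵇ_)
open import Data.Nat.Combinatorics using (_C_)
open import Data.Integer using (ℤ; +_; -_)
import Data.Integer as ℤ
open import Data.Fin using (Fin; toℕ)
import Data.Fin as F
open import Data.Fin.Subset using (Subset; inside; outside; _∈_; _∩_; _∪_; ⊤; ⊥; ⁅_⁆; ∣_∣; Nonempty; _⊆_)
open import Data.Fin.Subset.Properties using (_∈?_; _⊆?_; nonempty?)
open import Data.List using (List; []; _∷_; _++_; map; concatMap; length; filterᵇ; foldr; upTo; downFrom; allFin)
import Data.List as L
open import Data.Vec using ([]; _∷_)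
open import Data.Product using (_×_; _,_; Σ)
open import Relation.Nullary using (does)
open import Relation.Binary.PropositionalEquality using (_≡_)

-- Conventions.  The ground set [n] = {1,…,n} is represented by Fin n,
-- the element i ∈ [n] being the Fin n element with toℕ = i - 1 (this
-- preserves the order).  Subsets of [n] are 'Subset n'.  A collection
-- 𝓑 of subsets of [n] is given by its (Boolean) characteristic function.

Collection : ℕ → Set
Collection n = Subset n → Bool

IsBuildingSet : ∀ {n} → Collection n → Set
IsBuildingSet {n} 𝓑 =
  (∀ (I : Subset n) → 𝓑 I ≡ true → Nonempty I) ×
  (∀ (i : Fin n) → 𝓑 ⁅ i ⁆ ≡ true) ×
  (∀ (I J : Subset n) → 𝓑 I ≡ true → 𝓑 J ≡ true → Nonempty (I ∩ J) → 𝓑 (I ∪ J) ≡ true)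

IsConnected : ∀ {n} → Collection n → Set
IsConnected 𝓑 = 𝓑 ⊤ ≡ true

atLeast : ∀ {n} → Fin n → Subset n
atLeast {n} a = Data.Vec.tabulate (λ x → if toℕ x <ᵇ toℕ a then outside else inside)
  where import Data.Vec

-- chordal: for I = {i₁<…<i_r} ∈ 𝓑 and s ∈ [r], {i_s,…,i_r} = I ∩ {x ≥ i_s} ∈ 𝓑
IsChordal : ∀ {n} → Collection n → Set
IsChordal {n} 𝓑 = ∀ (I : Subset n) (a : Fin n) → 𝓑 I ≡ true → a ∈ I → 𝓑 (I ∩ atLeast a) ≡ true

any : ∀ {A : Set} → (A → Bool) → List A → Bool
any p [] = false
any p (x ∷ xs) = p x ∨ any p xs

all : ∀ {A : Set} → (A → Bool) → List A → Bool
all p [] = true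
all p (x ∷ xs) = p x ∧ all p xs

allSubsets : (n : ℕ) → List (Subset n)
allSubsets zero = [] ∷ []
allSubsets (suc n) = concatMap (λ s → (outside ∷ s) ∷ (inside ∷ s) ∷ []) (allSubsets n)

sublists : ∀ {A : Set} → List A → List (List A)
sublists [] = [] ∷ []
sublists (x ∷ xs) = sublists xs ++ map (x ∷_) (sublists xs)

words : ∀ {A : Set} → List A → ℕ → List (List A)
words xs zero = [] ∷ []
words xs (suc k) = concatMap (λ w → map (_∷ w) xs) (words xs k)

elemᵇ : ∀ {A : Set} → (A → A → Bool) → A → List A → Bool
elemᵇ eq x ys = any (eq x) ys

distinctᵇ : ∀ {A : Set} → (A → A → Bool) → List A → Bool
distinctᵇ eq [] = true
distinctᵇ eq (x ∷ xs) = not (elemᵇ eq x xs) ∧ distinctᵇ eq xs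

eqFin : ∀ {n} → Fin n → Fin n → Bool
eqFin a b = toℕ a ≡ᵇ toℕ b

eqList : List ℕ → List ℕ → Bool
eqList [] [] = true
eqList (x ∷ xs) (y ∷ ys) = (x ≡ᵇ y) ∧ eqList xs ys
eqList _ _ = false

_⊆ᵇ_ : ∀ {n} → Subset n → Subset n → Bool
I ⊆ᵇ J = does (I ⊆? J)

_∈ᵇ_ : ∀ {n} → Fin n → Subset n → Bool
a ∈ᵇ I = does (a ∈? I)

disjointᵇ : ∀ {n} → Subset n → Subset n → Bool
disjointᵇ I J = not (does (nonempty? (I ∩ J)))

⋃ : ∀ {n} → List (Subset n) → Subset n
⋃ = foldr _∪_ ⊥

pairwise : ∀ {A : Set} → (A → A → Bool) → List A → Bool
pairwise r xs = all (λ x → all (λ y → r x y) xs) xs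

pairwiseDisjointᵇ : ∀ {n} → List (Subset n) → Bool
pairwiseDisjointᵇ [] = true
pairwiseDisjointᵇ (I ∷ Is) = all (disjointᵇ I) Is ∧ pairwiseDisjointᵇ Is

-- {I₁,…,I_m} (list without repetition) and {x_i | i ∈ X}
-- form an extended nested collection
isENCᵇ : ∀ {n} → Collection n → List (Subset n) → Subset n → Bool
isENCᵇ {n} 𝓑 S X =
  all 𝓑 S ∧
  pairwise (λ I J → (I ⊆ᵇ J) ∨ (J ⊆ᵇ I) ∨ disjointᵇ I J) S ∧
  all (λ T → not ((2 ≤ᵇ length T) ∧ pairwiseDisjointᵇ T) ∨ not (𝓑 (⋃ T))) (sublists S) ∧
  all (disjointᵇ X) S

allENC : ∀ {n} → Collection n → List (List (Subset n) × Subset n)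
allENC {n} 𝓑 =
  filterᵇ (λ { (S , X) → isENCᵇ 𝓑 S X })
    (concatMap (λ S → map (S ,_) (allSubsets n)) (sublists (allSubsets n)))

-- f_i(𝒫□(𝓑)) = number of extended nested collections of cardinality n - i
fVec : ∀ {n} → Collection n → ℕ → ℕ
fVec {n} 𝓑 i = length (filterᵇ (λ { (S , X) → (length S + ∣ X ∣) ≡ᵇ (n ∸ i) }) (allENC 𝓑))

sumℕ : ℕ → (ℕ → ℕ) → ℕ
sumℕ zero g = 0
sumℕ (suc m) g = sumℕ m g + g m

sumℤ : ℕ → (ℕ → ℤ) → ℤ
sumℤ zero g = + 0
sumℤ (suc m) g = sumℤ m g ℤ.+ g m

sign : ℕ → ℤ
sign zero = + 1
sign (suc k) = - sign k

-- h-vector: h(t+1) = Σ_i f_i t^i, i.e. h(t) = Σ_{i=0}^n f_i (t-1)^i, whose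
-- coefficient of t^j is Σ_{i=0}^n f_i C(i,j) (-1)^(i-j)   (C(i,j) = 0 for i < j)
hVec : ∀ {n} → Collection n → ℕ → ℤ
hVec {n} 𝓑 j = sumℤ (suc n) (λ i → sign (i ∸ j) ℤ.* (+ ((i C j) * fVec 𝓑 i)))

coeffTiOnePlusT : ℕ → ℕ → ℕ → ℕ
coeffTiOnePlusT i m j = if j <ᵇ i then 0 else m C (j ∸ i)

maxFin : ∀ {n} → Fin n → List (Fin n) → Fin n
maxFin a [] = a
maxFin a (b ∷ bs) = maxFin (if toℕ a <ᵇ toℕ b then b else a) bs

toSubset : ∀ {n} → List (Fin n) → Subset n
toSubset = foldr (λ a s → ⁅ a ⁆ ∪ s) ⊥

-- a and b lie in the same connected component of 𝓑|_Y :
-- some J ∈ 𝓑 with J ⊆ Y contains both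
sameComponentᵇ : ∀ {n} → Collection n → Subset n → Fin n → Fin n → Bool
sameComponentᵇ {n} 𝓑 Y a b = any (λ J → 𝓑 J ∧ (J ⊆ᵇ Y) ∧ (a ∈ᵇ J) ∧ (b ∈ᵇ J)) (allSubsets n)

-- check the partial-permutation condition along the word; 'pre' is the
-- already-read prefix (a₁,…,a_{i-1}) in reverse order
ppCondᵇ : ∀ {n} → Collection n → List (Fin n) → List (Fin n) → Bool
ppCondᵇ 𝓑 pre [] = true
ppCondᵇ 𝓑 pre (a ∷ rest) =
  sameComponentᵇ 𝓑 (toSubset (a ∷ pre)) a (maxFin a pre) ∧ ppCondᵇ 𝓑 (a ∷ pre) rest

isPartialPermᵇ : ∀ {n} → Collection n → List (Fin n) → Bool
isPartialPermᵇ {n} 𝓑 w = (length w ≤ᵇ n) ∧ distinctᵇ eqFin w ∧ ppCondᵇ 𝓑 [] w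

partialPerms : ∀ {n} → Collection n → List (List (Fin n))
partialPerms {n} 𝓑 =
  filterᵇ (isPartialPermᵇ 𝓑) (concatMap (words (allFin n)) (upTo (suc n)))

-- φ_n : word over [n] ↦ permutation of [n+1] (one-line notation, values 1..n+1)
φ : ∀ {n} → List (Fin n) → List ℕ
φ {n} w = w′ ++ filterᵇ (λ x → not (elemᵇ _≡ᵇ_ x w′)) (map suc (downFrom (suc n)))
  where w′ = map (λ a → suc (toℕ a)) w

perms : ℕ → List (List ℕ)
perms m = filterᵇ (distinctᵇ _≡ᵇ_) (words (map suc (upTo m)) m)

inSquareᵇ : ∀ {n} → Collection n → List ℕ → Bool
inSquareᵇ 𝓑 u = any (λ w → eqList (φ w) u) (partialPerms 𝓑)

des : List ℕ → ℕ
des (x ∷ y ∷ rest) = (if y <ᵇ x then 1 else 0) + des (y ∷ rest)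
des _ = 0

noDoubleDescentᵇ : List ℕ → Bool
noDoubleDescentᵇ (x ∷ y ∷ z ∷ rest) = not ((y <ᵇ x) ∧ (z <ᵇ y)) ∧ noDoubleDescentᵇ (y ∷ z ∷ rest)
noDoubleDescentᵇ _ = true

noFinalDescentᵇ : List ℕ → Bool
noFinalDescentᵇ (x ∷ y ∷ []) = x <ᵇ y
noFinalDescentᵇ (x ∷ y ∷ z ∷ rest) = noFinalDescentᵇ (y ∷ z ∷ rest)
noFinalDescentᵇ _ = true

inHatᵇ : List ℕ → Bool
inHatᵇ u = noDoubleDescentᵇ u ∧ noFinalDescentᵇ u

descentCount : ∀ {n} → Collection n → ℕ → ℕ
descentCount {n} 𝓑 i =
  length (filterᵇ (λ u → inHatᵇ u ∧ inSquareᵇ 𝓑 u ∧ (des u ≡ᵇ i)) (perms (suc n)))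

{-# OPTIONS --safe #-}

-- Fix an integer x ≥ 2 and put t = x - 1.  For a function F of subsets of [n] let
--   (E α C F)(S) = Σ_{R ⊆ C ∩ S} α^|R| F(S ─ R),   so that   E α C ∘ E β C = E (α + β) C.
-- Let C = C(S) be the component of 𝓑|_S containing max S, and consider
--   K(S) = Σ t^(|S| - |N|) over the nested collections N with union S,
--   Γ(S) = Σ x^des(w) (1 + x)^(|S| - 2 des(w)) over the 𝓑-permutations w of S
--          without double descents.
-- Deleting C(S) from N shows E t C K = x K at every S ≠ ∅.  Hence G = E x [n] K, whose
-- value at [n] is h(x) = f(t), satisfies
--   E (-1) C G = x · E (-x) C G   at every S ≠ ∅.
-- By chordality a decreasing word in letters of C(S) can always be appended to a
-- 𝓑-permutation of the other letters of S; therefore E α C Γ is a sum over all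
-- 𝓑-permutations of S in which the maximal descending runs contribute separately, and Γ
-- satisfies the same relation.  Since x ≠ 1, the relation determines a function from
-- its value at ∅, so h(x) = G([n]) = Γ([n]) for all x ≥ 2.
module Submission where

open import Defs

-- The numbers -1 and -x are forced from two unrelated sides. For G, the factor E x C inside E x [n]
-- turns them into -1 + x = t and -x + x = 0: the left side meets the recursion of K, the right side
-- meets K with no letter of C deleted. For Γ, deleting letters from a final descending run of
-- length at least two leaves nonzero weight only when two, one or no letters of the run remain. The
-- total is a power of α times x + (1 + x) α + α² = (1 + α)(x + α), whose roots are exactly -1 and
-- -x. So only words whose final run is a single letter survive, and on these (1 + x) - 1 and x ((1
-- + x) - x) agree. No bijection between collections and words is built; one relation characterises
-- both functions. It can be solved at S because F(S) occurs with coefficient 1 on the left and x on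
-- the right, while all other arguments are smaller sets. The difference x - 1 = t must be
-- cancelled, so the comparison is made at integers x ≥ 2; coefficients are recovered afterwards
-- from infinitely many values by a divisibility argument.

module _ where

  open import Data.Bool using (Bool; true; false; _∧_; _∨_; not; if_then_else_; T)
  import Data.Bool as Bool
  import Data.Bool.Properties as Boolₚ
  open import Data.Empty using (⊥-elim)
  open import Data.Fin using (Fin; zero; suc; toℕ; fromℕ<)
  import Data.Fin.Properties as Finₚ
  open import Data.Fin.Subset using (Subset; inside; outside; _∈_; _∉_; _∪_; _∩_; ⊤; ⊥; ⁅_⁆; ∣_∣; Nonempty; _⊆_; ∁) renaming (_-_ to _∖_)
  open import Data.Fin.Subset.Properties
  open import Data.Integer using (ℤ; NonZero; -_; _+_; _*_; _^_; 0ℤ; 1ℤ) renaming (+_ to pos)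
  import Data.Integer as ℤ
  import Data.Integer.Properties as ℤₚ
  open import Data.Integer.Tactic.RingSolver using (solve-∀)
  open import Data.List using (List; []; _∷_; _++_; _ʳ++_; map; concatMap; length; filterᵇ; foldr; reverse; allFin; upTo; downFrom; tabulate; applyUpTo)
  import Data.List.Properties as Listₚ
  open import Data.List.Membership.Propositional using (find; lose) renaming (_∈_ to _∈ₗ_; _∉_ to _∉ₗ_)
  open import Data.List.Membership.Propositional.Properties using (∈-++⁺ˡ; ∈-++⁺ʳ; ∈-++⁻; ∈-map⁺; ∈-map⁻; ∈-∃++; ∈-allFin; ∈-filter⁺; ∈-filter⁻; ∈-concatMap⁺; ∈-concatMap⁻; ∈-upTo⁺; ∈-downFrom⁻)
  open import Data.List.Relation.Binary.Permutation.Propositional using (_↭_; prep; swap; ↭-sym; ↭-reflexive; ↭-trans; ↭⇒↭ₛ) renaming (refl to ↭refl; trans to ↭trans)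
  open import Data.List.Relation.Binary.Permutation.Propositional.Properties using (∈-resp-↭; ↭-length; shift)
  import Data.List.Relation.Binary.Permutation.Setoid.Properties as PermSetoid
  open import Data.List.Relation.Unary.All using (All; []; _∷_)
  import Data.List.Relation.Unary.All as All
  open import Data.List.Relation.Unary.AllPairs using (AllPairs; []; _∷_)
  import Data.List.Relation.Unary.AllPairs.Properties as AllPairsₚ
  open import Data.List.Relation.Unary.Any using (here; there)
  import Data.List.Relation.Unary.Any.Properties as Anyₚ
  open import Data.List.Relation.Unary.Unique.Propositional using (Unique)
  import Data.List.Relation.Unary.Unique.Propositional.Properties as Uniqueₚ
  open import Data.Nat using (ℕ; zero; suc; s≤s; z≤n)
  import Data.Nat as ℕ
  import Data.Nat.DivMod as DivMod
  open import Data.Nat.Induction using (<-rec)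
  import Data.Nat.Properties as ℕₚ
  import Data.Nat.Tactic.RingSolver as ℕSolver
  open import Data.Product using (_×_; _,_; proj₁; proj₂; ∃)
  open import Data.Sum using (_⊎_; inj₁; inj₂)
  open import Data.Vec using ([]; _∷_; here; there)
  import Data.Vec as Vec
  import Data.Vec.Properties as Vecₚ
  open import Function using (_∘_; case_of_; Equivalence)
  open import Relation.Binary.PropositionalEquality using (_≡_; _≢_; _≗_; refl; sym; trans; cong; cong₂; subst; setoid; module ≡-Reasoning)
  open import Relation.Nullary using (Dec; yes; no; does; ¬_)
  open import Relation.Nullary.Decidable using (dec-true; dec-false; map′; _×-dec_)

  private variable
    n : ℕ
    A B : Set

  -- Finite sums

  when : Bool → ℤ → ℤ
  when true  z = z
  when false z = 0ℤ

  [_]_ : {P : Set} → Dec P → ℤ → ℤ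
  [ d ] z = when (does d) z

  infixr 7 [_]_

  when-+ : ∀ b y z → when b (y + z) ≡ when b y + when b z
  when-+ true  y z = refl
  when-+ false y z = refl

  when-* : ∀ b y z → when b (y * z) ≡ y * when b z
  when-* true  y z = refl
  when-* false y z = sym (ℤₚ.*-zeroʳ y)

  when-∧ : ∀ b c z → when (b ∧ c) z ≡ when b (when c z)
  when-∧ true  c z = refl
  when-∧ false c z = refl

  when-comm : ∀ b c z → when b (when c z) ≡ when c (when b z)
  when-comm true  c     z = refl
  when-comm false true  z = refl
  when-comm false false z = refl

  when-cong : ∀ b {y z} → (b ≡ true → y ≡ z) → when b y ≡ when b z
  when-cong true  h = h refl
  when-cong false h = refl

  []-yes : {P : Set} (d : Dec P) {z : ℤ} → P → [ d ] z ≡ z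
  []-yes (yes _) p = refl
  []-yes (no ¬p) p = ⊥-elim (¬p p)

  []-no : {P : Set} (d : Dec P) {z : ℤ} → ¬ P → [ d ] z ≡ 0ℤ
  []-no (yes p) ¬p = ⊥-elim (¬p p)
  []-no (no _)  ¬p = refl

  []-cong : {P Q : Set} (d : Dec P) (e : Dec Q) {y z : ℤ} → (P → Q) → (Q → P) → (P → y ≡ z) → [ d ] y ≡ [ e ] z
  []-cong (yes p) e f g h = trans (h p) (sym ([]-yes e (f p)))
  []-cong (no ¬p) e f g h = sym ([]-no e (¬p ∘ g))

  ∑ : (A → ℤ) → List A → ℤ
  ∑ f []       = 0ℤ
  ∑ f (a ∷ as) = f a + ∑ f as

  ∑-cong-∈ : ∀ {f g : A → ℤ} as → (∀ {a} → a ∈ₗ as → f a ≡ g a) → ∑ f as ≡ ∑ g as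
  ∑-cong-∈ []       h = refl
  ∑-cong-∈ (a ∷ as) h = cong₂ _+_ (h (here refl)) (∑-cong-∈ as (h ∘ there))

  ∑-cong : ∀ {f g : A → ℤ} → (∀ a → f a ≡ g a) → ∀ as → ∑ f as ≡ ∑ g as
  ∑-cong h as = ∑-cong-∈ as (λ {a} _ → h a)

  ∑-zero : ∀ {f : A → ℤ} as → (∀ {a} → a ∈ₗ as → f a ≡ 0ℤ) → ∑ f as ≡ 0ℤ
  ∑-zero []       h = refl
  ∑-zero (a ∷ as) h = cong₂ _+_ (h (here refl)) (∑-zero as (h ∘ there))

  ∑-++ : ∀ (f : A → ℤ) as bs → ∑ f (as ++ bs) ≡ ∑ f as + ∑ f bs
  ∑-++ f []       bs = sym (ℤₚ.+-identityˡ _)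
  ∑-++ f (a ∷ as) bs = trans (cong (f a +_) (∑-++ f as bs)) (sym (ℤₚ.+-assoc (f a) _ _))

  ∑-map : ∀ (f : B → ℤ) (g : A → B) as → ∑ f (map g as) ≡ ∑ (f ∘ g) as
  ∑-map f g []       = refl
  ∑-map f g (a ∷ as) = cong (f (g a) +_) (∑-map f g as)

  ∑-concatMap : ∀ (f : B → ℤ) (g : A → List B) as → ∑ f (concatMap g as) ≡ ∑ (λ a → ∑ f (g a)) as
  ∑-concatMap f g []       = refl
  ∑-concatMap f g (a ∷ as) = trans (∑-++ f (g a) _) (cong (∑ f (g a) +_) (∑-concatMap f g as))

  interchange : ∀ a b c d → (a + b) + (c + d) ≡ (a + c) + (b + d)
  interchange = solve-∀

  ∑-+ : ∀ (f g : A → ℤ) as → ∑ (λ a → f a + g a) as ≡ ∑ f as + ∑ g as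
  ∑-+ f g []       = refl
  ∑-+ f g (a ∷ as) = trans (cong (f a + g a +_) (∑-+ f g as)) (interchange (f a) (g a) (∑ f as) (∑ g as))

  ∑-* : ∀ c (f : A → ℤ) as → ∑ (λ a → c * f a) as ≡ c * ∑ f as
  ∑-* c f []       = sym (ℤₚ.*-zeroʳ c)
  ∑-* c f (a ∷ as) = trans (cong (c * f a +_) (∑-* c f as)) (sym (ℤₚ.*-distribˡ-+ c (f a) _))

  ∑-when : ∀ b (f : A → ℤ) as → ∑ (λ a → when b (f a)) as ≡ when b (∑ f as)
  ∑-when true  f as = refl
  ∑-when false f as = ∑-zero as (λ _ → refl)

  ∑-swap : ∀ (f : A → B → ℤ) as bs → ∑ (λ a → ∑ (f a) bs) as ≡ ∑ (λ b → ∑ (λ a → f a b) as) bs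
  ∑-swap f []       bs = sym (∑-zero bs (λ _ → refl))
  ∑-swap f (a ∷ as) bs = trans (cong (∑ (f a) bs +_) (∑-swap f as bs)) (sym (∑-+ (f a) _ bs))

  ∑-filter : ∀ (f : A → ℤ) (p : A → Bool) as → ∑ f (filterᵇ p as) ≡ ∑ (λ a → when (p a) (f a)) as
  ∑-filter f p [] = refl
  ∑-filter f p (a ∷ as) with p a
  ... | true  = cong (f a +_) (∑-filter f p as)
  ... | false = trans (∑-filter f p as) (sym (ℤₚ.+-identityˡ _))

  ∑-sublists-∷ : ∀ (g : List A → ℤ) a as → ∑ g (sublists (a ∷ as)) ≡ ∑ (λ N → g N + g (a ∷ N)) (sublists as)
  ∑-sublists-∷ g a as = trans (∑-++ g (sublists as) _)
    (trans (cong (∑ g (sublists as) +_) (∑-map g (a ∷_) (sublists as))) (sym (∑-+ g (g ∘ (a ∷_)) (sublists as))))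

  -- Lets a chosen set be moved to the front of `allSubsets`, where `∑-sublists-∷` pairs each
  -- collection without it with the one obtained by adding it. The sublists get permuted as well,
  -- hence the invariance asked of `g`.
  ∑-sublists-↭ : ∀ (g : List A → ℤ) → (∀ {N M} → N ↭ M → g N ≡ g M) → ∀ {as bs} → as ↭ bs → ∑ g (sublists as) ≡ ∑ g (sublists bs)
  ∑-sublists-↭ g inv ↭refl = refl
  ∑-sublists-↭ g inv {a ∷ as} {_ ∷ bs} (prep a p) = begin
    ∑ g (sublists (a ∷ as))               ≡⟨ ∑-sublists-∷ g a as ⟩
    ∑ (λ N → g N + g (a ∷ N)) (sublists as) ≡⟨ ∑-sublists-↭ _ (λ q → cong₂ _+_ (inv q) (inv (prep a q))) p ⟩
    ∑ (λ N → g N + g (a ∷ N)) (sublists bs) ≡⟨ ∑-sublists-∷ g a bs ⟨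
    ∑ g (sublists (a ∷ bs))               ∎ where open ≡-Reasoning
  ∑-sublists-↭ g inv {a ∷ b ∷ as} {_ ∷ _ ∷ bs} (swap a b p) = begin
    ∑ g (sublists (a ∷ b ∷ as)) ≡⟨ ∑-sublists-∷ g a (b ∷ as) ⟩
    ∑ (λ N → g N + g (a ∷ N)) (sublists (b ∷ as)) ≡⟨ ∑-sublists-∷ _ b as ⟩
    ∑ (λ N → (g N + g (a ∷ N)) + (g (b ∷ N) + g (a ∷ b ∷ N))) (sublists as)
      ≡⟨ ∑-cong (λ N → trans (interchange (g N) _ _ _) (cong (λ z → (g N + g (b ∷ N)) + (g (a ∷ N) + z)) (inv (swap a b ↭refl))))
          (sublists as) ⟩
    ∑ (λ N → (g N + g (b ∷ N)) + (g (a ∷ N) + g (b ∷ a ∷ N))) (sublists as)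
      ≡⟨ ∑-sublists-↭ _ (λ q → cong₂ _+_ (cong₂ _+_ (inv q) (inv (prep b q))) (cong₂ _+_ (inv (prep a q)) (inv (prep b (prep a q))))) p ⟩
    ∑ (λ N → (g N + g (b ∷ N)) + (g (a ∷ N) + g (b ∷ a ∷ N))) (sublists bs) ≡⟨ ∑-sublists-∷ _ a bs ⟨
    ∑ (λ N → g N + g (b ∷ N)) (sublists (a ∷ bs)) ≡⟨ ∑-sublists-∷ g b (a ∷ bs) ⟨
    ∑ g (sublists (b ∷ a ∷ bs)) ∎ where open ≡-Reasoning
  ∑-sublists-↭ g inv (↭trans p q) = trans (∑-sublists-↭ g inv p) (∑-sublists-↭ g inv q)

  ∑-words-suc : ∀ (f : List A → ℤ) as k → ∑ f (words as (suc k)) ≡ ∑ (λ a → ∑ (λ w → f (a ∷ w)) (words as k)) as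
  ∑-words-suc f as k = begin
    ∑ f (words as (suc k)) ≡⟨ ∑-concatMap f (λ w → map (_∷ w) as) (words as k) ⟩
    ∑ (λ w → ∑ f (map (_∷ w) as)) (words as k) ≡⟨ ∑-cong (λ w → ∑-map f (_∷ w) as) (words as k) ⟩
    ∑ (λ w → ∑ (λ a → f (a ∷ w)) as) (words as k) ≡⟨ ∑-swap (λ w a → f (a ∷ w)) (words as k) as ⟩
    ∑ (λ a → ∑ (λ w → f (a ∷ w)) (words as k)) as ∎ where open ≡-Reasoning

  ∑-words-snoc : ∀ (f : List A → ℤ) as k → ∑ f (words as (suc k)) ≡ ∑ (λ a → ∑ (λ w → f (w ++ a ∷ [])) (words as k)) as
  ∑-words-snoc f as zero = ∑-words-suc f as zero
  ∑-words-snoc f as (suc k) = begin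
    ∑ f (words as (suc (suc k))) ≡⟨ ∑-words-suc f as (suc k) ⟩
    ∑ (λ a → ∑ (λ w → f (a ∷ w)) (words as (suc k))) as ≡⟨ ∑-cong (λ a → ∑-words-snoc (λ w → f (a ∷ w)) as k) as ⟩
    ∑ (λ a → ∑ (λ b → ∑ (λ w → f (a ∷ w ++ b ∷ [])) (words as k)) as) as ≡⟨ ∑-swap _ as as ⟩
    ∑ (λ b → ∑ (λ a → ∑ (λ w → f (a ∷ w ++ b ∷ [])) (words as k)) as) as ≡⟨ ∑-cong (λ b → ∑-words-suc (λ w → f (w ++ b ∷ [])) as k) as ⟨
    ∑ (λ b → ∑ (λ w → f (w ++ b ∷ [])) (words as (suc k))) as ∎ where open ≡-Reasoning

  -- Bridges two directions of reading: one-line notation is written first letter first, whereas the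
  -- recursion over 𝓑-permutations removes the last letter.
  ∑-words-reverse : ∀ (f : List A → ℤ) as k → ∑ f (words as k) ≡ ∑ (f ∘ reverse) (words as k)
  ∑-words-reverse f as zero = refl
  ∑-words-reverse f as (suc k) = begin
    ∑ f (words as (suc k)) ≡⟨ ∑-words-snoc f as k ⟩
    ∑ (λ a → ∑ (λ w → f (w ++ a ∷ [])) (words as k)) as ≡⟨ ∑-cong (λ a → ∑-words-reverse (λ w → f (w ++ a ∷ [])) as k) as ⟩
    ∑ (λ a → ∑ (λ w → f (reverse w ++ a ∷ [])) (words as k)) as
      ≡⟨ ∑-cong (λ a → ∑-cong (λ w → cong f (Listₚ.unfold-reverse a w)) (words as k)) as ⟨
    ∑ (λ a → ∑ (λ w → f (reverse (a ∷ w))) (words as k)) as ≡⟨ ∑-words-suc (f ∘ reverse) as k ⟨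
    ∑ (f ∘ reverse) (words as (suc k)) ∎ where open ≡-Reasoning

  words-map : ∀ (g : A → B) as k → words (map g as) k ≡ map (map g) (words as k)
  words-map g as zero = refl
  words-map g as (suc k) = trans (cong (concatMap (λ w → map (_∷ w) (map g as))) (words-map g as k)) (lem (words as k))
    where
    lem : ∀ ws → concatMap (λ w → map (_∷ w) (map g as)) (map (map g) ws) ≡ map (map g) (concatMap (λ w → map (_∷ w) as) ws)
    lem [] = refl
    lem (w ∷ ws) = trans (cong₂ _++_ (trans (sym (Listₚ.map-∘ as)) (Listₚ.map-∘ as)) (lem ws))
                         (sym (Listₚ.map-++ (map g) (map (_∷ w) as) _))

  ∑-words-avoid : ∀ (f : List A → ℤ) as z → (∀ w → z ∈ₗ w → f w ≡ 0ℤ) → ∀ k →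
                  ∑ f (words (as ++ z ∷ []) k) ≡ ∑ f (words as k)
  ∑-words-avoid f as z h zero = refl
  ∑-words-avoid f as z h (suc k) = begin
    ∑ f (words (as ++ z ∷ []) (suc k)) ≡⟨ ∑-words-suc f _ k ⟩
    ∑ (λ a → ∑ (λ w → f (a ∷ w)) (words (as ++ z ∷ []) k)) (as ++ z ∷ [])
      ≡⟨ ∑-++ _ as (z ∷ []) ⟩
    ∑ (λ a → ∑ (λ w → f (a ∷ w)) (words (as ++ z ∷ []) k)) as + (∑ (λ w → f (z ∷ w)) (words (as ++ z ∷ []) k) + 0ℤ)
      ≡⟨ cong₂ (λ y y′ → y + (y′ + 0ℤ)) (∑-cong (λ a → ∑-words-avoid (λ w → f (a ∷ w)) as z (λ w m → h _ (there m)) k) as)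
               (∑-zero (words (as ++ z ∷ []) k) (λ {w} _ → h (z ∷ w) (here refl))) ⟩
    ∑ (λ a → ∑ (λ w → f (a ∷ w)) (words as k)) as + 0ℤ ≡⟨ ℤₚ.+-identityʳ _ ⟩
    ∑ (λ a → ∑ (λ w → f (a ∷ w)) (words as k)) as ≡⟨ ∑-words-suc f as k ⟨
    ∑ f (words as (suc k)) ∎ where open ≡-Reasoning

  -- Deletion operators on set functions

  ∈∖⇒≢ : ∀ {S : Subset n} {a b} → b ∈ S ∖ a → b ≢ a
  ∈∖⇒≢ {S = s ∷ S} {suc a} {suc b} (there m) refl = ∈∖⇒≢ {S = S} m refl
  ∈∖⇒≢ {S = false ∷ S} {zero} {zero} () refl
  ∈∖⇒≢ {S = true  ∷ S} {zero} {zero} () refl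

  ∈∖⇒∈ : ∀ {S : Subset n} {a b} → b ∈ S ∖ a → b ∈ S
  ∈∖⇒∈ {S = S} {a} = p─q⊆p S ⁅ a ⁆

  ∈-∖ : ∀ {S : Subset n} {a b} → b ∈ S → b ≢ a → b ∈ S ∖ a
  ∈-∖ = x∈p∧x≢y⇒x∈p-y

  ∉-∖ : ∀ {S : Subset n} {a} → a ∉ S ∖ a
  ∉-∖ {S = S} m = ∈∖⇒≢ {S = S} m refl

  ∣∖∣ : ∀ {S : Subset n} {a} → a ∈ S → ∣ S ∣ ≡ suc ∣ S ∖ a ∣
  ∣∖∣ {S = inside ∷ S}  {zero}  here = cong (suc ∘ ∣_∣) (sym (p─⊥≡p S))
  ∣∖∣ {S = inside ∷ S}  {suc a} (there m) = cong suc (∣∖∣ m)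
  ∣∖∣ {S = outside ∷ S} {suc a} (there m) = ∣∖∣ m

  -- E α as F S = Σ α^|R| F(S ─ R) over the R ⊆ S with elements among as.
  e : ℤ → Fin n → (Subset n → ℤ) → Subset n → ℤ
  e α a F S = F S + [ a ∈? S ] (α * F (S ∖ a))

  E : ℤ → List (Fin n) → (Subset n → ℤ) → Subset n → ℤ
  E α []       F = F
  E α (a ∷ as) F = e α a (E α as F)

  e-cong : ∀ α (a : Fin n) {F G} → F ≗ G → e α a F ≗ e α a G
  e-cong α a h S = cong₂ (λ y z → y + [ a ∈? S ] (α * z)) (h S) (h (S ∖ a))

  E-cong : ∀ α (as : List (Fin n)) {F G} → F ≗ G → E α as F ≗ E α as G
  E-cong α []       h = h
  E-cong α (a ∷ as) h = e-cong α a (E-cong α as h)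

  e-∈ : ∀ α {a : Fin n} F {S} → a ∈ S → e α a F S ≡ F S + α * F (S ∖ a)
  e-∈ α {a} F {S} m = cong (F S +_) ([]-yes (a ∈? S) m)

  e-∉ : ∀ α {a : Fin n} F {S} → a ∉ S → e α a F S ≡ F S
  e-∉ α {a} F {S} m = trans (cong (F S +_) ([]-no (a ∈? S) m)) (ℤₚ.+-identityʳ _)

  -- A letter can be deleted only once: on the pair `S`, `S ∖ a` the operator is a unipotent
  -- triangular matrix, and such matrices multiply by adding their off-diagonal entries. In
  -- particular `- α` inverts `α`.
  e-merge : ∀ α β (a : Fin n) F → e α a (e β a F) ≗ e (α + β) a F
  e-merge α β a F S with a ∈? S
  ... | no m = ℤₚ.+-identityʳ _
  ... | yes m rewrite []-no (a ∈? (S ∖ a)) {β * F (S ∖ a ∖ a)} ∉-∖ = lem (F S) α β (F (S ∖ a))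
    where
    lem : ∀ f α β g → (f + β * g) + α * (g + 0ℤ) ≡ f + (α + β) * g
    lem = solve-∀

  e-comm : ∀ α β (a b : Fin n) F → e α a (e β b F) ≗ e β b (e α a F)
  e-comm α β a b F S with a Finₚ.≟ b
  ... | yes refl = trans (e-merge α β a F S) (trans (cong (λ γ → e γ a F S) (ℤₚ.+-comm α β)) (sym (e-merge β α a F S)))
  ... | no a≢b with a ∈? S | b ∈? S
  ... | yes m | yes k rewrite p─x─y≡p─y─x S a b = begin
        (F S + β * F (S ∖ b)) + α * (F (S ∖ a) + [ b ∈? (S ∖ a) ] (β * F (S ∖ b ∖ a)))
          ≡⟨ cong (λ z → (F S + β * F (S ∖ b)) + α * (F (S ∖ a) + z)) ([]-yes (b ∈? (S ∖ a)) (∈-∖ k (a≢b ∘ sym))) ⟩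
        (F S + β * F (S ∖ b)) + α * (F (S ∖ a) + β * F (S ∖ b ∖ a))
          ≡⟨ lem (F S) α β (F (S ∖ b)) (F (S ∖ a)) (F (S ∖ b ∖ a)) ⟩
        (F S + α * F (S ∖ a)) + β * (F (S ∖ b) + α * F (S ∖ b ∖ a))
          ≡⟨ cong (λ z → (F S + α * F (S ∖ a)) + β * (F (S ∖ b) + z)) ([]-yes (a ∈? (S ∖ b)) (∈-∖ m a≢b)) ⟨
        (F S + α * F (S ∖ a)) + β * (F (S ∖ b) + [ a ∈? (S ∖ b) ] (α * F (S ∖ b ∖ a))) ∎
    where
    open ≡-Reasoning
    lem : ∀ f α β g h k → (f + β * g) + α * (h + β * k) ≡ (f + α * h) + β * (g + α * k)
    lem = solve-∀
  ... | yes m | no k rewrite []-no (b ∈? (S ∖ a)) {β * F (S ∖ a ∖ b)} (k ∘ ∈∖⇒∈) = lem (F S) α (F (S ∖ a))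
    where
    lem : ∀ f α h → (f + 0ℤ) + α * (h + 0ℤ) ≡ (f + α * h) + 0ℤ
    lem = solve-∀
  ... | no m | yes k rewrite []-no (a ∈? (S ∖ b)) {α * F (S ∖ b ∖ a)} (m ∘ ∈∖⇒∈) = lem (F S) β (F (S ∖ b))
    where
    lem : ∀ f α h → (f + α * h) + 0ℤ ≡ (f + 0ℤ) + α * (h + 0ℤ)
    lem = solve-∀
  ... | no m | no k = refl

  e-E-comm : ∀ α β (a : Fin n) bs F → e α a (E β bs F) ≗ E β bs (e α a F)
  e-E-comm α β a []       F S = refl
  e-E-comm α β a (b ∷ bs) F S = trans (e-comm α β a b (E β bs F) S) (e-cong β b (e-E-comm α β a bs F) S)

  E-comm : ∀ α β (as bs : List (Fin n)) F → E α as (E β bs F) ≗ E β bs (E α as F)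
  E-comm α β []       bs F S = refl
  E-comm α β (a ∷ as) bs F S = trans (e-cong α a (E-comm α β as bs F) S) (e-E-comm α β a bs (E α as F) S)

  E-merge : ∀ α β (as : List (Fin n)) F → E α as (E β as F) ≗ E (α + β) as F
  E-merge α β []       F S = refl
  E-merge α β (a ∷ as) F S = begin
    e α a (E α as (e β a (E β as F))) S ≡⟨ e-cong α a (e-E-comm β α a as (E β as F)) S ⟨
    e α a (e β a (E α as (E β as F))) S ≡⟨ e-merge α β a (E α as (E β as F)) S ⟩
    e (α + β) a (E α as (E β as F)) S   ≡⟨ e-cong (α + β) a (E-merge α β as F) S ⟩
    e (α + β) a (E (α + β) as F) S      ∎ where open ≡-Reasoning

  E-filter : ∀ α (p : Fin n → Bool) as F → E α as F ≗ E α (filterᵇ p as) (E α (filterᵇ (not ∘ p) as) F)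
  E-filter α p []       F S = refl
  E-filter α p (a ∷ as) F S with p a
  ... | true  = e-cong α a (E-filter α p as F) S
  ... | false = trans (e-cong α a (E-filter α p as F) S) (e-E-comm α α a (filterᵇ p as) _ S)

  -- The value of E α as F at S only involves the sets S ─ R with R ⊆ as.
  E-local : ∀ α c (C : Subset n) as {F G} → (∀ {a} → a ∈ₗ as → a ∉ C) →
            ∀ S → C ⊆ S → (∀ S′ → C ⊆ S′ → S′ ⊆ S → F S′ ≡ c * G S′) → E α as F S ≡ c * E α as G S
  E-local α c C []       dis S C⊆S h = h S C⊆S ⊆-refl
  E-local α c C (a ∷ as) {F} {G} dis S C⊆S h with a ∈? S
  ... | no m  = trans (ℤₚ.+-identityʳ _) (trans (E-local α c C as (dis ∘ there) S C⊆S h) (cong (c *_) (sym (ℤₚ.+-identityʳ _))))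
  ... | yes m = trans (cong₂ (λ y z → y + α * z) (E-local α c C as (dis ∘ there) S C⊆S h)
                        (E-local α c C as (dis ∘ there) (S ∖ a) (λ b∈C → ∈-∖ (C⊆S b∈C) (λ { refl → dis (here refl) b∈C }))
                           (λ S′ p q → h S′ p (∈∖⇒∈ ∘ q))))
                      (lem α c (E α as G S) (E α as G (S ∖ a)))
    where
    lem : ∀ α c f g → c * f + α * (c * g) ≡ c * (f + α * g)
    lem = solve-∀

  E-smaller : ∀ α as {F G : Subset n → ℤ} k → (∀ S′ → ∣ S′ ∣ ℕ.< k → F S′ ≡ G S′) → ∀ S → ∣ S ∣ ℕ.< k → E α as F S ≡ E α as G S
  E-smaller α []       k h S S<k = h S S<k
  E-smaller α (a ∷ as) k h S S<k with a ∈? S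
  ... | no m  = cong (_+ 0ℤ) (E-smaller α as k h S S<k)
  ... | yes m = cong₂ (λ y z → y + α * z) (E-smaller α as k h S S<k)
                  (E-smaller α as k h (S ∖ a) (ℕₚ.<-trans (ℕₚ.≤-reflexive (sym (∣∖∣ m))) S<k))

  -- Every summand except the one with nothing deleted is taken at a smaller set, where `F` and `G`
  -- agree. Hence `F S - G S` passes through the operator with coefficient 1; the identity is
  -- arranged so as to avoid subtraction.
  E-leading : ∀ α as {F G : Subset n → ℤ} S → (∀ S′ → ∣ S′ ∣ ℕ.< ∣ S ∣ → F S′ ≡ G S′) → E α as F S + G S ≡ E α as G S + F S
  E-leading α [] {F} {G} S h = ℤₚ.+-comm (F S) (G S)
  E-leading α (a ∷ as) {F} {G} S h with a ∈? S
  ... | no m  =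
      trans (cong (_+ G S) (ℤₚ.+-identityʳ (E α as F S))) (trans (E-leading α as S h) (cong (_+ F S) (sym (ℤₚ.+-identityʳ (E α as G S)))))
  ... | yes m = trans (lem (E α as F S) _ (G S)) (trans (cong₂ (λ y z → y + α * z) (E-leading α as S h)
                  (E-smaller α as ∣ S ∣ h (S ∖ a) (ℕₚ.≤-reflexive (sym (∣∖∣ m))))) (sym (lem (E α as G S) _ (F S))))
    where
    lem : ∀ x y z → (x + y) + z ≡ (x + z) + y
    lem = solve-∀

  E-+ : ∀ α as (F G : Subset n → ℤ) S → E α as (λ S′ → F S′ + G S′) S ≡ E α as F S + E α as G S
  E-+ α []       F G S = refl
  E-+ α (a ∷ as) F G S with a ∈? S
  ... | no m  = trans (cong (_+ 0ℤ) (E-+ α as F G S)) (lem (E α as F S) (E α as G S))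
    where
    lem : ∀ f g → (f + g) + 0ℤ ≡ (f + 0ℤ) + (g + 0ℤ)
    lem = solve-∀
  ... | yes m =
      trans (cong₂ (λ y z → y + α * z) (E-+ α as F G S) (E-+ α as F G (S ∖ a))) (lem α (E α as F S) (E α as G S) (E α as F (S ∖ a))
          (E α as G (S ∖ a)))
    where
    lem : ∀ α f g h k → (f + g) + α * (h + k) ≡ (f + α * h) + (g + α * k)
    lem = solve-∀

  E-* : ∀ α as c (F : Subset n → ℤ) S → E α as (λ S′ → c * F S′) S ≡ c * E α as F S
  E-* α as c F S = E-local α c ⊥ as (λ _ → ∉⊥) S (⊆-min S) (λ _ _ _ → refl)

  E-0 : ∀ α as (S : Subset n) → E α as (λ _ → 0ℤ) S ≡ 0ℤ
  E-0 α as S = E-* α as 0ℤ (λ _ → 0ℤ) S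

  E-∑ : ∀ {A : Set} α as (F : A → Subset n → ℤ) xs S → E α as (λ S′ → ∑ (λ x → F x S′) xs) S ≡ ∑ (λ x → E α as (F x) S) xs
  E-∑ α as F []       S = E-0 α as S
  E-∑ α as F (x ∷ xs) S = trans (E-+ α as (F x) _ S) (cong (E α as (F x) S +_) (E-∑ α as F xs S))

  _≟ₛ_ : (S T : Subset n) → Dec (S ≡ T)
  _≟ₛ_ = Vecₚ.≡-dec Bool._≟_

  δ : Subset n → Subset n → ℤ
  δ U S = [ U ≟ₛ S ] 1ℤ

  -- `K` is a combination of the functions `δ U`. The only deletion that leads from `S` to `U`
  -- removes exactly the letters of `S` outside `U`, so it must be available in `as`.
  E-δ-no : ∀ α as (U S : Subset n) → ¬ (U ⊆ S × (∀ {a} → a ∈ S → a ∉ U → a ∈ₗ as)) → E α as (δ U) S ≡ 0ℤ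
  E-δ-no α [] U S ¬c = []-no (U ≟ₛ S) (λ { refl → ¬c (⊆-refl , (λ m k → ⊥-elim (k m))) })
  E-δ-no α (a ∷ as) U S ¬c with a ∈? S
  ... | no m  = trans (ℤₚ.+-identityʳ _) (E-δ-no α as U S (λ { (p , q) → ¬c (p , (λ x y → there (q x y))) }))
  ... | yes m = trans (cong₂ (λ y z → y + α * z) (E-δ-no α as U S (λ { (p , q) → ¬c (p , (λ x y → there (q x y))) }))
                         (E-δ-no α as U (S ∖ a) (λ { (p , q) → ¬c ((∈∖⇒∈ ∘ p) , λ {b} → lem q {b}) })))
                      (trans (ℤₚ.+-identityˡ _) (ℤₚ.*-zeroʳ α))
    where
    lem : (∀ {b} → b ∈ S ∖ a → b ∉ U → b ∈ₗ as) → ∀ {b} → b ∈ S → b ∉ U → b ∈ₗ a ∷ as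
    lem q {b} x y with b Finₚ.≟ a
    ... | yes refl = here refl
    ... | no b≢a   = there (q (∈-∖ x b≢a) y)

  -- Each letter of `S` outside `U` is deleted once and contributes one factor `α`. A repeated entry
  -- of `as` would offer that deletion several times, hence `Unique as`.
  E-δ-yes : ∀ α as (U S : Subset n) → Unique as → U ⊆ S → (∀ {a} → a ∈ S → a ∉ U → a ∈ₗ as) →
            E α as (δ U) S ≡ α ^ (∣ S ∣ ℕ.∸ ∣ U ∣)
  E-δ-yes α [] U S _ U⊆S q = trans ([]-yes (U ≟ₛ S) U≡S)
      (sym (cong (α ^_) (trans (cong (λ z → ∣ S ∣ ℕ.∸ ∣ z ∣) U≡S) (ℕₚ.n∸n≡0 ∣ S ∣))))
    where
    U≡S : U ≡ S
    U≡S = ⊆-antisym U⊆S (λ {a} m → case a ∈? U of λ { (yes k) → k ; (no k) → case q m k of λ () })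
  E-δ-yes α (a ∷ as) U S (a∉as ∷ un) U⊆S q with a ∈? S
  ... | no m = trans (ℤₚ.+-identityʳ _) (E-δ-yes α as U S un U⊆S λ {b} → q′ {b})
    where
    q′ : ∀ {b} → b ∈ S → b ∉ U → b ∈ₗ as
    q′ x y with q x y
    ... | here refl = ⊥-elim (m x)
    ... | there k   = k
  ... | yes m with a ∈? U
  ... | yes k = trans (cong₂ (λ y z → y + α * z) (E-δ-yes α as U S un U⊆S λ {b} → q′ {b})
                         (E-δ-no α as U (S ∖ a) (λ { (p , _) → ∉-∖ (p k) })))
                      (trans (cong (α ^ (∣ S ∣ ℕ.∸ ∣ U ∣) +_) (ℤₚ.*-zeroʳ α)) (ℤₚ.+-identityʳ _))
    where
    q′ : ∀ {b} → b ∈ S → b ∉ U → b ∈ₗ as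
    q′ x y with q x y
    ... | here refl = ⊥-elim (y k)
    ... | there k   = k
  ... | no k = trans (cong₂ (λ y z → y + α * z) (E-δ-no α as U S (λ { (_ , q) → All.lookup a∉as (q m k) refl }))
                         (E-δ-yes α as U (S ∖ a) un U⊆S∖a λ {b} → q′ {b}))
                      (trans (ℤₚ.+-identityˡ _) (cong (α ^_) (sym (trans (cong (ℕ._∸ ∣ U ∣) (∣∖∣ m)) (ℕₚ.+-∸-assoc 1
                          (p⊆q⇒∣p∣≤∣q∣ U⊆S∖a))))))
    where
    U⊆S∖a : U ⊆ S ∖ a
    U⊆S∖a x = ∈-∖ (U⊆S x) (λ { refl → k x })
    q′ : ∀ {b} → b ∈ S ∖ a → b ∉ U → b ∈ₗ as
    q′ x y with q (∈∖⇒∈ x) y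
    ... | here refl = ⊥-elim (∉-∖ x)
    ... | there k   = k

  -- Components of building sets

  does-true : {P : Set} (d : Dec P) → does d ≡ true → P
  does-true (yes p) _ = p

  does-⇔ : {P Q : Set} (d : Dec P) (e : Dec Q) → (P → Q) → (Q → P) → does d ≡ does e
  does-⇔ (yes p) e f g = sym (dec-true e (f p))
  does-⇔ (no ¬p) e f g = sym (dec-false e (¬p ∘ g))

  ∧-true : ∀ {b c} → b ∧ c ≡ true → b ≡ true × c ≡ true
  ∧-true {true} h = refl , h

  ∧-intro : ∀ {b c} → b ≡ true → c ≡ true → b ∧ c ≡ true
  ∧-intro refl refl = refl

  bool-⇔ : ∀ {b c} → (b ≡ true → c ≡ true) → (c ≡ true → b ≡ true) → b ≡ c
  bool-⇔ {true}  {c}     f g = sym (f refl)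
  bool-⇔ {false} {true}  f g = g refl
  bool-⇔ {false} {false} f g = refl

  any⁺ : ∀ (p : A → Bool) {a as} → a ∈ₗ as → p a ≡ true → any p as ≡ true
  any⁺ p (here refl) h rewrite h = refl
  any⁺ p {as = b ∷ as} (there m) h rewrite any⁺ p m h = Boolₚ.∨-zeroʳ (p b)

  any⁻ : ∀ (p : A → Bool) as → any p as ≡ true → ∃ λ a → a ∈ₗ as × p a ≡ true
  any⁻ p (a ∷ as) h with p a in eq
  ... | true  = a , here refl , eq
  ... | false = case any⁻ p as h of λ { (b , m , k) → b , there m , k }

  all⁺ : ∀ (p : A → Bool) as → (∀ {a} → a ∈ₗ as → p a ≡ true) → all p as ≡ true
  all⁺ p []       h = refl
  all⁺ p (a ∷ as) h = ∧-intro (h (here refl)) (all⁺ p as (h ∘ there))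

  all⁻ : ∀ (p : A → Bool) {as} → all p as ≡ true → ∀ {a} → a ∈ₗ as → p a ≡ true
  all⁻ p {b ∷ as} h (here refl) = proj₁ (∧-true h)
  all⁻ p {b ∷ as} h (there m)   = all⁻ p (proj₂ (∧-true {p b} h)) m

  ∈-allSubsets : ∀ (S : Subset n) → S ∈ₗ allSubsets n
  ∈-allSubsets []      = here refl
  ∈-allSubsets {suc n} (b ∷ S) = lem b (allSubsets n) (∈-allSubsets S)
    where
    lem : ∀ b Ts → S ∈ₗ Ts → (b ∷ S) ∈ₗ concatMap (λ s → (outside ∷ s) ∷ (inside ∷ s) ∷ []) Ts
    lem false (T ∷ Ts) (here refl) = here refl
    lem true  (T ∷ Ts) (here refl) = there (here refl)
    lem b     (T ∷ Ts) (there m)   = there (there (lem b Ts m))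

  allSubsets-unique : ∀ n → Unique (allSubsets n)
  allSubsets-unique zero    = [] ∷ []
  allSubsets-unique (suc n) = lem (allSubsets-unique n)
    where
    fresh : ∀ {b S} {Ts : List (Subset n)} → All (S ≢_) Ts → All ((b ∷ S) ≢_) (concatMap (λ s → (outside ∷ s) ∷ (inside ∷ s) ∷ []) Ts)
    fresh []       = []
    fresh (p ∷ ps) = (p ∘ cong Vec.tail) ∷ (p ∘ cong Vec.tail) ∷ fresh ps
    lem : ∀ {Ts} → Unique Ts → Unique (concatMap (λ s → (outside ∷ s) ∷ (inside ∷ s) ∷ []) Ts)
    lem []       = []
    lem (p ∷ ps) = ((λ ()) ∷ fresh p) ∷ fresh p ∷ lem ps

  ∈-atLeast⁺ : ∀ {a x : Fin n} → toℕ a ℕ.≤ toℕ x → x ∈ atLeast a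
  ∈-atLeast⁺ {a = a} {x} a≤x = Vecₚ.lookup⇒[]= x _ (trans (Vecₚ.lookup∘tabulate _ x) lem)
    where
    lem : (if toℕ x ℕ.<ᵇ toℕ a then outside else inside) ≡ inside
    lem with toℕ x ℕ.<ᵇ toℕ a in eq
    ... | false = refl
    ... | true  = ⊥-elim (ℕₚ.<⇒≱ (ℕₚ.<ᵇ⇒< (toℕ x) (toℕ a) (subst T (sym eq) _)) a≤x)

  ∈-atLeast⁻ : ∀ {a x : Fin n} → x ∈ atLeast a → toℕ a ℕ.≤ toℕ x
  ∈-atLeast⁻ {a =
      a} {x} m with toℕ x ℕ.<ᵇ toℕ a in eq | trans (sym (Vecₚ.lookup∘tabulate (λ x → if toℕ x ℕ.<ᵇ toℕ a then outside else inside) x)) (Vecₚ.[]=⇒lookup m)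
  ... | true  | ()
  ... | false | _ = ℕₚ.≮⇒≥ (λ lt → subst T eq (ℕₚ.<⇒<ᵇ lt))

  IsMax : Subset n → Fin n → Set
  IsMax S m = m ∈ S × (∀ {b} → b ∈ S → toℕ b ℕ.≤ toℕ m)

  max-exists : ∀ (S : Subset n) → Nonempty S → ∃ (IsMax S)
  max-exists (b ∷ S) ne with nonempty? S
  ... | yes ne′ = case max-exists S ne′ of λ { (m , m∈S , mx) → suc m , there m∈S , λ { here → z≤n ; (there k) → s≤s (mx k) } }
  max-exists (b ∷ S) (zero  , here)    | no ¬ne = zero , here , λ { here → z≤n ; (there k) → ⊥-elim (¬ne (_ , k)) }
  max-exists (b ∷ S) (suc i , there k) | no ¬ne = ⊥-elim (¬ne (i , k))

  IsMax-unique : ∀ {S : Subset n} {m m′} → IsMax S m → IsMax S m′ → m ≡ m′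
  IsMax-unique (p , q) (p′ , q′) = Finₚ.toℕ-injective (ℕₚ.≤-antisym (q′ p) (q p′))

  -- C is the connected component of 𝓑|_S containing max S.
  record IsTop (𝓑 : Collection n) (S C : Subset n) : Set where
    field
      {m}     : Fin n
      max     : IsMax S m
      m∈C     : m ∈ C
      inside𝓑 : 𝓑 C ≡ true
      C⊆S     : C ⊆ S
      absorbs : ∀ {J a} → 𝓑 J ≡ true → J ⊆ S → a ∈ J → a ∈ C → J ⊆ C

  module Component (𝓑 : Collection n) (building : IsBuildingSet 𝓑) where

    singleton∈𝓑 : ∀ i → 𝓑 ⁅ i ⁆ ≡ true
    singleton∈𝓑 = proj₁ (proj₂ building)

    ∪∈𝓑 : ∀ {I J a} → 𝓑 I ≡ true → 𝓑 J ≡ true → a ∈ I → a ∈ J → 𝓑 (I ∪ J) ≡ true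
    ∪∈𝓑 {I} {J} {a} p q r s = proj₂ (proj₂ building) I J p q (a , x∈p∩q⁺ (r , s))

    joins : Subset n → Fin n → Subset n → Bool
    joins S m J = 𝓑 J ∧ (J ⊆ᵇ S) ∧ (m ∈ᵇ J)

    gather : Subset n → Fin n → List (Subset n) → Subset n
    gather S m = foldr (λ J U → if joins S m J then J ∪ U else U) ⁅ m ⁆

    joins-elim : ∀ {S m J} → joins S m J ≡ true → 𝓑 J ≡ true × J ⊆ S × m ∈ J
    joins-elim {S} {m} {J} h =
      let (p , h′) = ∧-true h ; (q , r) = ∧-true h′ in p , does-true (J ⊆? S) q , does-true (m ∈? J) r

    -- All sets that are joined share the element `m`, so each partial union stays in `𝓑`; the
    -- singleton of `m` is the member to start from.
    gather-spec : ∀ {S m} → m ∈ S → ∀ Js → let U = gather S m Js in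
                  𝓑 U ≡ true × m ∈ U × U ⊆ S × (∀ {J} → J ∈ₗ Js → joins S m J ≡ true → J ⊆ U)
    gather-spec {S} {m} m∈S [] = singleton∈𝓑 m , x∈⁅x⁆ m , (λ k → subst (_∈ S) (sym (x∈⁅y⁆⇒x≡y m k)) m∈S) , λ ()
    gather-spec {S} {m} m∈S (J ∷ Js) with joins S m J in eq | gather-spec m∈S Js
    ... | false | p , q , r , s = p , q , r , λ { (here refl) h → case trans (sym eq) h of λ () ; (there k) h → s k h }
    ... | true  | p , q , r , s = let (p′ , r′ , q′) = joins-elim eq in
        ∪∈𝓑 p′ p q′ q , x∈p∪q⁺ (inj₁ q′)
      , (λ k → case x∈p∪q⁻ J _ k of λ { (inj₁ x) → r′ x ; (inj₂ y) → r y })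
      , λ { (here refl) _ k → x∈p∪q⁺ (inj₁ k) ; (there l) h k → x∈p∪q⁺ (inj₂ (s l h k)) }

    top : Subset n → Subset n
    top S with nonempty? S
    ... | yes ne = gather S (proj₁ (max-exists S ne)) (allSubsets n)
    ... | no _   = ⊥

    top-spec : ∀ {S} → Nonempty S → IsTop 𝓑 S (top S)
    top-spec {S} ne′ with nonempty? S
    ... | no ¬ne = ⊥-elim (¬ne ne′)
    ... | yes ne with max-exists S ne
    ... | m , mx with gather-spec (proj₁ mx) (allSubsets n)
    ... | p , q , r , s = record
      { max = mx ; m∈C = q ; inside𝓑 = p ; C⊆S = r
      -- The union of `J` with the component is again a member of `𝓑` inside `S` through `m`, hence
      -- one of the sets that were gathered.
      ; absorbs = λ {J} {a} J∈𝓑 J⊆S a∈J a∈C k →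
          s (∈-allSubsets (J ∪ gather S m (allSubsets n)))
            (∧-intro (∪∈𝓑 J∈𝓑 p a∈J a∈C) (∧-intro
              (dec-true (_ ⊆? S) (λ l → case x∈p∪q⁻ J _ l of λ { (inj₁ x) → J⊆S x ; (inj₂ y) → r y }))
              (dec-true (m ∈? _) (x∈p∪q⁺ (inj₂ q)))))
            (x∈p∪q⁺ (inj₁ k)) }

    top⊆ : ∀ S → top S ⊆ S
    top⊆ S k with nonempty? S
    ... | no ¬ne = ⊥-elim (∉⊥ k)
    ... | yes ne = proj₁ (proj₂ (proj₂ (gather-spec (proj₁ (proj₂ (max-exists S ne))) (allSubsets n)))) k

    IsTop-unique : ∀ {S C D} → IsTop 𝓑 S C → IsTop 𝓑 S D → C ≡ D
    IsTop-unique c d with IsMax-unique (IsTop.max c) (IsTop.max d)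
    ... | refl = ⊆-antisym (IsTop.absorbs d (IsTop.inside𝓑 c) (IsTop.C⊆S c) (IsTop.m∈C c) (IsTop.m∈C d))
                           (IsTop.absorbs c (IsTop.inside𝓑 d) (IsTop.C⊆S d) (IsTop.m∈C d) (IsTop.m∈C c))

    IsTop⇒≡ : ∀ {S C} → IsTop 𝓑 S C → C ≡ top S
    IsTop⇒≡ c = IsTop-unique c (top-spec (_ , proj₁ (IsTop.max c)))

    top-restrict : ∀ {S S′} → Nonempty S → top S ⊆ S′ → S′ ⊆ S → top S′ ≡ top S
    top-restrict ne C⊆S′ S′⊆S = sym (IsTop⇒≡ (record
      { max = C⊆S′ m∈C , (λ k → proj₂ max (S′⊆S k)) ; m∈C = m∈C ; inside𝓑 = inside𝓑 ; C⊆S = C⊆S′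
      ; absorbs = λ J∈𝓑 J⊆S′ → absorbs J∈𝓑 (S′⊆S ∘ J⊆S′) }))
      where open IsTop (top-spec ne)

    module _ (chordal : IsChordal 𝓑) where

      -- By chordality the part of the component from `b` upwards is still in `𝓑`. It avoids `a`
      -- because `a < b`, and it joins `b` to the maximum of `S`, which survives the deletion
      -- because it is at least `b`.
      top-∖⁺ : ∀ {S a b} → toℕ a ℕ.< toℕ b → b ∈ top S → b ∈ top (S ∖ a)
      top-∖⁺ {S} {a} {b} a<b b∈C =
          IsTop.absorbs D (chordal (top S) b inside𝓑 b∈C) ⊆∖ (x∈p∩q⁺ (m∈C , ∈-atLeast⁺ (proj₂ max (C⊆S b∈C)))) m∈D
                                     (x∈p∩q⁺ (b∈C , ∈-atLeast⁺ ℕₚ.≤-refl))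
        where
        open IsTop (top-spec (b , top⊆ S b∈C))
        D = top-spec {S ∖ a} (b , ∈-∖ (top⊆ S b∈C) (λ { refl → ℕₚ.<-irrefl refl a<b }))
        m≢a : m ≢ a
        m≢a eq = ℕₚ.<⇒≱ a<b (subst (λ z → toℕ b ℕ.≤ toℕ z) eq (proj₂ max (C⊆S b∈C)))
        ⊆∖ : top S ∩ atLeast b ⊆ S ∖ a
        ⊆∖ k = case x∈p∩q⁻ (top S) _ k of λ { (x , y) → ∈-∖ (C⊆S x) λ { refl → ℕₚ.<⇒≱ a<b (∈-atLeast⁻ y) } }
        m∈D : m ∈ top (S ∖ a)
        m∈D = subst (_∈ top (S ∖ a)) (IsMax-unique (IsTop.max D) (∈-∖ (proj₁ max) m≢a , λ k → proj₂ max (∈∖⇒∈ k))) (IsTop.m∈C D)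

    top-∖⁻ : ∀ {S a b} → toℕ a ℕ.< toℕ b → b ∈ top (S ∖ a) → b ∈ top S
    top-∖⁻ {S} {a} {b} a<b b∈D = absorbs (IsTop.inside𝓑 D) (∈∖⇒∈ ∘ IsTop.C⊆S D) m∈D m∈C b∈D
      where
      b∈S : b ∈ S
      b∈S = ∈∖⇒∈ (top⊆ (S ∖ a) b∈D)
      open IsTop (top-spec (b , b∈S))
      D = top-spec {S ∖ a} (b , top⊆ (S ∖ a) b∈D)
      m≢a : m ≢ a
      m≢a eq = ℕₚ.<⇒≱ a<b (subst (λ z → toℕ b ℕ.≤ toℕ z) eq (proj₂ max b∈S))
      m∈D : m ∈ top (S ∖ a)
      m∈D = subst (_∈ top (S ∖ a)) (IsMax-unique (IsTop.max D) (∈-∖ (proj₁ max) m≢a , λ k → proj₂ max (∈∖⇒∈ k))) (IsTop.m∈C D)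

    sameComponent-top : ∀ {S m} a → IsMax S m → sameComponentᵇ 𝓑 S a m ≡ does (a ∈? top S)
    sameComponent-top {S} {m} a mx = bool-⇔ to from
      where
      C = top-spec (m , proj₁ mx)
      m∈C : m ∈ top S
      m∈C = subst (_∈ top S) (IsMax-unique (IsTop.max C) mx) (IsTop.m∈C C)
      to : sameComponentᵇ 𝓑 S a m ≡ true → does (a ∈? top S) ≡ true
      to h with any⁻ _ (allSubsets n) h
      ... | J , _ , k = case ∧-true k of λ { (p , k′) → case ∧-true k′ of λ { (q , k″) → case ∧-true k″ of λ { (r , s) →
        dec-true (a ∈? top S) (IsTop.absorbs C p (does-true (J ⊆? S) q) (does-true (m ∈? J) s) m∈C (does-true (a ∈? J) r)) } } }
      from : does (a ∈? top S) ≡ true → sameComponentᵇ 𝓑 S a m ≡ true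
      from h = any⁺ _ (∈-allSubsets (top S)) (∧-intro (IsTop.inside𝓑 C) (∧-intro (dec-true (top S ⊆? S) (IsTop.C⊆S C))
                 (∧-intro h (dec-true (m ∈? top S) m∈C))))

  -- Nested collections

  ∈-filterᵇ⁺ : ∀ (p : A → Bool) {a as} → a ∈ₗ as → p a ≡ true → a ∈ₗ filterᵇ p as
  ∈-filterᵇ⁺ p m h = ∈-filter⁺ (Boolₚ.T? ∘ p) m (subst T (sym h) _)

  ∈-filterᵇ⁻ : ∀ (p : A → Bool) {a as} → a ∈ₗ filterᵇ p as → a ∈ₗ as × p a ≡ true
  ∈-filterᵇ⁻ p {as = as} m = case ∈-filter⁻ (Boolₚ.T? ∘ p) {xs = as} m of λ { (k , h) → k , Equivalence.to Boolₚ.T-≡ h }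

  ⊈⇒∃ : ∀ (J U : Subset n) → ¬ J ⊆ U → ∃ λ a → a ∈ J × a ∉ U
  ⊈⇒∃ J U J⊈U with nonempty? (J ∩ ∁ U)
  ... | yes (a , k) = let (p , q) = x∈p∩q⁻ J (∁ U) k in a , p , x∈∁p⇒x∉p q
  ... | no ¬ne = ⊥-elim (J⊈U (λ {a} a∈J → case a ∈? U of λ { (yes k) → k ; (no k) → ⊥-elim (¬ne (a , x∈p∩q⁺ (a∈J , x∉p⇒x∈∁p k))) }))

  disjoint⁻ : ∀ {I J : Subset n} → disjointᵇ I J ≡ true → ∀ {a} → a ∈ I → a ∉ J
  disjoint⁻ {I = I} {J} h a∈I a∈J with nonempty? (I ∩ J)
  ... | no ¬ne = ¬ne (_ , x∈p∩q⁺ (a∈I , a∈J))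
  disjoint⁻ () a∈I a∈J | yes _

  disjoint⁺ : ∀ {I J : Subset n} → (∀ {a} → a ∈ I → a ∉ J) → disjointᵇ I J ≡ true
  disjoint⁺ {I = I} {J} h with nonempty? (I ∩ J)
  ... | no _ = refl
  ... | yes (a , k) = let (p , q) = x∈p∩q⁻ I J k in ⊥-elim (h p q)

  ⋃⁺ : ∀ {N : List (Subset n)} {I a} → I ∈ₗ N → a ∈ I → a ∈ ⋃ N
  ⋃⁺ (here refl) k = x∈p∪q⁺ (inj₁ k)
  ⋃⁺ (there m)   k = x∈p∪q⁺ (inj₂ (⋃⁺ m k))

  ⋃⁻ : ∀ (N : List (Subset n)) {a} → a ∈ ⋃ N → ∃ λ I → I ∈ₗ N × a ∈ I
  ⋃⁻ []      k = ⊥-elim (∉⊥ k)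
  ⋃⁻ (I ∷ N) k with x∈p∪q⁻ I (⋃ N) k
  ... | inj₁ p = I , here refl , p
  ... | inj₂ q = let (J , m , l) = ⋃⁻ N q in J , there m , l

  ⋃-↭ : ∀ {N M : List (Subset n)} → N ↭ M → ⋃ N ≡ ⋃ M
  ⋃-↭ {N = N} {M} p = ⊆-antisym (λ k → let (I , m , l) = ⋃⁻ N k in ⋃⁺ (∈-resp-↭ p m) l)
                                (λ k → let (I , m , l) = ⋃⁻ M k in ⋃⁺ (∈-resp-↭ (↭-sym p) m) l)

  sublists-∷⁻ : ∀ {M : List A} {a as} → M ∈ₗ sublists (a ∷ as) → M ∈ₗ sublists as ⊎ ∃ λ M′ → M′ ∈ₗ sublists as × M ≡ a ∷ M′
  sublists-∷⁻ {a = a} {as} m with ∈-++⁻ (sublists as) m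
  ... | inj₁ k = inj₁ k
  ... | inj₂ k = inj₂ (∈-map⁻ (a ∷_) k)

  sublists-skip : ∀ {M : List A} a as → M ∈ₗ sublists as → M ∈ₗ sublists (a ∷ as)
  sublists-skip a as m = ∈-++⁺ˡ m

  sublists-keep : ∀ {M : List A} a as → M ∈ₗ sublists as → (a ∷ M) ∈ₗ sublists (a ∷ as)
  sublists-keep a as m = ∈-++⁺ʳ (sublists as) (∈-map⁺ (a ∷_) m)

  ∈-sublists : ∀ {M : List A} {as} → M ∈ₗ sublists as → ∀ {a} → a ∈ₗ M → a ∈ₗ as
  ∈-sublists {as = []} (here refl) ()
  ∈-sublists {as = b ∷ as} m k with sublists-∷⁻ {as = as} m
  ... | inj₁ l = there (∈-sublists l k)
  ∈-sublists {as = b ∷ as} m (here refl) | inj₂ (M′ , l , refl) = here refl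
  ∈-sublists {as = b ∷ as} m (there k)   | inj₂ (M′ , l , refl) = there (∈-sublists l k)

  sublists-unique : ∀ {M : List A} {as} → Unique as → M ∈ₗ sublists as → Unique M
  sublists-unique {as = []} _ (here refl) = []
  sublists-unique {as = a ∷ as} (a∉ ∷ un) m with sublists-∷⁻ {as = as} m
  ... | inj₁ l = sublists-unique un l
  ... | inj₂ (M′ , l , refl) = All.tabulate (λ k → All.lookup a∉ (∈-sublists l k)) ∷ sublists-unique un l

  sublists-filter : ∀ (p : A → Bool) {M} as → M ∈ₗ sublists as → filterᵇ p M ∈ₗ sublists as
  sublists-filter p [] (here refl) = here refl
  sublists-filter p (a ∷ as) m with sublists-∷⁻ {as = as} m
  ... | inj₁ l = sublists-skip a as (sublists-filter p as l)
  ... | inj₂ (M′ , l , refl) with p a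
  ... | true  = sublists-keep a as (sublists-filter p as l)
  ... | false = sublists-skip a as (sublists-filter p as l)

  sublists-of-filter : ∀ (p : A → Bool) {M} as → M ∈ₗ sublists (filterᵇ p as) → M ∈ₗ sublists as
  sublists-of-filter p []       m = m
  sublists-of-filter p (a ∷ as) m with p a
  ... | false = sublists-skip a as (sublists-of-filter p as m)
  ... | true with sublists-∷⁻ {as = filterᵇ p as} m
  ... | inj₁ l = sublists-skip a as (sublists-of-filter p as l)
  ... | inj₂ (M′ , l , refl) = sublists-keep a as (sublists-of-filter p as l)

  Laminar : List (Subset n) → Set
  Laminar N = ∀ {I J} → I ∈ₗ N → J ∈ₗ N → I ⊆ J ⊎ J ⊆ I ⊎ (∀ {a} → a ∈ I → a ∉ J)

  pairwiseDisjoint-filter : ∀ p (M : List (Subset n)) → pairwiseDisjointᵇ M ≡ true → pairwiseDisjointᵇ (filterᵇ p M) ≡ true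
  pairwiseDisjoint-filter p []      h = refl
  pairwiseDisjoint-filter p (I ∷ M) h with p I
  ... | false = pairwiseDisjoint-filter p M (proj₂ (∧-true {all (disjointᵇ I) M} h))
  ... | true  =
      ∧-intro (all⁺ (disjointᵇ I) (filterᵇ p M) (λ k → all⁻ (disjointᵇ I) {M} (proj₁ (∧-true h)) (proj₁ (∈-filterᵇ⁻ p {as = M} k))))
                        (pairwiseDisjoint-filter p M (proj₂ (∧-true {all (disjointᵇ I) M} h)))

  -- Greedy choice: a new set `I` is either already covered, or it replaces the chosen sets that
  -- meet it. By laminarity such a set contains `I`, which is excluded, or lies inside `I`, so no
  -- point is lost.
  disjoint-cover : ∀ (M : List (Subset n)) → Laminar M →
                   ∃ λ T → T ∈ₗ sublists M × pairwiseDisjointᵇ T ≡ true × ⋃ M ⊆ ⋃ T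
  disjoint-cover []      lam = [] , here refl , refl , λ k → k
  disjoint-cover (I ∷ M) lam with disjoint-cover M (λ p q → lam (there p) (there q))
  ... | T , T∈ , dis , cov with I ⊆? ⋃ T
  ... | yes I⊆ = T , sublists-skip I M T∈ , dis , λ k → case x∈p∪q⁻ I (⋃ M) k of λ { (inj₁ p) → I⊆ p ; (inj₂ q) → cov q }
  ... | no I⊈ = I ∷ filterᵇ (disjointᵇ I) T , sublists-keep I M (sublists-filter (disjointᵇ I) M T∈)
      , ∧-intro (all⁺ (disjointᵇ I) _ (λ k → proj₂ (∈-filterᵇ⁻ (disjointᵇ I) {as = T} k))) (pairwiseDisjoint-filter _ T dis)
      , λ k → case x∈p∪q⁻ I (⋃ M) k of λ { (inj₁ p) → x∈p∪q⁺ (inj₁ p) ; (inj₂ q) → cover (⋃⁻ T (cov q)) }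
    where
    cover : ∀ {a} → (∃ λ J → J ∈ₗ T × a ∈ J) → a ∈ I ∪ ⋃ (filterᵇ (disjointᵇ I) T)
    cover (J , m , k) with lam (here refl) (there (∈-sublists T∈ m))
    ... | inj₁ I⊆J        = ⊥-elim (I⊈ (⋃⁺ m ∘ I⊆J))
    ... | inj₂ (inj₁ J⊆I) = x∈p∪q⁺ (inj₁ (J⊆I k))
    ... | inj₂ (inj₂ d)   = x∈p∪q⁺ (inj₂ (⋃⁺ (∈-filterᵇ⁺ (disjointᵇ I) m (disjoint⁺ d)) k))

  -- Given laminarity, the union condition on nested collections says that no
  -- J ∈ 𝓑 is covered by the members of N strictly contained in J.
  record Nested (𝓑 : Collection n) (N : List (Subset n)) : Set where
    field
      in𝓑     : ∀ {I} → I ∈ₗ N → 𝓑 I ≡ true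
      laminar : Laminar N
      private-point : ∀ J → 𝓑 J ≡ true → ∃ λ a → a ∈ J × (∀ {I} → I ∈ₗ N → I ⊆ J → a ∈ I → J ⊆ I)

  Nested-mono : ∀ {𝓑 : Collection n} {N M} → (∀ {I} → I ∈ₗ M → I ∈ₗ N) → Nested 𝓑 N → Nested 𝓑 M
  Nested-mono sub nst = record
    { in𝓑 = in𝓑 ∘ sub
    ; laminar = λ p q → laminar (sub p) (sub q)
    ; private-point = λ J J∈𝓑 → let (a , a∈J , h) = private-point J J∈𝓑 in a , a∈J , (λ m → h (sub m)) }
    where open Nested nst

  nestedᵇ : Collection n → List (Subset n) → Bool
  nestedᵇ 𝓑 N = all 𝓑 N ∧ pairwise (λ I J → (I ⊆ᵇ J) ∨ (J ⊆ᵇ I) ∨ disjointᵇ I J) N ∧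
    all (λ T → not ((2 ℕ.≤ᵇ length T) ∧ pairwiseDisjointᵇ T) ∨ not (𝓑 (⋃ T))) (sublists N)

  module Nestedness (𝓑 : Collection n) (building : IsBuildingSet 𝓑) where

    laminar-sound : ∀ {I J : Subset n} → (I ⊆ᵇ J) ∨ (J ⊆ᵇ I) ∨ disjointᵇ I J ≡ true → I ⊆ J ⊎ J ⊆ I ⊎ (∀ {a} → a ∈ I → a ∉ J)
    laminar-sound {I} {J} h with I ⊆? J
    ... | yes p = inj₁ p
    ... | no _ with J ⊆? I
    ... | yes q = inj₂ (inj₁ q)
    ... | no _  = inj₂ (inj₂ (disjoint⁻ h))

    laminar-complete : ∀ {I J : Subset n} → I ⊆ J ⊎ J ⊆ I ⊎ (∀ {a} → a ∈ I → a ∉ J) → (I ⊆ᵇ J) ∨ (J ⊆ᵇ I) ∨ disjointᵇ I J ≡ true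
    laminar-complete {I} {J} h with I ⊆? J
    ... | yes p = refl
    ... | no ¬p with J ⊆? I
    ... | yes q = refl
    laminar-complete (inj₁ p) | no ¬p | no ¬q = ⊥-elim (¬p p)
    laminar-complete (inj₂ (inj₁ q)) | no ¬p | no ¬q = ⊥-elim (¬q q)
    laminar-complete (inj₂ (inj₂ d)) | no ¬p | no ¬q = disjoint⁺ d

    -- If `J` had no private point, the members strictly inside `J` would cover it, and
    -- `disjoint-cover` would thin them to a disjoint family with union `J`. One strict subset
    -- cannot cover `J`, nor can the empty family since `J` is nonempty; so the family has at least
    -- two sets and violates the union condition.
    nested-sound : ∀ N → nestedᵇ 𝓑 N ≡ true → Nested 𝓑 N
    nested-sound N h = record
      { in𝓑 = all⁻ 𝓑 (proj₁ (∧-true h))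
      ; laminar = lam
      ; private-point = point }
      where
      h₂ = proj₂ (∧-true {all 𝓑 N} h)
      h₃ = proj₂ (∧-true {pairwise _ N} h₂)
      lam : Laminar N
      lam p q = laminar-sound (all⁻ _ (all⁻ _ {N} (proj₁ (∧-true h₂)) p) q)
      point : ∀ J → 𝓑 J ≡ true → ∃ λ a → a ∈ J × (∀ {I} → I ∈ₗ N → I ⊆ J → a ∈ I → J ⊆ I)
      point J J∈𝓑 = go (J ⊆? ⋃ M)
        where
        strict : Subset n → Bool
        strict I = (I ⊆ᵇ J) ∧ not (J ⊆ᵇ I)
        M = filterᵇ strict N
        strict⁻ : ∀ {I} → strict I ≡ true → I ⊆ J × ¬ J ⊆ I
        strict⁻ {I} k with I ⊆? J | J ⊆? I
        ... | yes p | no ¬q = p , ¬q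
        strict⁻ () | yes p | yes q
        strict⁻ () | no ¬p | q
        strict⁺ : ∀ {I} → I ⊆ J → ¬ J ⊆ I → strict I ≡ true
        strict⁺ {I} p ¬q = ∧-intro (dec-true (I ⊆? J) p) (cong not (dec-false (J ⊆? I) ¬q))
        ⋃≡J : ∀ {T} → T ∈ₗ sublists M → J ⊆ ⋃ T → ⋃ T ≡ J
        ⋃≡J {T} T∈ J⊆ = ⊆-antisym (λ k → let (K , m , l) = ⋃⁻ T k in
            proj₁ (strict⁻ (proj₂ (∈-filterᵇ⁻ strict {as = N} (∈-sublists T∈ m)))) l) J⊆
        uncoverable : ∀ T → T ∈ₗ sublists M → pairwiseDisjointᵇ T ≡ true → ¬ J ⊆ ⋃ T
        uncoverable [] _ _ J⊆ = let (a , a∈J) = proj₁ building J J∈𝓑 in ∉⊥ (J⊆ a∈J)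
        uncoverable (I ∷ []) T∈ _ J⊆ = proj₂ (strict⁻ (proj₂ (∈-filterᵇ⁻ strict {as = N} (∈-sublists T∈ (here refl)))))
          (λ k → case x∈p∪q⁻ I ⊥ (J⊆ k) of λ { (inj₁ p) → p ; (inj₂ q) → ⊥-elim (∉⊥ q) })
        uncoverable T@(I ∷ I′ ∷ T′) T∈ dis J⊆ with all⁻ _ h₃ (sublists-of-filter strict N T∈)
        ... | k rewrite dis | ⋃≡J T∈ J⊆ | J∈𝓑 = case k of λ ()
        go : Dec (J ⊆ ⋃ M) → ∃ λ a → a ∈ J × (∀ {I} → I ∈ₗ N → I ⊆ J → a ∈ I → J ⊆ I)
        go (no J⊈) = let (a , a∈J , a∉) = ⊈⇒∃ J (⋃ M) J⊈ in
          a , a∈J , λ {I} m I⊆J a∈I → case J ⊆? I of λ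
            { (yes q) → q ; (no ¬q) → ⊥-elim (a∉ (⋃⁺ (∈-filterᵇ⁺ strict m (strict⁺ I⊆J ¬q)) a∈I)) }
        go (yes J⊆) with disjoint-cover M (λ p q → lam (proj₁ (∈-filterᵇ⁻ strict p)) (proj₁ (∈-filterᵇ⁻ strict q)))
        ... | T , T∈ , dis , cov = ⊥-elim (uncoverable T T∈ dis (cov ∘ J⊆))

    -- A private point of the union of `T` lies in some member `K` of `T`, and then `K` is the whole
    -- union. But `T` has another member, which is nonempty and disjoint from `K`.
    nested-complete : ∀ N → Nested 𝓑 N → nestedᵇ 𝓑 N ≡ true
    nested-complete N nst = ∧-intro (all⁺ 𝓑 N in𝓑) (∧-intro
        (all⁺ _ N (λ p → all⁺ _ N (λ q → laminar-complete (laminar p q))))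
        (all⁺ _ (sublists N) (λ {T} m → union T (λ k → ∈-sublists m k))))
      where
      open Nested nst
      union : ∀ T → (∀ {I} → I ∈ₗ T → I ∈ₗ N) → not ((2 ℕ.≤ᵇ length T) ∧ pairwiseDisjointᵇ T) ∨ not (𝓑 (⋃ T)) ≡ true
      union []       sub = refl
      union (I ∷ []) sub = refl
      union T@(I ∷ I′ ∷ T′) sub with pairwiseDisjointᵇ T in dis | 𝓑 (⋃ T) in ∈𝓑
      ... | false | _     = refl
      ... | true  | false = refl
      ... | true  | true with private-point (⋃ T) ∈𝓑
      ... | a , a∈ , h with ⋃⁻ T a∈
      ... | K , here refl , a∈K =
        let (b , b∈I′) = proj₁ building I′ (in𝓑 (sub (there (here refl))))
        in ⊥-elim (disjoint⁻ {I = I} {I′} (all⁻ (disjointᵇ I) {I′ ∷ T′} (proj₁ (∧-true dis)) (here refl))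
                     (h (sub (here refl)) (⋃⁺ {N = T} (here refl)) a∈K (⋃⁺ {N = T} (there (here refl)) b∈I′)) b∈I′)
      ... | K , there m , a∈K =
        let (b , b∈I) = proj₁ building I (in𝓑 (sub (here refl)))
        in ⊥-elim (disjoint⁻ {I = I} {K} (all⁻ (disjointᵇ I) {I′ ∷ T′} (proj₁ (∧-true dis)) m) b∈I
                     (h (sub (there m)) (⋃⁺ {N = T} (there m)) a∈K (⋃⁺ {N = T} (here refl) b∈I)))

    nested? : ∀ N → Dec (Nested 𝓑 N)
    nested? N = map′ (nested-sound N) (nested-complete N) (nestedᵇ 𝓑 N Bool.≟ true)

    does-nested? : ∀ N → does (nested? N) ≡ nestedᵇ 𝓑 N
    does-nested? N with nestedᵇ 𝓑 N
    ... | true  = refl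
    ... | false = refl

    -- Taking `J = I` in the private-point condition gives every member a point of its own, and by
    -- laminarity two members owning the same point coincide. So `N` injects into `S`. This makes
    -- the truncated exponents of `t` genuine differences.
    nested-card : ∀ {N S} → Unique N → Nested 𝓑 N → (∀ {I} → I ∈ₗ N → I ⊆ S) → length N ℕ.≤ ∣ S ∣
    nested-card {N} {S} un nst sub = go N S un (λ m → m)
        (λ m → let (a , a∈I , h) = private-point _ (in𝓑 m) in a , sub m a∈I , a∈I , h)
      where
      open Nested nst
      Owns : Subset n → Fin n → Set
      Owns I a = a ∈ I × (∀ {J} → J ∈ₗ N → J ⊆ I → a ∈ J → I ⊆ J)
      owner-unique : ∀ {I J a} → I ∈ₗ N → J ∈ₗ N → Owns I a → Owns J a → I ≡ J
      owner-unique p q (a∈I , h) (a∈J , k) with laminar p q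
      ... | inj₁ I⊆J        = ⊆-antisym I⊆J (k p I⊆J a∈I)
      ... | inj₂ (inj₁ J⊆I) = ⊆-antisym (h q J⊆I a∈J) J⊆I
      ... | inj₂ (inj₂ d)   = ⊥-elim (d a∈I a∈J)
      go : ∀ M U → Unique M → (∀ {I} → I ∈ₗ M → I ∈ₗ N) → (∀ {I} → I ∈ₗ M → ∃ λ a → a ∈ U × Owns I a) → length M ℕ.≤ ∣ U ∣
      go []      U _ _ _ = z≤n
      go (I ∷ M) U (I∉ ∷ un) inc own with own (here refl)
      ... | a , a∈U , o = subst (suc (length M) ℕ.≤_) (sym (∣∖∣ a∈U)) (s≤s (go M (U ∖ a) un (inc ∘ there) λ m →
        let (b , b∈U , o′) = own (there m) in b , ∈-∖ b∈U (λ { refl → All.lookup I∉ m (owner-unique (inc (here refl)) (inc (there m)) o o′) }) , o′))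

  -- The generating function of nested collections and its recursion

  []-*-zero : ∀ {P : Set} (d : Dec P) {y z} → (P → z ≡ 0ℤ) → ([ d ] y) * z ≡ 0ℤ
  []-*-zero (yes p) {y} h = trans (cong (y *_) (h p)) (ℤₚ.*-zeroʳ y)
  []-*-zero (no _)  h = refl

  ∑-sublists-[] : ∀ {A : Set} (g : List A → ℤ) → (∀ a N → g (a ∷ N) ≡ 0ℤ) → ∀ as → ∑ g (sublists as) ≡ g []
  ∑-sublists-[] g h []       = ℤₚ.+-identityʳ _
  ∑-sublists-[] g h (a ∷ as) = trans (∑-sublists-∷ g a as)
    (trans (∑-cong (λ N → trans (cong (g N +_) (h a N)) (ℤₚ.+-identityʳ _)) (sublists as)) (∑-sublists-[] g h as))

  elements : Subset n → List (Fin n)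
  elements {n} C = filterᵇ (_∈ᵇ C) (allFin n)

  ∈-elements⁺ : ∀ {C : Subset n} {a} → a ∈ C → a ∈ₗ elements C
  ∈-elements⁺ {C = C} {a} a∈C = ∈-filterᵇ⁺ (_∈ᵇ C) (∈-allFin a) (dec-true (a ∈? C) a∈C)

  ∈-elements⁻ : ∀ {C : Subset n} {a} → a ∈ₗ elements C → a ∈ C
  ∈-elements⁻ {n} {C} {a} m = does-true (a ∈? C) (proj₂ (∈-filterᵇ⁻ (_∈ᵇ C) {as = allFin n} m))

  elements-unique : ∀ (C : Subset n) → Unique (elements C)
  elements-unique {n} C = Uniqueₚ.filter⁺ (Boolₚ.T? ∘ (_∈ᵇ C)) (Uniqueₚ.allFin⁺ n)

  disjoint-card : ∀ {X U : Subset n} → disjointᵇ X U ≡ true → ∣ X ∣ ℕ.≤ ∣ ∁ U ∣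
  disjoint-card {X = X} {U} dis = p⊆q⇒∣p∣≤∣q∣ {p = X} {∁ U} (λ p → x∉p⇒x∈∁p (disjoint⁻ {I = X} {U} dis p))

  ∣U∣+∣∁U∣ : ∀ (U : Subset n) → ∣ U ∣ ℕ.+ ∣ ∁ U ∣ ≡ n
  ∣U∣+∣∁U∣ U = trans (cong (∣ U ∣ ℕ.+_) (∣∁p∣≡n∸∣p∣ U)) (ℕₚ.m+[n∸m]≡n (∣p∣≤n U))

  -- Only subsets of the complement of `U` contribute, and each element of the complement
  -- independently gives 1 if it is chosen and `t` if it is not.
  ∑-subsets-disjoint : ∀ t (U : Subset n) →
    ∑ (λ X → when (disjointᵇ X U) (t ^ (∣ ∁ U ∣ ℕ.∸ ∣ X ∣))) (allSubsets n) ≡ (1ℤ + t) ^ ∣ ∁ U ∣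
  ∑-subsets-disjoint {zero}  t []      = refl
  ∑-subsets-disjoint {suc n} t (u ∷ U) = begin
    ∑ h (allSubsets (suc n)) ≡⟨ ∑-concatMap h _ (allSubsets n) ⟩
    ∑ (λ X → h (outside ∷ X) + (h (inside ∷ X) + 0ℤ)) (allSubsets n) ≡⟨ step u ⟩
    (1ℤ + t) ^ ∣ ∁ (u ∷ U) ∣ ∎
    where
    open ≡-Reasoning
    h : Subset (suc n) → ℤ
    h X = when (disjointᵇ X (u ∷ U)) (t ^ (∣ ∁ (u ∷ U) ∣ ℕ.∸ ∣ X ∣))
    disjoint-∷ : ∀ b c X → b ∧ c ≡ false → disjointᵇ (b ∷ X) (c ∷ U) ≡ disjointᵇ X U
    disjoint-∷ b c X bc = bool-⇔ (λ k → disjoint⁺ (λ p q → disjoint⁻ {I = b ∷ X} {c ∷ U} k (there p) (there q)))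
                                (λ k → disjoint⁺ {I = b ∷ X} {c ∷ U} (lem k bc))
      where
      lem : ∀ {b c} → disjointᵇ X U ≡ true → b ∧ c ≡ false → ∀ {a} → a ∈ b ∷ X → a ∉ c ∷ U
      lem k bc (there p) (there q) = disjoint⁻ k p q
      lem k () here here
    step : ∀ u → ∑ (λ X → when (disjointᵇ (outside ∷ X) (u ∷ U)) (t ^ (∣ ∁ (u ∷ U) ∣ ℕ.∸ ∣ X ∣))
                       + (when (disjointᵇ (inside ∷ X) (u ∷ U)) (t ^ (∣ ∁ (u ∷ U) ∣ ℕ.∸ suc ∣ X ∣)) + 0ℤ)) (allSubsets n)
           ≡ (1ℤ + t) ^ ∣ ∁ (u ∷ U) ∣
    step true = trans (∑-cong (λ X → begin
        when (disjointᵇ (outside ∷ X) (true ∷ U)) (t ^ (∣ ∁ U ∣ ℕ.∸ ∣ X ∣)) + (0ℤ + 0ℤ) ≡⟨ ℤₚ.+-identityʳ _ ⟩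
        when (disjointᵇ (outside ∷ X) (true ∷ U)) (t ^ (∣ ∁ U ∣ ℕ.∸ ∣ X ∣))
          ≡⟨ cong (λ b → when b (t ^ (∣ ∁ U ∣ ℕ.∸ ∣ X ∣))) (disjoint-∷ false true X refl) ⟩
        when (disjointᵇ X U) (t ^ (∣ ∁ U ∣ ℕ.∸ ∣ X ∣)) ∎) (allSubsets n)) (∑-subsets-disjoint t U)
    step false = trans (∑-cong (λ X → begin
        when (disjointᵇ (outside ∷ X) (false ∷ U)) (t ^ (suc ∣ ∁ U ∣ ℕ.∸ ∣ X ∣)) + (when (disjointᵇ (inside ∷ X) (false ∷ U)) (t ^
            (∣ ∁ U ∣ ℕ.∸ ∣ X ∣)) + 0ℤ)
          ≡⟨ cong₂ (λ b c → when b (t ^ (suc ∣ ∁ U ∣ ℕ.∸ ∣ X ∣)) + (when c (t ^ (∣ ∁ U ∣ ℕ.∸ ∣ X ∣)) + 0ℤ))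
              (disjoint-∷ false false X refl) (disjoint-∷ true false X refl) ⟩
        when (disjointᵇ X U) (t ^ (suc ∣ ∁ U ∣ ℕ.∸ ∣ X ∣)) + (when (disjointᵇ X U) (t ^ (∣ ∁ U ∣ ℕ.∸ ∣ X ∣)) + 0ℤ)
          ≡⟨ combine X ⟩
        (1ℤ + t) * when (disjointᵇ X U) (t ^ (∣ ∁ U ∣ ℕ.∸ ∣ X ∣)) ∎) (allSubsets n))
        (trans (∑-* (1ℤ + t) _ (allSubsets n)) (cong ((1ℤ + t) *_) (∑-subsets-disjoint t U)))
      where
      ring : ∀ t z → t * z + (z + 0ℤ) ≡ (1ℤ + t) * z
      ring = solve-∀
      combine : ∀ X → when (disjointᵇ X U) (t ^ (suc ∣ ∁ U ∣ ℕ.∸ ∣ X ∣)) + (when (disjointᵇ X U) (t ^ (∣ ∁ U ∣ ℕ.∸ ∣ X ∣)) + 0ℤ)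
                ≡ (1ℤ + t) * when (disjointᵇ X U) (t ^ (∣ ∁ U ∣ ℕ.∸ ∣ X ∣))
      combine X with disjointᵇ X U in eq
      ... | false = sym (ℤₚ.*-zeroʳ (1ℤ + t))
      ... | true rewrite ℕₚ.+-∸-assoc 1 (disjoint-card {X = X} {U} eq) = ring t (t ^ (∣ ∁ U ∣ ℕ.∸ ∣ X ∣))

  module NestedSum (𝓑 : Collection n) (building : IsBuildingSet 𝓑) (t : ℤ) where

    open Component 𝓑 building
    open Nestedness 𝓑 building

    weight : List (Subset n) → ℤ
    weight N = [ nested? N ] (t ^ (∣ ⋃ N ∣ ℕ.∸ length N))

    -- K S = Σ t^(|S| - |N|) over the nested collections N with union S.
    K : Subset n → ℤ
    K S = ∑ (λ N → weight N * δ (⋃ N) S) (sublists (allSubsets n))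

    weight-↭ : ∀ {N M} → N ↭ M → weight N ≡ weight M
    weight-↭ {N} {M} p = []-cong (nested? N) (nested? M) (Nested-mono (∈-resp-↭ (↭-sym p))) (Nested-mono (∈-resp-↭ p))
      (λ _ → cong₂ (λ U k → t ^ (∣ U ∣ ℕ.∸ k)) (⋃-↭ p) (↭-length p))

    E-K : ∀ α as S → E α as K S ≡ ∑ (λ N → weight N * E α as (δ (⋃ N)) S) (sublists (allSubsets n))
    E-K α as S = trans (E-∑ α as _ (sublists (allSubsets n)) S) (∑-cong (λ N → E-* α as (weight N) (δ (⋃ N)) S) (sublists (allSubsets n)))

    members⊆⋃ : ∀ {N : List (Subset n)} {I} → I ∈ₗ N → I ⊆ ⋃ N
    members⊆⋃ m k = ⋃⁺ m k

    module _ {S : Subset n} (ne : Nonempty S) where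

      private
        C = top S
        as = elements C
        open IsTop (top-spec ne) hiding (m)

      -- The collections that survive in `E t as K` at `S`: whatever part of `S` they leave
      -- uncovered has to be deleted, hence must lie in `C`.
      Ok : List (Subset n) → Set
      Ok N = Nested 𝓑 N × ⋃ N ⊆ S × S ⊆ ⋃ N ∪ C

      ok? : ∀ N → Dec (Ok N)
      ok? N = nested? N ×-dec ((⋃ N ⊆? S) ×-dec (S ⊆? (⋃ N ∪ C)))

      summand : List (Subset n) → ℤ
      summand N = weight N * E t as (δ (⋃ N)) S

      -- The deleted letters supply the powers of `t` missing between the union of `N` and `S`, so
      -- the result depends on `N` only through its length.
      summand-yes : ∀ {N} → Unique N → Ok N → summand N ≡ t ^ (∣ S ∣ ℕ.∸ length N)
      summand-yes {N} un (nst , ⋃⊆S , S⊆) = begin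
        weight N * E t as (δ (⋃ N)) S
          ≡⟨ cong₂ _*_ ([]-yes (nested? N) nst) (E-δ-yes t as (⋃ N) S (elements-unique C) ⋃⊆S (λ {a} → covered {a})) ⟩
        t ^ (∣ ⋃ N ∣ ℕ.∸ length N) * t ^ (∣ S ∣ ℕ.∸ ∣ ⋃ N ∣) ≡⟨ ℤₚ.^-distribˡ-+-* t (∣ ⋃ N ∣ ℕ.∸ length N) _ ⟨
        t ^ (∣ ⋃ N ∣ ℕ.∸ length N ℕ.+ (∣ S ∣ ℕ.∸ ∣ ⋃ N ∣)) ≡⟨ cong (t ^_) exponent ⟩
        t ^ (∣ S ∣ ℕ.∸ length N) ∎
        where
        open ≡-Reasoning
        covered : ∀ {a} → a ∈ S → a ∉ ⋃ N → a ∈ₗ as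
        covered a∈S a∉ with x∈p∪q⁻ (⋃ N) C (S⊆ a∈S)
        ... | inj₁ p = ⊥-elim (a∉ p)
        ... | inj₂ q = ∈-elements⁺ q
        exponent : ∣ ⋃ N ∣ ℕ.∸ length N ℕ.+ (∣ S ∣ ℕ.∸ ∣ ⋃ N ∣) ≡ ∣ S ∣ ℕ.∸ length N
        exponent = begin
          ∣ ⋃ N ∣ ℕ.∸ length N ℕ.+ (∣ S ∣ ℕ.∸ ∣ ⋃ N ∣) ≡⟨ ℕₚ.+-comm (∣ ⋃ N ∣ ℕ.∸ length N) _ ⟩
          ∣ S ∣ ℕ.∸ ∣ ⋃ N ∣ ℕ.+ (∣ ⋃ N ∣ ℕ.∸ length N) ≡⟨ ℕₚ.+-∸-assoc (∣ S ∣ ℕ.∸ ∣ ⋃ N ∣) (nested-card un nst members⊆⋃) ⟨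
          ∣ S ∣ ℕ.∸ ∣ ⋃ N ∣ ℕ.+ ∣ ⋃ N ∣ ℕ.∸ length N ≡⟨ cong (ℕ._∸ length N) (ℕₚ.m∸n+n≡m (p⊆q⇒∣p∣≤∣q∣ ⋃⊆S)) ⟩
          ∣ S ∣ ℕ.∸ length N ∎

      summand-no : ∀ {N} → ¬ Ok N → summand N ≡ 0ℤ
      summand-no {N} ¬ok = []-*-zero (nested? N) (λ nst → E-δ-no t as (⋃ N) S λ { (⋃⊆S , h) →
        ¬ok (nst , ⋃⊆S , λ {a} a∈S → case a ∈? ⋃ N of λ
          { (yes p) → x∈p∪q⁺ (inj₁ p) ; (no p) → x∈p∪q⁺ (inj₂ (∈-elements⁻ (h a∈S p))) }) })

      term-yes : ∀ {N} → Nested 𝓑 N → ⋃ N ≡ S → weight N * δ (⋃ N) S ≡ t ^ (∣ S ∣ ℕ.∸ length N)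
      term-yes {N} nst refl = trans (cong₂ _*_ ([]-yes (nested? N) nst) ([]-yes (⋃ N ≟ₛ ⋃ N) refl)) (ℤₚ.*-identityʳ _)

      term-no : ∀ {N} → ¬ (Nested 𝓑 N × ⋃ N ≡ S) → weight N * δ (⋃ N) S ≡ 0ℤ
      term-no {N} h = []-*-zero (nested? N) (λ nst → []-no (⋃ N ≟ₛ S) (λ eq → h (nst , eq)))

      -- A member of `N` that meets `C` is absorbed by it, which gives laminarity. For `J` not
      -- inside `S`, a point outside `S` lies in no member at all. For `J` inside `S` the old
      -- private point still serves: if it lies in `C`, then `C` absorbs `J`.
      ok-∷ : ∀ {N} → Ok N → Ok (C ∷ N)
      ok-∷ {N} (nst , ⋃⊆S , S⊆) = record { in𝓑 = in′ ; laminar = lam ; private-point = point }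
        , (λ k → case x∈p∪q⁻ C (⋃ N) k of λ { (inj₁ p) → C⊆S p ; (inj₂ q) → ⋃⊆S q })
        , (λ k → case x∈p∪q⁻ (⋃ N) C (S⊆ k) of λ { (inj₁ p) → x∈p∪q⁺ (inj₁ (x∈p∪q⁺ (inj₂ p))) ; (inj₂ q) → x∈p∪q⁺ (inj₂ q) })
        where
        open Nested nst
        in′ : ∀ {I} → I ∈ₗ C ∷ N → 𝓑 I ≡ true
        in′ (here refl) = inside𝓑
        in′ (there m)   = in𝓑 m
        member⊆S : ∀ {I} → I ∈ₗ N → I ⊆ S
        member⊆S m k = ⋃⊆S (⋃⁺ m k)
        versusC : ∀ {I} → I ∈ₗ N → I ⊆ C ⊎ (∀ {a} → a ∈ I → a ∉ C)
        versusC {I} m with nonempty? (I ∩ C)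
        ... | yes (a , k) = let (p , q) = x∈p∩q⁻ I C k in inj₁ (absorbs (in𝓑 m) (member⊆S m) p q)
        ... | no ¬ne      = inj₂ (λ p q → ¬ne (_ , x∈p∩q⁺ (p , q)))
        lam : Laminar (C ∷ N)
        lam (here refl) (here refl) = inj₁ (λ k → k)
        lam (here refl) (there q) with versusC q
        ... | inj₁ J⊆C = inj₂ (inj₁ J⊆C)
        ... | inj₂ d   = inj₂ (inj₂ (λ a∈C a∈J → d a∈J a∈C))
        lam (there p) (here refl) with versusC p
        ... | inj₁ I⊆C = inj₁ I⊆C
        ... | inj₂ d   = inj₂ (inj₂ d)
        lam (there p) (there q) = laminar p q
        point : ∀ J → 𝓑 J ≡ true → ∃ λ a → a ∈ J × (∀ {I} → I ∈ₗ C ∷ N → I ⊆ J → a ∈ I → J ⊆ I)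
        point J J∈𝓑 with J ⊆? S
        ... | no J⊈S = let (a , a∈J , a∉S) = ⊈⇒∃ J S J⊈S in
          a , a∈J , λ { (here refl) _ a∈C → ⊥-elim (a∉S (C⊆S a∈C)) ; (there m) _ a∈I → ⊥-elim (a∉S (member⊆S m a∈I)) }
        ... | yes J⊆S = let (a , a∈J , h) = private-point J J∈𝓑 in
          a , a∈J , λ { (here refl) C⊆J a∈C → absorbs J∈𝓑 J⊆S a∈J a∈C ; (there m) I⊆J a∈I → h m I⊆J a∈I }

      ok-∷⁻ : ∀ {N} → Ok (C ∷ N) → Ok N
      ok-∷⁻ {N} (nst , ⋃⊆S , S⊆) = Nested-mono there nst , (λ k → ⋃⊆S (x∈p∪q⁺ (inj₂ k)))
        , (λ k → case x∈p∪q⁻ (C ∪ ⋃ N) C (S⊆ k) of λ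
            { (inj₁ p) → case x∈p∪q⁻ C (⋃ N) p of λ { (inj₁ c) → x∈p∪q⁺ (inj₂ c) ; (inj₂ u) → x∈p∪q⁺ (inj₁ u) }
            ; (inj₂ q) → x∈p∪q⁺ (inj₂ q) })

      ok⇒⋃≡ : ∀ {N} → Ok (C ∷ N) → ⋃ (C ∷ N) ≡ S
      ok⇒⋃≡ {N} (nst , ⋃⊆S , S⊆) = ⊆-antisym ⋃⊆S (λ k → case x∈p∪q⁻ (C ∪ ⋃ N) C (S⊆ k) of λ { (inj₁ p) → p ; (inj₂ q) → x∈p∪q⁺ (inj₁ q) })

      -- Some member `I` covers the private point of `C`. It meets `C`, so it is absorbed by `C`;
      -- privacy of the point gives the reverse inclusion.
      C-forced : ∀ {N} → Nested 𝓑 N → ⋃ N ≡ S → C ∈ₗ N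
      C-forced {N} nst eq with Nested.private-point nst C inside𝓑
      ... | a , a∈C , h with ⋃⁻ N (subst (a ∈_) (sym eq) (C⊆S a∈C))
      ... | I , m , a∈I = subst (_∈ₗ N) (⊆-antisym I⊆C (h m I⊆C a∈I)) m
        where
        I⊆C : I ⊆ C
        I⊆C = absorbs (Nested.in𝓑 nst m) (λ k → subst (_ ∈_) eq (⋃⁺ m k)) a∈I a∈C

      -- Without `C` the union cannot be `S`, so the right side has a single term `z`. On the left
      -- both collections survive or neither does; the one lacking `C` has one member less, which
      -- gives `t * z + z`.
      pair-identity : ∀ {N} → Unique (C ∷ N) →
        summand N + summand (C ∷ N) ≡ (1ℤ + t) * (weight N * δ (⋃ N) S + weight (C ∷ N) * δ (⋃ (C ∷ N)) S)
      pair-identity {N} (C∉N ∷ un) = go (ok? (C ∷ N))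
        where
        kN≡0 : weight N * δ (⋃ N) S ≡ 0ℤ
        kN≡0 = term-no {N} (λ { (nst , eq) → All.lookup C∉N (C-forced nst eq) refl })
        ring : ∀ t z → t * z + z ≡ (1ℤ + t) * (0ℤ + z)
        ring = solve-∀
        go : Dec (Ok (C ∷ N)) → summand N + summand (C ∷ N) ≡ (1ℤ + t) * (weight N * δ (⋃ N) S + weight (C ∷ N) * δ (⋃ (C ∷ N)) S)
        go (no ¬ok) = trans (cong₂ _+_ (summand-no {N} (¬ok ∘ ok-∷)) (summand-no ¬ok))
          (sym (trans (cong ((1ℤ + t) *_) (cong₂ _+_ kN≡0 (term-no {C ∷ N} (λ { (nst , eq) →
            ¬ok (nst , ⊆-reflexive eq , λ k → x∈p∪q⁺ (inj₁ (subst (_ ∈_) (sym eq) k))) })))) (ℤₚ.*-zeroʳ (1ℤ + t))))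
        go (yes ok) = trans (cong₂ _+_ (trans (summand-yes un (ok-∷⁻ ok)) (cong (t ^_) exponent)) (summand-yes (C∉N ∷ un) ok))
          (trans (ring t (t ^ (∣ S ∣ ℕ.∸ suc (length N))))
            (sym (cong ((1ℤ + t) *_) (cong₂ _+_ kN≡0 (term-yes {C ∷ N} (proj₁ ok) (ok⇒⋃≡ ok))))))
          where
          exponent : ∣ S ∣ ℕ.∸ length N ≡ suc (∣ S ∣ ℕ.∸ suc (length N))
          exponent = ℕₚ.+-∸-assoc 1 {∣ S ∣} {suc (length N)} (nested-card (C∉N ∷ un) (proj₁ ok) (λ m k → proj₁ (proj₂ ok) (⋃⁺ m k)))

      K-recursion : E t as K S ≡ (1ℤ + t) * K S
      K-recursion with ∈-∃++ (∈-allSubsets C)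
      ... | ys , zs , eq = begin
        E t as K S ≡⟨ E-K t as S ⟩
        ∑ summand (sublists (allSubsets n))
          ≡⟨ ∑-sublists-↭ summand (λ p → cong₂ _*_ (weight-↭ p) (cong (λ U → E t as (δ U) S) (⋃-↭ p))) moved ⟩
        ∑ summand (sublists (C ∷ rest)) ≡⟨ ∑-sublists-∷ summand C rest ⟩
        ∑ (λ N → summand N + summand (C ∷ N)) (sublists rest) ≡⟨ ∑-cong-∈ (sublists rest) (λ {N} m → pair-identity (unique-∷ m)) ⟩
        ∑ (λ N → (1ℤ + t) * (k N + k (C ∷ N))) (sublists rest) ≡⟨ ∑-* (1ℤ + t) _ (sublists rest) ⟩
        (1ℤ + t) * ∑ (λ N → k N + k (C ∷ N)) (sublists rest) ≡⟨ cong ((1ℤ + t) *_) (∑-sublists-∷ k C rest) ⟨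
        (1ℤ + t) * ∑ k (sublists (C ∷ rest))
          ≡⟨ cong ((1ℤ + t) *_) (∑-sublists-↭ k (λ p → cong₂ _*_ (weight-↭ p) (cong (λ U → δ U S) (⋃-↭ p))) moved) ⟨
        (1ℤ + t) * K S ∎
        where
        open ≡-Reasoning
        rest = ys ++ zs
        moved : allSubsets n ↭ C ∷ rest
        moved = ↭-trans (↭-reflexive eq) (shift C ys zs)
        k : List (Subset n) → ℤ
        k N = weight N * δ (⋃ N) S
        unique-rest : Unique (C ∷ rest)
        unique-rest = PermSetoid.Unique-resp-↭ (setoid (Subset n)) (↭⇒↭ₛ moved) (allSubsets-unique n)
        unique-∷ : ∀ {N} → N ∈ₗ sublists rest → Unique (C ∷ N)
        unique-∷ m = sublists-unique unique-rest (sublists-keep C rest m)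

    K-⊥ : K ⊥ ≡ 1ℤ
    K-⊥ = trans (∑-sublists-[] _ (λ I N → []-*-zero (nested? (I ∷ N)) (λ nst → []-no (⋃ (I ∷ N) ≟ₛ ⊥) (λ eq →
              let (a , a∈I) = proj₁ building I (Nested.in𝓑 nst (here refl)) in ∉⊥ (subst (a ∈_) eq (⋃⁺ {N = I ∷ N} (here refl) a∈I)))))
            (allSubsets n))
          (cong₂ _*_ (trans ([]-yes (nested? []) nested-[]) (cong (t ^_) (∣⊥∣≡0 n))) ([]-yes (⊥ {n} ≟ₛ ⊥) {1ℤ} refl))
      where
      nested-[] : Nested 𝓑 []
      nested-[] =
          record { in𝓑 = λ () ; laminar = λ () ; private-point = λ J J∈𝓑 → let (a , a∈J) = proj₁ building J J∈𝓑 in a , a∈J , λ () }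

    isENC-split : ∀ N X → isENCᵇ 𝓑 N X ≡ nestedᵇ 𝓑 N ∧ disjointᵇ X (⋃ N)
    isENC-split N X = trans (assoc₄ (all 𝓑 N) (pairwise _ N) (all _ (sublists N)) (all (disjointᵇ X) N)) (cong (nestedᵇ 𝓑 N ∧_) (bool-⇔
        (λ h → disjoint⁺ (λ p q → let (I , m , k) = ⋃⁻ N q in disjoint⁻ {I = X} {I} (all⁻ (disjointᵇ X) h m) p k))
        (λ h → all⁺ (disjointᵇ X) N (λ {I} m → disjoint⁺ {I = X} {I} (λ p q → disjoint⁻ {I = X} {⋃ N} h p (⋃⁺ m q))))))
      where
      assoc₄ : ∀ a b c d → a ∧ b ∧ c ∧ d ≡ (a ∧ b ∧ c) ∧ d
      assoc₄ true  true  c d = refl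
      assoc₄ true  false c d = refl
      assoc₄ false b     c d = refl

    -- The symbols `x_i` of an extended nested collection form an arbitrary subset of the complement
    -- of the union of `N`. Summing over them yields a power of `1ℤ + t`, which is the coefficient
    -- of `δ (⋃ N)` at `⊤` under deletion of all letters with weight `1ℤ + t`.
    ∑-ENC : ∑ (λ NX → t ^ (n ℕ.∸ (length (proj₁ NX) ℕ.+ ∣ proj₂ NX ∣))) (allENC 𝓑) ≡ E (1ℤ + t) (allFin n) K ⊤
    ∑-ENC = begin
      ∑ f (allENC 𝓑) ≡⟨ ∑-filter f _ (concatMap (λ N → map (N ,_) (allSubsets n)) (sublists (allSubsets n))) ⟩
      ∑ (λ NX → when (isENCᵇ 𝓑 (proj₁ NX) (proj₂ NX)) (f NX)) (concatMap (λ N → map (N ,_) (allSubsets n)) (sublists (allSubsets n)))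
        ≡⟨ ∑-concatMap _ (λ N → map (N ,_) (allSubsets n)) (sublists (allSubsets n)) ⟩
      ∑ (λ N → ∑ (λ NX → when (isENCᵇ 𝓑 (proj₁ NX) (proj₂ NX)) (f NX)) (map (N ,_) (allSubsets n))) (sublists (allSubsets n))
        ≡⟨ ∑-cong-∈ (sublists (allSubsets n)) (λ {N} m → inner (sublists-unique (allSubsets-unique n) m)) ⟩
      ∑ (λ N → weight N * E (1ℤ + t) (allFin n) (δ (⋃ N)) ⊤) (sublists (allSubsets n)) ≡⟨ E-K (1ℤ + t) (allFin n) ⊤ ⟨
      E (1ℤ + t) (allFin n) K ⊤ ∎
      where
      open ≡-Reasoning
      f : List (Subset n) × Subset n → ℤ
      f NX = t ^ (n ℕ.∸ (length (proj₁ NX) ℕ.+ ∣ proj₂ NX ∣))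
      exponent : ∀ {k u x c} → k ℕ.≤ u → x ℕ.≤ c → u ℕ.+ c ℕ.∸ (k ℕ.+ x) ≡ (u ℕ.∸ k) ℕ.+ (c ℕ.∸ x)
      exponent {k} {u} {x} {c} k≤u x≤c = begin
        u ℕ.+ c ℕ.∸ (k ℕ.+ x) ≡⟨ cong₂ (λ y z → y ℕ.+ z ℕ.∸ (k ℕ.+ x)) (ℕₚ.m+[n∸m]≡n k≤u) (ℕₚ.m+[n∸m]≡n x≤c) ⟨
        (k ℕ.+ (u ℕ.∸ k)) ℕ.+ (x ℕ.+ (c ℕ.∸ x)) ℕ.∸ (k ℕ.+ x) ≡⟨ cong (ℕ._∸ (k ℕ.+ x)) (ring k (u ℕ.∸ k) x (c ℕ.∸ x)) ⟩
        (k ℕ.+ x) ℕ.+ ((u ℕ.∸ k) ℕ.+ (c ℕ.∸ x)) ℕ.∸ (k ℕ.+ x) ≡⟨ ℕₚ.m+n∸m≡n (k ℕ.+ x) _ ⟩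
        (u ℕ.∸ k) ℕ.+ (c ℕ.∸ x) ∎
        where
        ring : ∀ a b c d → (a ℕ.+ b) ℕ.+ (c ℕ.+ d) ≡ (a ℕ.+ c) ℕ.+ (b ℕ.+ d)
        ring = ℕSolver.solve-∀
      inner : ∀ {N} → Unique N → ∑ (λ NX → when (isENCᵇ 𝓑 (proj₁ NX) (proj₂ NX)) (f NX)) (map (N ,_) (allSubsets n))
              ≡ weight N * E (1ℤ + t) (allFin n) (δ (⋃ N)) ⊤
      inner {N} un = begin
        ∑ (λ NX → when (isENCᵇ 𝓑 (proj₁ NX) (proj₂ NX)) (f NX)) (map (N ,_) (allSubsets n)) ≡⟨ ∑-map _ (N ,_) (allSubsets n) ⟩
        ∑ (λ X → when (isENCᵇ 𝓑 N X) (f (N , X))) (allSubsets n)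
          ≡⟨ ∑-cong (λ X → trans (cong (λ b → when b (f (N , X))) (trans (isENC-split N X) (cong (_∧ disjointᵇ X (⋃ N)) (sym
              (does-nested? N))))) (when-∧ (does (nested? N)) _ _)) (allSubsets n) ⟩
        ∑ (λ X → [ nested? N ] when (disjointᵇ X (⋃ N)) (f (N , X))) (allSubsets n) ≡⟨ ∑-when (does (nested? N)) _ (allSubsets n) ⟩
        [ nested? N ] ∑ (λ X → when (disjointᵇ X (⋃ N)) (f (N , X))) (allSubsets n)
          ≡⟨ []-cong (nested? N) (nested? N) (λ z → z) (λ z → z) value ⟩
        [ nested? N ] (E (1ℤ + t) (allFin n) (δ (⋃ N)) ⊤ * t ^ (∣ ⋃ N ∣ ℕ.∸ length N))
          ≡⟨ when-* (does (nested? N)) (E (1ℤ + t) (allFin n) (δ (⋃ N)) ⊤) _ ⟩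
        E (1ℤ + t) (allFin n) (δ (⋃ N)) ⊤ * weight N ≡⟨ ℤₚ.*-comm _ (weight N) ⟩
        weight N * E (1ℤ + t) (allFin n) (δ (⋃ N)) ⊤ ∎
        where
        U = ⋃ N
        value : Nested 𝓑 N → ∑ (λ X → when (disjointᵇ X U) (f (N , X))) (allSubsets n)
            ≡ E (1ℤ + t) (allFin n) (δ U) ⊤ * t ^ (∣ U ∣ ℕ.∸ length N)
        value nst = begin
          ∑ (λ X → when (disjointᵇ X U) (f (N , X))) (allSubsets n)
            ≡⟨ ∑-cong (λ X → trans (when-cong (disjointᵇ X U) (power X)) (when-* (disjointᵇ X U) (t ^ (∣ U ∣ ℕ.∸ length N)) _))
                (allSubsets n) ⟩
          ∑ (λ X → t ^ (∣ U ∣ ℕ.∸ length N) * when (disjointᵇ X U) (t ^ (∣ ∁ U ∣ ℕ.∸ ∣ X ∣))) (allSubsets n)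
            ≡⟨ ∑-* (t ^ (∣ U ∣ ℕ.∸ length N)) _ (allSubsets n) ⟩
          t ^ (∣ U ∣ ℕ.∸ length N) * ∑ (λ X → when (disjointᵇ X U) (t ^ (∣ ∁ U ∣ ℕ.∸ ∣ X ∣))) (allSubsets n)
            ≡⟨ ℤₚ.*-comm (t ^ (∣ U ∣ ℕ.∸ length N)) _ ⟩
          ∑ (λ X → when (disjointᵇ X U) (t ^ (∣ ∁ U ∣ ℕ.∸ ∣ X ∣))) (allSubsets n) * t ^ (∣ U ∣ ℕ.∸ length N)
            ≡⟨ cong (_* t ^ (∣ U ∣ ℕ.∸ length N)) (∑-subsets-disjoint t U) ⟩
          (1ℤ + t) ^ ∣ ∁ U ∣ * t ^ (∣ U ∣ ℕ.∸ length N)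
            ≡⟨ cong (λ k → (1ℤ + t) ^ k * t ^ (∣ U ∣ ℕ.∸ length N)) (trans (∣∁p∣≡n∸∣p∣ U) (cong (ℕ._∸ ∣ U ∣) (sym (∣⊤∣≡n n)))) ⟩
          (1ℤ + t) ^ (∣ ⊤ {n} ∣ ℕ.∸ ∣ U ∣) * t ^ (∣ U ∣ ℕ.∸ length N)
            ≡⟨ cong (_* t ^ (∣ U ∣ ℕ.∸ length N)) (E-δ-yes (1ℤ + t) (allFin n) U ⊤ (Uniqueₚ.allFin⁺ n) ⊆⊤ (λ {a} _ _ → ∈-allFin a)) ⟨
          E (1ℤ + t) (allFin n) (δ U) ⊤ * t ^ (∣ U ∣ ℕ.∸ length N) ∎
          where
          power : ∀ X → disjointᵇ X U ≡ true → f (N , X) ≡ t ^ (∣ U ∣ ℕ.∸ length N) * t ^ (∣ ∁ U ∣ ℕ.∸ ∣ X ∣)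
          power X dis =
              trans (cong (t ^_) (trans (cong (ℕ._∸ (length N ℕ.+ ∣ X ∣)) (sym (∣U∣+∣∁U∣ U))) (exponent (nested-card un nst members⊆⋃)
                  (disjoint-card {X = X} {U} dis))))
                              (ℤₚ.^-distribˡ-+-* t (∣ U ∣ ℕ.∸ length N) _)

    ENC-card : ∀ {NX} → NX ∈ₗ allENC 𝓑 → length (proj₁ NX) ℕ.+ ∣ proj₂ NX ∣ ℕ.≤ n
    ENC-card {N , X} m with ∈-filterᵇ⁻ _ {as = concatMap (λ N → map (N ,_) (allSubsets n)) (sublists (allSubsets n))} m
    ... | k , h with find (∈-concatMap⁻ (λ N → map (N ,_) (allSubsets n)) {xs = sublists (allSubsets n)} k)
    ... | N′ , N∈ , l with ∈-map⁻ (N′ ,_) l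
    ... | _ , _ , refl =
      let (nst , dis) = ∧-true (trans (sym (isENC-split N X)) h) in
      ℕₚ.≤-trans (ℕₚ.+-mono-≤ (nested-card (sublists-unique (allSubsets-unique n) N∈) (nested-sound N nst) members⊆⋃)
          (disjoint-card {X = X} {⋃ N} dis))
                 (ℕₚ.≤-reflexive (∣U∣+∣∁U∣ (⋃ N)))

  -- Words and their descending runs

  E-zero : ∀ as (F : Subset n → ℤ) S → E 0ℤ as F S ≡ F S
  E-zero []       F S = refl
  E-zero (a ∷ as) F S with a ∈? S
  ... | yes _ = trans (cong (_+ 0ℤ) (E-zero as F S)) (ℤₚ.+-identityʳ (F S))
  ... | no _  = trans (cong (_+ 0ℤ) (E-zero as F S)) (ℤₚ.+-identityʳ (F S))

  E-⊥ : ∀ α as (F : Subset n → ℤ) → E α as F ⊥ ≡ F ⊥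
  E-⊥ α []       F = refl
  E-⊥ α (a ∷ as) F = trans (e-∉ α (E α as F) ∉⊥) (E-⊥ α as F)

  filterᵇ-cong : ∀ {A : Set} {p q : A → Bool} as → (∀ {a} → a ∈ₗ as → p a ≡ q a) → filterᵇ p as ≡ filterᵇ q as
  filterᵇ-cong []       h = refl
  filterᵇ-cong {p = p} {q} (a ∷ as) h with p a | q a | h (here refl)
  ... | true  | _ | refl = cong (a ∷_) (filterᵇ-cong as (h ∘ there))
  ... | false | _ | refl = filterᵇ-cong as (h ∘ there)

  split-sorted : ∀ {A : Set} {R : A → A → Set} pre {a post} → AllPairs R (pre ++ a ∷ post) → (∀ {b} → b ∈ₗ pre → R b a) × (∀ {b} →
      b ∈ₗ post → R a b)
  split-sorted []        (h ∷ _)  = (λ ()) , All.lookup h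
  split-sorted (b ∷ pre) (h ∷ hs) =
      (λ { (here refl) → All.lookup h (∈-++⁺ʳ pre (here refl)) ; (there m) → proj₁ (split-sorted pre hs) m })
                                  , proj₂ (split-sorted pre hs)

  allFin-sorted : ∀ n → AllPairs (λ a b → toℕ a ℕ.< toℕ b) (allFin n)
  allFin-sorted n = AllPairsₚ.tabulate⁺-< (λ i<j → i<j)

  _<ᶠ_ : Fin n → Fin n → Bool
  a <ᶠ b = toℕ a ℕ.<ᵇ toℕ b

  <ᵇ-true : ∀ {i j : ℕ} → i ℕ.< j → (i ℕ.<ᵇ j) ≡ true
  <ᵇ-true lt = Equivalence.to Boolₚ.T-≡ (ℕₚ.<⇒<ᵇ lt)

  <ᵇ-false : ∀ {i j : ℕ} → j ℕ.≤ i → (i ℕ.<ᵇ j) ≡ false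
  <ᵇ-false {i} {j} le with i ℕ.<ᵇ j in eq
  ... | false = refl
  ... | true  = ⊥-elim (ℕₚ.<⇒≱ (ℕₚ.<ᵇ⇒< i j (subst T (sym eq) _)) le)

  above : Fin n → List (Fin n) → Bool
  above a []      = false
  above a (b ∷ w) = a <ᶠ b

  module Runs (x : ℤ) where

    -- Words are read backwards (last letter first), so descents of the original
    -- word are ascents here.  A maximal descending run contributes 1 + x if it
    -- has one letter, x if it has two, and 0 otherwise.
    runWeight : List (Fin n) → ℤ
    runWeight []          = 1ℤ
    runWeight (a ∷ [])    = 1ℤ + x
    runWeight (a ∷ b ∷ w) = if a <ᶠ b then (if above b w then 0ℤ else x * runWeight w) else (1ℤ + x) * runWeight (b ∷ w)

    -- The sum of α^j · runWeight over the words obtained by deleting the last j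
    -- letters, as long as these continue a descending run ending in a.
    tails : ℤ → Fin n → List (Fin n) → ℤ
    tails α a []      = 1ℤ
    tails α a (b ∷ w) = runWeight (b ∷ w) + when (a <ᶠ b) (α * tails α b w)

    -- No deleted letter precedes the word, so the first deletion is unconditional, unlike in
    -- `tails`.
    allTails : ℤ → List (Fin n) → ℤ
    allTails α []      = 1ℤ
    allTails α (a ∷ w) = runWeight (a ∷ w) + α * tails α a w

    runWeight-single : ∀ (a : Fin n) w → above a w ≡ false → runWeight (a ∷ w) ≡ (1ℤ + x) * runWeight w
    runWeight-single a []      h = sym (ℤₚ.*-identityʳ (1ℤ + x))
    runWeight-single a (b ∷ w) h rewrite h = refl

    tails-single : ∀ α (a : Fin n) w → above a w ≡ false → tails α a w ≡ runWeight w
    tails-single α a []      h = refl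
    tails-single α a (b ∷ w) h rewrite h = ℤₚ.+-identityʳ _

    tails-descent : ∀ α (a b : Fin n) w → a <ᶠ b ≡ true → tails α a (b ∷ w) ≡ allTails α (b ∷ w)
    tails-descent α a b w h rewrite h = refl

    -- With `V` the weight of what precedes the final run, the only remainders of the run with
    -- nonzero weight have two, one or no letters and give `x * V`, `(1ℤ + x) * V` and `V`, each
    -- deletion bringing a factor `α`. Longer runs reduce to this by induction, since their own
    -- weight is 0.
    allTails-descent : ∀ α → x + α * ((1ℤ + x) + α) ≡ 0ℤ → ∀ (a : Fin n) w → above a w ≡ true → allTails α (a ∷ w) ≡ 0ℤ
    allTails-descent α root a (b ∷ w) h =
        trans (cong (λ z → runWeight (a ∷ b ∷ w) + α * z) (tails-descent α a b w h)) (go (above b w) refl)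
      where
      open ≡-Reasoning
      ring : ∀ x α V → x * V + α * ((1ℤ + x) * V + α * V) ≡ (x + α * ((1ℤ + x) + α)) * V
      ring = solve-∀
      go : ∀ c → above b w ≡ c → runWeight (a ∷ b ∷ w) + α * allTails α (b ∷ w) ≡ 0ℤ
      go true eq rewrite h | eq = trans (ℤₚ.+-identityˡ _) (trans (cong (α *_) (allTails-descent α root b w eq)) (ℤₚ.*-zeroʳ α))
      go false eq = begin
        runWeight (a ∷ b ∷ w) + α * (runWeight (b ∷ w) + α * tails α b w)
          ≡⟨ cong₂ _+_ two (cong (α *_) (cong₂ (λ y z → y + α * z) (runWeight-single b w eq) (tails-single α b w eq))) ⟩
        x * runWeight w + α * ((1ℤ + x) * runWeight w + α * runWeight w) ≡⟨ ring x α (runWeight w) ⟩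
        (x + α * ((1ℤ + x) + α)) * runWeight w ≡⟨ cong (_* runWeight w) root ⟩
        0ℤ ∎
        where
        two : runWeight (a ∷ b ∷ w) ≡ x * runWeight w
        two rewrite h | eq = refl

    -- When the final run is longer than one letter both sides vanish. For a single letter the two
    -- sides are `(1ℤ + x) * V - V` and `x * ((1ℤ + x) * V - x * V)`, both equal to `x * V`.
    allTails-relation : ∀ (a : Fin n) w → allTails (- 1ℤ) (a ∷ w) ≡ x * allTails (- x) (a ∷ w)
    allTails-relation a w = go (above a w) refl
      where
      open ≡-Reasoning
      root₁ : ∀ x → x + - 1ℤ * ((1ℤ + x) + - 1ℤ) ≡ 0ℤ
      root₁ = solve-∀
      root₂ : ∀ x → x + - x * ((1ℤ + x) + - x) ≡ 0ℤ
      root₂ = solve-∀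
      ring : ∀ x V → (1ℤ + x) * V + - 1ℤ * V ≡ x * ((1ℤ + x) * V + - x * V)
      ring = solve-∀
      value : ∀ α → above a w ≡ false → allTails α (a ∷ w) ≡ (1ℤ + x) * runWeight w + α * runWeight w
      value α eq = cong₂ (λ y z → y + α * z) (runWeight-single a w eq) (tails-single α a w eq)
      go : ∀ c → above a w ≡ c → allTails (- 1ℤ) (a ∷ w) ≡ x * allTails (- x) (a ∷ w)
      go true  eq = trans (allTails-descent (- 1ℤ) (root₁ x) a w eq)
                          (sym (trans (cong (x *_) (allTails-descent (- x) (root₂ x) a w eq)) (ℤₚ.*-zeroʳ x)))
      go false eq = trans (value (- 1ℤ) eq) (trans (ring x (runWeight w)) (sym (cong (x *_) (value (- x) eq))))

  module Words (𝓑 : Collection n) (building : IsBuildingSet 𝓑) where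

    open Component 𝓑 building

    -- The sum of f over the 𝓑-partial permutations using exactly the letters S,
    -- |S| = k, read backwards.
    𝒲 : ℕ → Subset n → (List (Fin n) → ℤ) → ℤ
    𝒲 zero    S f = f []
    𝒲 (suc k) S f = ∑ (λ a → [ a ∈? top S ] 𝒲 k (S ∖ a) (λ w → f (a ∷ w))) (allFin n)

    𝒲-cong : ∀ k S {f g} → (∀ w → f w ≡ g w) → 𝒲 k S f ≡ 𝒲 k S g
    𝒲-cong zero    S h = h []
    𝒲-cong (suc k) S h = ∑-cong (λ a → cong ([ a ∈? top S ]_) (𝒲-cong k (S ∖ a) (λ w → h (a ∷ w)))) (allFin n)

    𝒲-+ : ∀ k S f g → 𝒲 k S (λ w → f w + g w) ≡ 𝒲 k S f + 𝒲 k S g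
    𝒲-+ zero    S f g = refl
    𝒲-+ (suc k) S f g =
        trans (∑-cong (λ a → trans (cong ([ a ∈? top S ]_) (𝒲-+ k (S ∖ a) _ _)) (when-+ (does (a ∈? top S)) _ _)) (allFin n))
                              (∑-+ _ _ (allFin n))

    𝒲-* : ∀ k S c f → 𝒲 k S (λ w → c * f w) ≡ c * 𝒲 k S f
    𝒲-* zero    S c f = refl
    𝒲-* (suc k) S c f =
        trans (∑-cong (λ a → trans (cong ([ a ∈? top S ]_) (𝒲-* k (S ∖ a) c _)) (when-* (does (a ∈? top S)) c _)) (allFin n))
                              (∑-* c _ (allFin n))

    𝒲-when : ∀ k S b f → 𝒲 k S (λ w → when b (f w)) ≡ when b (𝒲 k S f)
    𝒲-when k S true  f = refl
    𝒲-when k S false f = 𝒲-* k S 0ℤ (λ _ → 0ℤ)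

    𝒱 : Subset n → (List (Fin n) → ℤ) → ℤ
    𝒱 S = 𝒲 ∣ S ∣ S

    𝒱-empty : ∀ {S} f → ¬ Nonempty S → 𝒱 S f ≡ f []
    𝒱-empty f ¬ne = trans (cong (λ S → 𝒱 S f) (Empty-unique ¬ne)) (cong (λ k → 𝒲 k ⊥ f) (∣⊥∣≡0 n))

    𝒱-step : ∀ {S} f → Nonempty S → 𝒱 S f ≡ ∑ (λ a → [ a ∈? top S ] 𝒱 (S ∖ a) (λ w → f (a ∷ w))) (allFin n)
    𝒱-step {S} f (b , b∈S) rewrite ∣∖∣ b∈S = ∑-cong (λ a → []-cong (a ∈? top S) (a ∈? top S) (λ z → z) (λ z → z)
      (λ a∈ → cong (λ k → 𝒲 k (S ∖ a) (λ w → f (a ∷ w))) (ℕₚ.suc-injective (trans (sym (∣∖∣ b∈S)) (∣∖∣ (top⊆ S a∈)))))) (allFin n)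

    module _ (x : ℤ) where

      open Runs x

      Γ : Subset n → ℤ
      Γ S = 𝒱 S runWeight

      Γ-⊥ : Γ ⊥ ≡ 1ℤ
      Γ-⊥ = 𝒱-empty runWeight (λ { (_ , k) → ∉⊥ k })

      private
        next : ℤ → Subset n → Fin n → ℤ
        next α S a = [ a ∈? top S ] (α * 𝒱 (S ∖ a) (tails α a))

      -- The next deleted letter must exceed `a`, and since `allFin n` is increasing, the letters
      -- exceeding `a` are exactly those of `post`. This is what lets the order in which `E`
      -- processes letters encode the descending condition.
      𝒲-tails : ∀ α pre a post → pre ++ a ∷ post ≡ allFin n → ∀ S →
                𝒱 S (tails α a) ≡ Γ S + ∑ (next α S) post
      𝒲-tails α pre a post eq S = go (nonempty? S)
        where
        open ≡-Reasoning
        expand : ∀ b → [ b ∈? top S ] 𝒱 (S ∖ b) (λ w → runWeight (b ∷ w) + when (a <ᶠ b) (α * tails α b w))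
                     ≡ [ b ∈? top S ] 𝒱 (S ∖ b) (λ w → runWeight (b ∷ w)) + when (a <ᶠ b) (next α S b)
        expand b = begin
          [ b ∈? top S ] 𝒲 k V (λ w → runWeight (b ∷ w) + when (a <ᶠ b) (α * tails α b w))
            ≡⟨ cong ([ b ∈? top S ]_) (trans (𝒲-+ k V (λ w → runWeight (b ∷ w)) (λ w → when (a <ᶠ b) (α * tails α b w))) (cong (𝒲 k V
                (λ w → runWeight (b ∷ w)) +_)
                 (trans (𝒲-when k V (a <ᶠ b) (λ w → α * tails α b w)) (cong (when (a <ᶠ b)) (𝒲-* k V α (tails α b)))))) ⟩
          [ b ∈? top S ] (𝒲 k V (λ w → runWeight (b ∷ w)) + when (a <ᶠ b) (α * 𝒲 k V (tails α b)))
            ≡⟨ when-+ (does (b ∈? top S)) (𝒲 k V (λ w → runWeight (b ∷ w))) (when (a <ᶠ b) (α * 𝒲 k V (tails α b))) ⟩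
          [ b ∈? top S ] 𝒲 k V (λ w → runWeight (b ∷ w)) + [ b ∈? top S ] when (a <ᶠ b) (α * 𝒲 k V (tails α b))
            ≡⟨ cong ([ b ∈? top S ] 𝒲 k V (λ w → runWeight (b ∷ w)) +_) (when-comm (does (b ∈? top S)) (a <ᶠ b) (α * 𝒲 k V (tails α b))) ⟩
          [ b ∈? top S ] 𝒲 k V (λ w → runWeight (b ∷ w)) + when (a <ᶠ b) (next α S b) ∎
          where
          V = S ∖ b
          k = ∣ S ∖ b ∣
        sorted : AllPairs (λ a b → toℕ a ℕ.< toℕ b) (pre ++ a ∷ post)
        sorted = subst (AllPairs _) (sym eq) (allFin-sorted n)
        restrict : ∑ (λ b → when (a <ᶠ b) (next α S b)) (allFin n) ≡ ∑ (next α S) post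
        restrict = begin
          ∑ (λ b → when (a <ᶠ b) (next α S b)) (allFin n) ≡⟨ cong (∑ (λ b → when (a <ᶠ b) (next α S b))) eq ⟨
          ∑ (λ b → when (a <ᶠ b) (next α S b)) (pre ++ a ∷ post) ≡⟨ ∑-++ _ pre (a ∷ post) ⟩
          ∑ (λ b → when (a <ᶠ b) (next α S b)) pre + (when (a <ᶠ a) (next α S a) + ∑ (λ b → when (a <ᶠ b) (next α S b)) post)
            ≡⟨ cong₂ (λ y z → y + (z + ∑ (λ b → when (a <ᶠ b) (next α S b)) post))
                 (∑-zero pre (λ {b} m → cong (λ c → when c (next α S b)) (<ᵇ-false (ℕₚ.<⇒≤ (proj₁ (split-sorted pre sorted) m)))))
                 (cong (λ c → when c (next α S a)) (<ᵇ-false (ℕₚ.≤-refl {toℕ a}))) ⟩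
          0ℤ + (0ℤ + ∑ (λ b → when (a <ᶠ b) (next α S b)) post) ≡⟨ trans (ℤₚ.+-identityˡ _) (ℤₚ.+-identityˡ _) ⟩
          ∑ (λ b → when (a <ᶠ b) (next α S b)) post
            ≡⟨ ∑-cong-∈ post (λ {b} m → cong (λ c → when c (next α S b)) (<ᵇ-true (proj₂ (split-sorted pre sorted) m))) ⟩
          ∑ (next α S) post ∎
        go : Dec (Nonempty S) → 𝒱 S (tails α a) ≡ Γ S + ∑ (next α S) post
        go (no ¬ne) = trans (𝒱-empty (tails α a) ¬ne) (sym (trans (cong₂ _+_ (𝒱-empty runWeight ¬ne)
          (∑-zero post (λ {b} _ → []-no (b ∈? top S) (λ k → ¬ne (b , top⊆ S k))))) (ℤₚ.+-identityʳ 1ℤ)))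
        go (yes ne) = begin
          𝒱 S (tails α a) ≡⟨ 𝒱-step (tails α a) ne ⟩
          ∑ (λ b → [ b ∈? top S ] 𝒱 (S ∖ b) (λ w → runWeight (b ∷ w) + when (a <ᶠ b) (α * tails α b w))) (allFin n)
            ≡⟨ ∑-cong expand (allFin n) ⟩
          ∑ (λ b → [ b ∈? top S ] 𝒱 (S ∖ b) (λ w → runWeight (b ∷ w)) + when (a <ᶠ b) (next α S b)) (allFin n)
            ≡⟨ ∑-+ _ _ (allFin n) ⟩
          ∑ (λ b → [ b ∈? top S ] 𝒱 (S ∖ b) (λ w → runWeight (b ∷ w))) (allFin n) + ∑ (λ b → when (a <ᶠ b) (next α S b)) (allFin n)
            ≡⟨ cong₂ _+_ (sym (𝒱-step runWeight ne)) restrict ⟩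
          Γ S + ∑ (next α S) post ∎

      -- Deleting an increasing sequence of letters of the top component never
      -- leaves the top component; this is where chordality enters.
      E-Γ-suffix : IsChordal 𝓑 → ∀ α pre post → pre ++ post ≡ allFin n → ∀ S →
                   E α (filterᵇ (_∈ᵇ top S) post) Γ S ≡ Γ S + ∑ (next α S) post
      E-Γ-suffix chordal α pre []         eq S = sym (ℤₚ.+-identityʳ (Γ S))
      E-Γ-suffix chordal α pre (a ∷ post) eq S with a ∈? top S
      ... | no a∉ = trans (E-Γ-suffix chordal α (pre ++ a ∷ []) post eq′ S) (cong (Γ S +_) (sym (ℤₚ.+-identityˡ (∑ (next α S) post))))
        where
        eq′ = trans (Listₚ.++-assoc pre (a ∷ []) post) eq
      ... | yes a∈ = begin
        e α a (E α F Γ) S ≡⟨ e-∈ α (E α F Γ) (top⊆ S a∈) ⟩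
        E α F Γ S + α * E α F Γ (S ∖ a)
          ≡⟨ cong₂ (λ y z → y + α * z) (E-Γ-suffix chordal α (pre ++ a ∷ []) post eq′ S)
               (trans (cong (λ as → E α as Γ (S ∖ a)) F≡F′) (E-Γ-suffix chordal α (pre ++ a ∷ []) post eq′ (S ∖ a))) ⟩
        (Γ S + ∑ (next α S) post) + α * (Γ (S ∖ a) + ∑ (next α (S ∖ a)) post)
          ≡⟨ cong (λ z → (Γ S + ∑ (next α S) post) + α * z) (𝒲-tails α pre a post eq (S ∖ a)) ⟨
        (Γ S + ∑ (next α S) post) + α * 𝒱 (S ∖ a) (tails α a) ≡⟨ ring (Γ S) (∑ (next α S) post) _ ⟩
        Γ S + (α * 𝒱 (S ∖ a) (tails α a) + ∑ (next α S) post) ∎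
        where
        open ≡-Reasoning
        eq′ = trans (Listₚ.++-assoc pre (a ∷ []) post) eq
        F = filterᵇ (_∈ᵇ top S) post
        a< : ∀ {b} → b ∈ₗ post → toℕ a ℕ.< toℕ b
        a< = proj₂ (split-sorted pre (subst (AllPairs _) (sym eq) (allFin-sorted n)))
        -- The letters still to be deleted all exceed `a`, so each lies in the top component of `S`
        -- exactly when it lies in that of `S ∖ a`.
        F≡F′ : F ≡ filterᵇ (_∈ᵇ top (S ∖ a)) post
        F≡F′ = filterᵇ-cong post (λ {b} m → does-⇔ (b ∈? top S) (b ∈? top (S ∖ a)) (top-∖⁺ chordal (a< m)) (top-∖⁻ (a< m)))
        ring : ∀ f g h → (f + g) + h ≡ f + (h + g)
        ring = solve-∀

      E-Γ : IsChordal 𝓑 → ∀ α {S} → Nonempty S → E α (elements (top S)) Γ S ≡ 𝒱 S (allTails α)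
      E-Γ chordal α {S} ne = begin
        E α (elements (top S)) Γ S ≡⟨ E-Γ-suffix chordal α [] (allFin n) refl S ⟩
        Γ S + ∑ (next α S) (allFin n) ≡⟨ cong (_+ ∑ (next α S) (allFin n)) (𝒱-step runWeight ne) ⟩
        ∑ (λ a → [ a ∈? top S ] 𝒱 (S ∖ a) (λ w → runWeight (a ∷ w))) (allFin n) + ∑ (next α S) (allFin n) ≡⟨ ∑-+ _ (next α S) (allFin n) ⟨
        ∑ (λ a → [ a ∈? top S ] 𝒱 (S ∖ a) (λ w → runWeight (a ∷ w)) + next α S a) (allFin n) ≡⟨ ∑-cong collect (allFin n) ⟨
        ∑ (λ a → [ a ∈? top S ] 𝒱 (S ∖ a) (λ w → allTails α (a ∷ w))) (allFin n) ≡⟨ 𝒱-step (allTails α) ne ⟨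
        𝒱 S (allTails α) ∎
        where
        open ≡-Reasoning
        collect : ∀ a → [ a ∈? top S ] 𝒱 (S ∖ a) (λ w → allTails α (a ∷ w))
                      ≡ [ a ∈? top S ] 𝒱 (S ∖ a) (λ w → runWeight (a ∷ w)) + next α S a
        collect a = trans (cong ([ a ∈? top S ]_) (trans (𝒲-+ k V (λ w → runWeight (a ∷ w)) (λ w → α * tails α a w))
                            (cong (𝒲 k V (λ w → runWeight (a ∷ w)) +_) (𝒲-* k V α (tails α a)))))
                          (when-+ (does (a ∈? top S)) (𝒲 k V (λ w → runWeight (a ∷ w))) (α * 𝒲 k V (tails α a)))
          where
          V = S ∖ a
          k = ∣ S ∖ a ∣

      Γ-relation : IsChordal 𝓑 → ∀ {S} → Nonempty S → E (- 1ℤ) (elements (top S)) Γ S ≡ x * E (- x) (elements (top S)) Γ S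
      Γ-relation chordal {S} ne = begin
        E (- 1ℤ) (elements (top S)) Γ S ≡⟨ E-Γ chordal (- 1ℤ) ne ⟩
        𝒱 S (allTails (- 1ℤ)) ≡⟨ 𝒱-step (allTails (- 1ℤ)) ne ⟩
        ∑ (λ a → [ a ∈? top S ] 𝒱 (S ∖ a) (λ w → allTails (- 1ℤ) (a ∷ w))) (allFin n)
          ≡⟨ ∑-cong (λ a → cong ([ a ∈? top S ]_) (𝒲-cong ∣ S ∖ a ∣ (S ∖ a) (allTails-relation a))) (allFin n) ⟩
        ∑ (λ a → [ a ∈? top S ] 𝒱 (S ∖ a) (λ w → x * allTails (- x) (a ∷ w))) (allFin n) ≡⟨ 𝒱-step (λ w → x * allTails (- x) w) ne ⟨
        𝒱 S (λ w → x * allTails (- x) w) ≡⟨ 𝒲-* ∣ S ∣ S x (allTails (- x)) ⟩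
        x * 𝒱 S (allTails (- x)) ≡⟨ cong (x *_) (E-Γ chordal (- x) ne) ⟨
        x * E (- x) (elements (top S)) Γ S ∎
        where open ≡-Reasoning

  -- The common relation and the equality of the two set functions

  module Comparison (𝓑 : Collection n) (building : IsBuildingSet 𝓑) (chordal : IsChordal 𝓑) (t : ℤ) where

    open Component 𝓑 building
    open NestedSum 𝓑 building t
    open Words 𝓑 building

    x : ℤ
    x = 1ℤ + t

    G : Subset n → ℤ
    G = E x (allFin n) K

    -- `G` is split into deletions inside and outside the top component. The outer deletions commute
    -- with the inner ones, so the recursion of `K` is needed at every set obtained from `S` by
    -- removing letters outside the component. By `top-restrict` all these sets have the same top
    -- component, and the factor `x` comes out.
    G-relation : ∀ {S} → Nonempty S → E (- 1ℤ) (elements (top S)) G S ≡ x * E (- x) (elements (top S)) G S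
    G-relation {S} ne = begin
      E (- 1ℤ) C G S ≡⟨ E-cong (- 1ℤ) C (E-filter x (_∈ᵇ top S) (allFin n) K) S ⟩
      E (- 1ℤ) C (E x C F) S ≡⟨ E-merge (- 1ℤ) x C F S ⟩
      E (- 1ℤ + x) C F S ≡⟨ cong (λ α → E α C F S) (ring₁ t) ⟩
      E t C (E x D K) S ≡⟨ E-comm t x C D K S ⟩
      E x D (E t C K) S ≡⟨ E-local x x (top S) D D∉top S (top⊆ S) local ⟩
      x * F S ≡⟨ cong (x *_) (trans (cong (λ α → E α C F S) (ring₂ t)) (E-zero C F S)) ⟨
      x * E (- x + x) C F S ≡⟨ cong (x *_) (E-merge (- x) x C F S) ⟨
      x * E (- x) C (E x C F) S ≡⟨ cong (x *_) (E-cong (- x) C (E-filter x (_∈ᵇ top S) (allFin n) K) S) ⟨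
      x * E (- x) C G S ∎
      where
      open ≡-Reasoning
      C = elements (top S)
      D = filterᵇ (not ∘ (_∈ᵇ top S)) (allFin n)
      F = E x D K
      ring₁ : ∀ t → - 1ℤ + (1ℤ + t) ≡ t
      ring₁ = solve-∀
      ring₂ : ∀ t → - (1ℤ + t) + (1ℤ + t) ≡ 0ℤ
      ring₂ = solve-∀
      D∉top : ∀ {a} → a ∈ₗ D → a ∉ top S
      D∉top {a} m a∈ with trans (sym (proj₂ (∈-filterᵇ⁻ (not ∘ (_∈ᵇ top S)) {as = allFin n} m))) (cong not (dec-true (a ∈? top S) a∈))
      ... | ()
      local : ∀ S′ → top S ⊆ S′ → S′ ⊆ S → E t C K S′ ≡ x * K S′
      local S′ C⊆S′ S′⊆S = subst (λ T → E t (elements T) K S′ ≡ x * K S′) (top-restrict ne C⊆S′ S′⊆S)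
        (K-recursion (_ , C⊆S′ (IsTop.m∈C (top-spec ne))))

    module _ {{_ : NonZero t}} where

      G≡Γ : ∀ S → G S ≡ Γ x S
      G≡Γ S = <-rec (λ k → ∀ S → ∣ S ∣ ≡ k → G S ≡ Γ x S) step ∣ S ∣ S refl
        where
        step : ∀ k → (∀ {j} → j ℕ.< k → ∀ S → ∣ S ∣ ≡ j → G S ≡ Γ x S) → ∀ S → ∣ S ∣ ≡ k → G S ≡ Γ x S
        step k ih S refl = go (nonempty? S)
          where
          open ≡-Reasoning
          C = elements (top S)
          smaller : ∀ S′ → ∣ S′ ∣ ℕ.< ∣ S ∣ → G S′ ≡ Γ x S′
          smaller S′ lt = ih lt S′ refl
          go : Dec (Nonempty S) → G S ≡ Γ x S
          go (no ¬ne) = begin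
            G S ≡⟨ cong G (Empty-unique ¬ne) ⟩
            G ⊥ ≡⟨ E-⊥ x (allFin n) K ⟩
            K ⊥ ≡⟨ K-⊥ ⟩
            1ℤ ≡⟨ Γ-⊥ x ⟨
            Γ x ⊥ ≡⟨ cong (Γ x) (Empty-unique ¬ne) ⟨
            Γ x S ∎
          -- `E-leading` at `- 1ℤ` and at `- x` shows that the difference of the two functions at
          -- `S` equals `x` times itself; subtracting leaves the factor `t`, which is cancelled.
          go (yes ne) = sym (ℤₚ.*-cancelˡ-≡ t (Γ x S) (G S) (begin
            t * Γ′ ≡⟨ ring₁ t L₁ Γ′ ⟩
            (L₁ + x * Γ′) + - (L₁ + Γ′) ≡⟨ cong₂ (λ y z → y + - z) scaled (E-leading (- 1ℤ) C S smaller) ⟩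
            (L₁′ + x * G S) + - (L₁′ + G S) ≡⟨ ring₁ t L₁′ (G S) ⟨
            t * G S ∎))
            where
            Γ′ = Γ x S
            L₁ = E (- 1ℤ) C G S
            L₁′ = E (- 1ℤ) C (Γ x) S
            L₂ = E (- x) C G S
            L₂′ = E (- x) C (Γ x) S
            ring₁ : ∀ t a g → t * g ≡ (a + (1ℤ + t) * g) + - (a + g)
            ring₁ = solve-∀
            scaled : L₁ + x * Γ′ ≡ L₁′ + x * G S
            scaled = begin
              L₁ + x * Γ′ ≡⟨ cong (_+ x * Γ′) (G-relation ne) ⟩
              x * L₂ + x * Γ′ ≡⟨ ℤₚ.*-distribˡ-+ x L₂ Γ′ ⟨
              x * (L₂ + Γ′) ≡⟨ cong (x *_) (E-leading (- x) C S smaller) ⟩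
              x * (L₂′ + G S) ≡⟨ ℤₚ.*-distribˡ-+ x L₂′ (G S) ⟩
              x * L₂′ + x * G S ≡⟨ cong (_+ x * G S) (Γ-relation x chordal ne) ⟨
              L₁′ + x * G S ∎

      ∑-ENC≡Γ : ∑ (λ NX → t ^ (n ℕ.∸ (length (proj₁ NX) ℕ.+ ∣ proj₂ NX ∣))) (allENC 𝓑) ≡ Γ x ⊤
      ∑-ENC≡Γ = trans ∑-ENC (G≡Γ ⊤)

  -- Letter sets of words and the prefix condition

  ∈-toSubset⁺ : ∀ {a : Fin n} {w} → a ∈ₗ w → a ∈ toSubset w
  ∈-toSubset⁺ {a = a} (here refl) = x∈p∪q⁺ (inj₁ (x∈⁅x⁆ a))
  ∈-toSubset⁺ (there m)   = x∈p∪q⁺ (inj₂ (∈-toSubset⁺ m))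

  ∈-toSubset⁻ : ∀ {a : Fin n} w → a ∈ toSubset w → a ∈ₗ w
  ∈-toSubset⁻ []      k = ⊥-elim (∉⊥ k)
  ∈-toSubset⁻ (b ∷ w) k with x∈p∪q⁻ ⁅ b ⁆ (toSubset w) k
  ... | inj₁ p = here (x∈⁅y⁆⇒x≡y b p)
  ... | inj₂ q = there (∈-toSubset⁻ w q)

  toSubset-∷-∖ : ∀ (a : Fin n) w → toSubset (a ∷ w) ∖ a ⊆ toSubset w
  toSubset-∷-∖ a w k with ∈-toSubset⁻ (a ∷ w) (∈∖⇒∈ {S = toSubset (a ∷ w)} k)
  ... | here refl = ⊥-elim (∉-∖ {S = toSubset (a ∷ w)} k)
  ... | there m   = ∈-toSubset⁺ m

  ∣toSubset∣≤ : ∀ (w : List (Fin n)) → ∣ toSubset w ∣ ℕ.≤ length w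
  ∣toSubset∣≤ {n} []      = ℕₚ.≤-reflexive (∣⊥∣≡0 n)
  ∣toSubset∣≤ (a ∷ w) = ℕₚ.≤-trans (ℕₚ.≤-reflexive (∣∖∣ (∈-toSubset⁺ {a = a} {a ∷ w} (here refl))))
    (s≤s (ℕₚ.≤-trans (p⊆q⇒∣p∣≤∣q∣ {p = toSubset (a ∷ w) ∖ a} {toSubset w} (toSubset-∷-∖ a w)) (∣toSubset∣≤ w)))

  toSubset-repeat : ∀ {a : Fin n} {w} → a ∈ₗ w → toSubset (a ∷ w) ≡ toSubset w
  toSubset-repeat {a = a} {w} m = ⊆-antisym (λ k → ∈-toSubset⁺ (lem (∈-toSubset⁻ (a ∷ w) k))) (λ k → x∈p∪q⁺ (inj₂ k))
    where
    lem : ∀ {b} → b ∈ₗ a ∷ w → b ∈ₗ w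
    lem (here refl) = m
    lem (there k)   = k

  toSubset-fresh : ∀ {a : Fin n} {w} → a ∉ₗ w → toSubset w ≡ toSubset (a ∷ w) ∖ a
  toSubset-fresh {a =
      a} {w} a∉ = ⊆-antisym (λ k → ∈-∖ {S = toSubset (a ∷ w)} (x∈p∪q⁺ (inj₂ k)) (λ { refl → a∉ (∈-toSubset⁻ w k) })) (toSubset-∷-∖ a w)

  unique⇒∣toSubset∣ : ∀ {w : List (Fin n)} → Unique w → ∣ toSubset w ∣ ≡ length w
  unique⇒∣toSubset∣ {n} {[]} _ = ∣⊥∣≡0 n
  unique⇒∣toSubset∣ {w = a ∷ w} (a∉ ∷ un) = trans (∣∖∣ (∈-toSubset⁺ {a = a} {a ∷ w} (here refl)))
    (cong suc (trans (cong ∣_∣ (sym (toSubset-fresh {w = w} (λ m → All.lookup a∉ m refl)))) (unique⇒∣toSubset∣ un)))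

  long⇒fresh : ∀ {a : Fin n} {w} → suc (length w) ℕ.≤ ∣ toSubset (a ∷ w) ∣ → a ∉ₗ w
  long⇒fresh {a = a} {w} le m = ℕₚ.<⇒≱ (subst (suc (length w) ℕ.≤_) (cong ∣_∣ (toSubset-repeat m)) le) (∣toSubset∣≤ w)

  ∣toSubset∣⇒unique : ∀ (w : List (Fin n)) → length w ℕ.≤ ∣ toSubset w ∣ → Unique w
  ∣toSubset∣⇒unique []      _  = []
  ∣toSubset∣⇒unique (a ∷ w) le = All.tabulate (λ m eq → a∉ (subst (_∈ₗ w) (sym eq) m)) ∷ ∣toSubset∣⇒unique w
      (ℕ.s≤s⁻¹ (subst (suc (length w) ℕ.≤_) (trans (∣∖∣ (∈-toSubset⁺ {a =
          a} {a ∷ w} (here refl))) (cong (suc ∘ ∣_∣) (sym (toSubset-fresh a∉)))) le))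
    where
    a∉ : a ∉ₗ w
    a∉ = long⇒fresh le

  maxFin-∈ : ∀ (a : Fin n) w → maxFin a w ∈ₗ a ∷ w
  maxFin-∈ a []      = here refl
  maxFin-∈ a (b ∷ w) with toℕ a ℕ.<ᵇ toℕ b
  ... | true  = there (maxFin-∈ b w)
  ... | false = case maxFin-∈ a w of λ { (here eq) → here eq ; (there m) → there (there m) }

  maxFin-≥ : ∀ (a : Fin n) w {b} → b ∈ₗ a ∷ w → toℕ b ℕ.≤ toℕ (maxFin a w)
  maxFin-≥ a []      (here refl) = ℕₚ.≤-refl
  maxFin-≥ a (c ∷ w) m with toℕ a ℕ.<ᵇ toℕ c in eq
  maxFin-≥ a (c ∷ w) (here refl)         | true  =
      ℕₚ.≤-trans (ℕₚ.<⇒≤ (ℕₚ.<ᵇ⇒< (toℕ a) (toℕ c) (subst T (sym eq) _))) (maxFin-≥ c w (here refl))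
  maxFin-≥ a (c ∷ w) (there m)           | true  = maxFin-≥ c w m
  maxFin-≥ a (c ∷ w) (here refl)         | false = maxFin-≥ a w (here refl)
  maxFin-≥ a (c ∷ w) (there (here refl)) | false = ℕₚ.≤-trans (ℕₚ.≮⇒≥ (λ lt → subst T eq (ℕₚ.<⇒<ᵇ lt))) (maxFin-≥ a w (here refl))
  maxFin-≥ a (c ∷ w) (there (there m))   | false = maxFin-≥ a w (there m)

  maxFin-max : ∀ (a : Fin n) w → IsMax (toSubset (a ∷ w)) (maxFin a w)
  maxFin-max a w = ∈-toSubset⁺ (maxFin-∈ a w) , λ k → maxFin-≥ a w (∈-toSubset⁻ (a ∷ w) k)

  words-length : ∀ (as : List A) k {w} → w ∈ₗ words as k → length w ≡ k
  words-length as zero    (here refl) = refl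
  words-length as (suc k) m with find (∈-concatMap⁻ (λ w → map (_∷ w) as) {xs = words as k} m)
  ... | v , v∈ , l with ∈-map⁻ (_∷ v) l
  ... | _ , _ , refl = cong suc (words-length as k v∈)

  ∈-words : ∀ (as : List A) → (∀ a → a ∈ₗ as) → ∀ w → w ∈ₗ words as (length w)
  ∈-words as h []      = here refl
  ∈-words as h (a ∷ w) = ∈-concatMap⁺ (λ w → map (_∷ w) as) (lose (∈-words as h w) (∈-map⁺ (_∷ w) (h a)))

  module BackwardWords (𝓑 : Collection n) (building : IsBuildingSet 𝓑) where

    open Component 𝓑 building
    open Words 𝓑 building

    -- Tails of the backward list are the prefixes of the word, so the prefix condition becomes
    -- structurally recursive and matches the recursion of `𝒲`.
    admissible : List (Fin n) → Bool
    admissible []      = true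
    admissible (a ∷ w) = sameComponentᵇ 𝓑 (toSubset (a ∷ w)) a (maxFin a w) ∧ admissible w

    -- Distinctness needs no separate test: a word of length `∣ S ∣` whose letter set is `S` cannot
    -- repeat a letter. The condition on the last letter is membership in the top component, by
    -- `sameComponent-top`.
    𝒲-words : ∀ k S f → ∣ S ∣ ≡ k → 𝒲 k S f ≡ ∑ (λ w → [ toSubset w ≟ₛ S ] when (admissible w) (f w)) (words (allFin n) k)
    𝒲-words zero S f S≡0 = sym (trans (ℤₚ.+-identityʳ ([ ⊥ ≟ₛ S ] f [])) ([]-yes (⊥ ≟ₛ S)
      (sym (Empty-unique (λ { (a , a∈S) → case trans (sym S≡0) (∣∖∣ a∈S) of λ () })))))
    𝒲-words (suc k) S f S≡ = begin
      ∑ (λ a → [ a ∈? top S ] 𝒲 k (S ∖ a) (λ w → f (a ∷ w))) (allFin n)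
        ≡⟨ ∑-cong (λ a → []-cong (a ∈? top S) (a ∈? top S) (λ z → z) (λ z → z)
             (λ a∈ → 𝒲-words k (S ∖ a) (λ w → f (a ∷ w)) (ℕₚ.suc-injective (trans (sym (∣∖∣ (top⊆ S a∈))) S≡)))) (allFin n) ⟩
      ∑ (λ a → [ a ∈? top S ] ∑ (λ w → [ toSubset w ≟ₛ (S ∖ a) ] when (admissible w) (f (a ∷ w))) (words (allFin n) k)) (allFin n)
        ≡⟨ ∑-cong (λ a → trans (sym (∑-when (does (a ∈? top S)) _ (words (allFin n) k)))
             (∑-cong-∈ (words (allFin n) k) (λ {w} m → pointwise a w (words-length (allFin n) k m)))) (allFin n) ⟩
      ∑ (λ a → ∑ (λ w → [ toSubset (a ∷ w) ≟ₛ S ] when (admissible (a ∷ w)) (f (a ∷ w))) (words (allFin n) k)) (allFin n)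
        ≡⟨ ∑-words-suc _ (allFin n) k ⟨
      ∑ (λ w → [ toSubset w ≟ₛ S ] when (admissible w) (f w)) (words (allFin n) (suc k)) ∎
      where
      open ≡-Reasoning
      pointwise : ∀ a w → length w ≡ k → [ a ∈? top S ] [ toSubset w ≟ₛ (S ∖ a) ] when (admissible w) (f (a ∷ w))
                  ≡ [ toSubset (a ∷ w) ≟ₛ S ] when (admissible (a ∷ w)) (f (a ∷ w))
      pointwise a w refl = go (toSubset (a ∷ w) ≟ₛ S)
        where
        go : (d : Dec (toSubset (a ∷ w) ≡ S)) → [ a ∈? top S ] [ toSubset w ≟ₛ (S ∖ a) ] when (admissible w) (f (a ∷ w))
             ≡ [ d ] when (admissible (a ∷ w)) (f (a ∷ w))
        go (yes eq) = begin
          [ a ∈? top S ] [ toSubset w ≟ₛ (S ∖ a) ] when (admissible w) (f (a ∷ w))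
            ≡⟨ cong ([ a ∈? top S ]_) ([]-yes (toSubset w ≟ₛ (S ∖ a)) (trans (toSubset-fresh fresh) (cong (_∖ a) eq))) ⟩
          [ a ∈? top S ] when (admissible w) (f (a ∷ w))
            ≡⟨ cong (λ b → when b (when (admissible w) (f (a ∷ w)))) (trans (cong (λ T → does (a ∈? top T)) (sym eq)) (sym
                (sameComponent-top a (maxFin-max a w)))) ⟩
          when (sameComponentᵇ 𝓑 (toSubset (a ∷ w)) a (maxFin a w)) (when (admissible w) (f (a ∷ w)))
            ≡⟨ when-∧ (sameComponentᵇ 𝓑 (toSubset (a ∷ w)) a (maxFin a w)) (admissible w) (f (a ∷ w)) ⟨
          when (admissible (a ∷ w)) (f (a ∷ w)) ∎
          where
          fresh : a ∉ₗ w
          fresh = long⇒fresh (ℕₚ.≤-reflexive (sym (trans (cong ∣_∣ eq) S≡)))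
        go (no neq) = zero-unless (a ∈? top S) (λ a∈ → []-no (toSubset w ≟ₛ (S ∖ a)) (λ eq → neq (restore (top⊆ S a∈) eq)))
          where
          zero-unless : ∀ {P : Set} (d : Dec P) {z} → (P → z ≡ 0ℤ) → [ d ] z ≡ 0ℤ
          zero-unless (yes p) h = h p
          zero-unless (no _)  h = refl
          restore : a ∈ S → toSubset w ≡ S ∖ a → toSubset (a ∷ w) ≡ S
          restore a∈S eq = ⊆-antisym
            (λ k → case x∈p∪q⁻ ⁅ a ⁆ (toSubset w) k of λ { (inj₁ p) → subst (_∈ S) (sym (x∈⁅y⁆⇒x≡y a p)) a∈S ; (inj₂ q) → ∈∖⇒∈ {S = S}
                (subst (_ ∈_) eq q) })
            (λ {b} b∈S → case b Finₚ.≟ a of λ { (yes refl) → x∈p∪q⁺ (inj₁ (x∈⁅x⁆ b)) ; (no b≢a) → x∈p∪q⁺ (inj₂ (subst (b ∈_) (sym eq)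
                (∈-∖ b∈S b≢a))) })

    ppCond-snoc : ∀ pre r a → ppCondᵇ 𝓑 pre (r ++ a ∷ [])
        ≡ ppCondᵇ 𝓑 pre r ∧ sameComponentᵇ 𝓑 (toSubset (a ∷ (r ʳ++ pre))) a (maxFin a (r ʳ++ pre))
    ppCond-snoc pre []      a = Boolₚ.∧-identityʳ _
    ppCond-snoc pre (b ∷ r) a =
        trans (cong (sameComponentᵇ 𝓑 (toSubset (b ∷ pre)) b (maxFin b pre) ∧_) (ppCond-snoc (b ∷ pre) r a)) (sym (Boolₚ.∧-assoc
            (sameComponentᵇ 𝓑 (toSubset (b ∷ pre)) b (maxFin b pre)) _ _))

    ppCond-reverse : ∀ w → ppCondᵇ 𝓑 [] (reverse w) ≡ admissible w
    ppCond-reverse []      = refl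
    ppCond-reverse (a ∷ w) = begin
      ppCondᵇ 𝓑 [] (reverse (a ∷ w)) ≡⟨ cong (ppCondᵇ 𝓑 []) (Listₚ.unfold-reverse a w) ⟩
      ppCondᵇ 𝓑 [] (reverse w ++ a ∷ []) ≡⟨ ppCond-snoc [] (reverse w) a ⟩
      ppCondᵇ 𝓑 [] (reverse w) ∧ sameComponentᵇ 𝓑 (toSubset (a ∷ reverse (reverse w))) a (maxFin a (reverse (reverse w)))
        ≡⟨ cong₂ (λ b v → b ∧ sameComponentᵇ 𝓑 (toSubset (a ∷ v)) a (maxFin a v)) (ppCond-reverse w) (Listₚ.reverse-involutive w) ⟩
      admissible w ∧ sameComponentᵇ 𝓑 (toSubset (a ∷ w)) a (maxFin a w) ≡⟨ Boolₚ.∧-comm (admissible w) _ ⟩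
      admissible (a ∷ w) ∎
      where open ≡-Reasoning

  -- Permutations of [n+1]

  ≡ᵇ-true : ∀ {i j : ℕ} → i ≡ j → (i ℕ.≡ᵇ j) ≡ true
  ≡ᵇ-true {i} {j} eq = Equivalence.to Boolₚ.T-≡ (ℕₚ.≡⇒≡ᵇ i j eq)

  ≡ᵇ-sound : ∀ {i j : ℕ} → (i ℕ.≡ᵇ j) ≡ true → i ≡ j
  ≡ᵇ-sound {i} {j} h = ℕₚ.≡ᵇ⇒≡ i j (subst T (sym h) _)

  eqList-sound : ∀ {u v} → eqList u v ≡ true → u ≡ v
  eqList-sound {[]}    {[]}    h = refl
  eqList-sound {x ∷ u} {y ∷ v} h = cong₂ _∷_ (≡ᵇ-sound (proj₁ (∧-true h))) (eqList-sound (proj₂ (∧-true {x ℕ.≡ᵇ y} h)))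

  eqList-refl : ∀ u → eqList u u ≡ true
  eqList-refl []      = refl
  eqList-refl (x ∷ u) = ∧-intro (≡ᵇ-true {x} refl) (eqList-refl u)

  not-true : ∀ {b} → not b ≡ true → b ≢ true
  not-true {false} _ ()

  distinct⁺ : ∀ (eq : A → A → Bool) → (∀ {a b} → eq a b ≡ true → a ≡ b) → ∀ {w} → Unique w → distinctᵇ eq w ≡ true
  distinct⁺ eq snd []        = refl
  distinct⁺ eq snd {a ∷ w} (a∉ ∷ un) with any (eq a) w in h
  ... | false = distinct⁺ eq snd un
  ... | true  = let (b , m , k) = any⁻ (eq a) w h in ⊥-elim (All.lookup a∉ m (snd k))

  distinct⁻ : ∀ (eq : A → A → Bool) → (∀ {a b} → a ≡ b → eq a b ≡ true) → ∀ w → distinctᵇ eq w ≡ true → Unique w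
  distinct⁻ eq cmp []      h = []
  distinct⁻ eq cmp (a ∷ w) h = All.tabulate (λ m k → not-true (proj₁ (∧-true h)) (any⁺ (eq a) m (cmp k)))
                             ∷ distinct⁻ eq cmp w (proj₂ (∧-true {not (any (eq a) w)} h))

  eqFin-sound : ∀ {a b : Fin n} → eqFin a b ≡ true → a ≡ b
  eqFin-sound h = Finₚ.toℕ-injective (≡ᵇ-sound h)

  eqFin-complete : ∀ {a b : Fin n} → a ≡ b → eqFin a b ≡ true
  eqFin-complete {a = a} refl = ≡ᵇ-true {toℕ a} refl

  noFinalDescent-++ : ∀ p y z w → noFinalDescentᵇ (p ++ y ∷ z ∷ w) ≡ noFinalDescentᵇ (y ∷ z ∷ w)
  noFinalDescent-++ []          y z w = refl
  noFinalDescent-++ (a ∷ [])    y z w = refl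
  noFinalDescent-++ (a ∷ b ∷ []) y z w = refl
  noFinalDescent-++ (a ∷ b ∷ c ∷ p) y z w = noFinalDescent-++ (b ∷ c ∷ p) y z w

  decreasing-finalDescent : ∀ {y z w} → AllPairs ℕ._>_ (y ∷ z ∷ w) → noFinalDescentᵇ (y ∷ z ∷ w) ≡ false
  decreasing-finalDescent {w = []}    ((y>z ∷ _) ∷ _) = <ᵇ-false (ℕₚ.<⇒≤ y>z)
  decreasing-finalDescent {w = _ ∷ _} (_ ∷ dec)       = decreasing-finalDescent dec

  +-swap : ∀ a b c → a ℕ.+ (b ℕ.+ c) ≡ b ℕ.+ (a ℕ.+ c)
  +-swap = ℕSolver.solve-∀

  des-snoc : ∀ p y z → des (p ++ y ∷ z ∷ []) ≡ (if z ℕ.<ᵇ y then 1 else 0) ℕ.+ des (p ++ y ∷ [])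
  des-snoc []       y z = refl
  des-snoc (a ∷ []) y z = +-swap (if y ℕ.<ᵇ a then 1 else 0) (if z ℕ.<ᵇ y then 1 else 0) 0
  des-snoc (a ∷ b ∷ p) y z = trans (cong ((if b ℕ.<ᵇ a then 1 else 0) ℕ.+_) (des-snoc (b ∷ p) y z))
    (+-swap (if b ℕ.<ᵇ a then 1 else 0) (if z ℕ.<ᵇ y then 1 else 0) (des (b ∷ p ++ y ∷ [])))

  ∧-swap : ∀ a b c → a ∧ (b ∧ c) ≡ b ∧ (a ∧ c)
  ∧-swap true  b c = refl
  ∧-swap false b c = sym (Boolₚ.∧-zeroʳ b)

  noDoubleDescent-snoc : ∀ p x y z → noDoubleDescentᵇ (p ++ x ∷ y ∷ z ∷ [])
      ≡ not ((y ℕ.<ᵇ x) ∧ (z ℕ.<ᵇ y)) ∧ noDoubleDescentᵇ (p ++ x ∷ y ∷ [])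
  noDoubleDescent-snoc []           x y z = refl
  noDoubleDescent-snoc (a ∷ [])     x y z = ∧-swap (not ((x ℕ.<ᵇ a) ∧ (y ℕ.<ᵇ x))) (not ((y ℕ.<ᵇ x) ∧ (z ℕ.<ᵇ y))) true
  noDoubleDescent-snoc (a ∷ b ∷ []) x y z = trans (cong (not ((b ℕ.<ᵇ a) ∧ (x ℕ.<ᵇ b)) ∧_) (noDoubleDescent-snoc (b ∷ []) x y z))
    (∧-swap (not ((b ℕ.<ᵇ a) ∧ (x ℕ.<ᵇ b))) (not ((y ℕ.<ᵇ x) ∧ (z ℕ.<ᵇ y))) (noDoubleDescentᵇ (b ∷ x ∷ y ∷ [])))
  noDoubleDescent-snoc (a ∷ b ∷ c ∷ p) x y z = trans (cong (not ((b ℕ.<ᵇ a) ∧ (c ℕ.<ᵇ b)) ∧_) (noDoubleDescent-snoc (b ∷ c ∷ p) x y z))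
    (∧-swap (not ((b ℕ.<ᵇ a) ∧ (c ℕ.<ᵇ b))) (not ((y ℕ.<ᵇ x) ∧ (z ℕ.<ᵇ y))) (noDoubleDescentᵇ (b ∷ c ∷ p ++ x ∷ y ∷ [])))

  val : Fin n → ℕ
  val a = suc (toℕ a)

  val≤n : ∀ (a : Fin n) → val a ℕ.≤ n
  val≤n = Finₚ.toℕ<n

  val-injective : ∀ {a b : Fin n} → val a ≡ val b → a ≡ b
  val-injective eq = Finₚ.toℕ-injective (ℕₚ.suc-injective eq)

  ∉-vals : ∀ (w : List (Fin n)) → suc n ∉ₗ map val w
  ∉-vals w m with ∈-map⁻ val m
  ... | a , _ , eq = ℕₚ.<-irrefl (sym eq) (s≤s (val≤n a))

  backDes : List (Fin n) → ℕ
  backDes (a ∷ b ∷ w) = (if a <ᶠ b then 1 else 0) ℕ.+ backDes (b ∷ w)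
  backDes _           = 0

  backNoDD : List (Fin n) → Bool
  backNoDD (a ∷ b ∷ c ∷ w) = not ((b <ᶠ c) ∧ (a <ᶠ b)) ∧ backNoDD (b ∷ c ∷ w)
  backNoDD _               = true

  forward : List (Fin n) → List ℕ
  forward w = map val (reverse w)

  forward-∷ : ∀ (a : Fin n) w → forward (a ∷ w) ≡ forward w ++ val a ∷ []
  forward-∷ a w = trans (cong (map val) (Listₚ.unfold-reverse a w)) (Listₚ.map-++ val (reverse w) (a ∷ []))

  forward-snoc : ∀ (a : Fin n) w z → forward (a ∷ w) ++ z ≡ forward w ++ val a ∷ z
  forward-snoc a w z = trans (cong (_++ z) (forward-∷ a w)) (Listₚ.++-assoc (forward w) (val a ∷ []) z)

  des-forward : ∀ (w : List (Fin n)) → des (forward w) ≡ backDes w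
  des-forward []          = refl
  des-forward (a ∷ [])    = refl
  des-forward (a ∷ b ∷ w) = begin
    des (forward (a ∷ b ∷ w)) ≡⟨ cong des (trans (forward-∷ a (b ∷ w)) (forward-snoc b w (val a ∷ []))) ⟩
    des (forward w ++ val b ∷ val a ∷ []) ≡⟨ des-snoc (forward w) (val b) (val a) ⟩
    (if a <ᶠ b then 1 else 0) ℕ.+ des (forward w ++ val b ∷ []) ≡⟨ cong (λ u → (if a <ᶠ b then 1 else 0) ℕ.+ des u) (forward-∷ b w) ⟨
    (if a <ᶠ b then 1 else 0) ℕ.+ des (forward (b ∷ w)) ≡⟨ cong ((if a <ᶠ b then 1 else 0) ℕ.+_) (des-forward (b ∷ w)) ⟩
    backDes (a ∷ b ∷ w) ∎
    where open ≡-Reasoning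

  -- The appended letter exceeds every other one, so it closes the word without a new descent.
  des-completed : ∀ (w : List (Fin n)) → des (forward w ++ suc n ∷ []) ≡ backDes w
  des-completed {n} []      = refl
  des-completed {n} (a ∷ w) = begin
    des (forward (a ∷ w) ++ suc n ∷ []) ≡⟨ cong des (forward-snoc a w (suc n ∷ [])) ⟩
    des (forward w ++ val a ∷ suc n ∷ []) ≡⟨ des-snoc (forward w) (val a) (suc n) ⟩
    (if suc n ℕ.<ᵇ val a then 1 else 0) ℕ.+ des (forward w ++ val a ∷ [])
      ≡⟨ cong₂ (λ b u → (if b then 1 else 0) ℕ.+ des u) (<ᵇ-false {suc n} {val a} (ℕₚ.m≤n⇒m≤1+n (val≤n a))) (sym (forward-∷ a w)) ⟩
    des (forward (a ∷ w)) ≡⟨ des-forward (a ∷ w) ⟩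
    backDes (a ∷ w) ∎
    where open ≡-Reasoning

  noDD-forward : ∀ (w : List (Fin n)) → noDoubleDescentᵇ (forward w) ≡ backNoDD w
  noDD-forward []       = refl
  noDD-forward (a ∷ []) = refl
  noDD-forward (a ∷ b ∷ []) = refl
  noDD-forward (a ∷ b ∷ c ∷ w) = begin
    noDoubleDescentᵇ (forward (a ∷ b ∷ c ∷ w))
      ≡⟨ cong noDoubleDescentᵇ (trans (forward-∷ a (b ∷ c ∷ w)) (trans (forward-snoc b (c ∷ w) (val a ∷ [])) (forward-snoc c w
          (val b ∷ val a ∷ [])))) ⟩
    noDoubleDescentᵇ (forward w ++ val c ∷ val b ∷ val a ∷ []) ≡⟨ noDoubleDescent-snoc (forward w) (val c) (val b) (val a) ⟩
    not ((b <ᶠ c) ∧ (a <ᶠ b)) ∧ noDoubleDescentᵇ (forward w ++ val c ∷ val b ∷ [])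
      ≡⟨ cong (λ u → not ((b <ᶠ c) ∧ (a <ᶠ b)) ∧ noDoubleDescentᵇ u) (trans (forward-∷ b (c ∷ w)) (forward-snoc c w (val b ∷ []))) ⟨
    not ((b <ᶠ c) ∧ (a <ᶠ b)) ∧ noDoubleDescentᵇ (forward (b ∷ c ∷ w)) ≡⟨ cong (not ((b <ᶠ c) ∧ (a <ᶠ b)) ∧_) (noDD-forward (b ∷ c ∷ w)) ⟩
    backNoDD (a ∷ b ∷ c ∷ w) ∎
    where open ≡-Reasoning

  noDD-completed : ∀ (w : List (Fin n)) → noDoubleDescentᵇ (forward w ++ suc n ∷ []) ≡ backNoDD w
  noDD-completed []       = refl
  noDD-completed (a ∷ []) = refl
  noDD-completed {n} (a ∷ b ∷ w) = begin
    noDoubleDescentᵇ (forward (a ∷ b ∷ w) ++ suc n ∷ [])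
      ≡⟨ cong noDoubleDescentᵇ (trans (forward-snoc a (b ∷ w) (suc n ∷ [])) (forward-snoc b w (val a ∷ suc n ∷ []))) ⟩
    noDoubleDescentᵇ (forward w ++ val b ∷ val a ∷ suc n ∷ []) ≡⟨ noDoubleDescent-snoc (forward w) (val b) (val a) (suc n) ⟩
    not ((a <ᶠ b) ∧ (suc n ℕ.<ᵇ val a)) ∧ noDoubleDescentᵇ (forward w ++ val b ∷ val a ∷ [])
      ≡⟨ cong₂ (λ c u → not ((a <ᶠ b) ∧ c) ∧ noDoubleDescentᵇ u) (<ᵇ-false {suc n} {val a} (ℕₚ.m≤n⇒m≤1+n (val≤n a)))
               (sym (trans (forward-∷ a (b ∷ w)) (forward-snoc b w (val a ∷ [])))) ⟩
    not ((a <ᶠ b) ∧ false) ∧ noDoubleDescentᵇ (forward (a ∷ b ∷ w))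
      ≡⟨ cong₂ (λ c d → not c ∧ d) (Boolₚ.∧-zeroʳ (a <ᶠ b)) (noDD-forward (a ∷ b ∷ w)) ⟩
    backNoDD (a ∷ b ∷ w) ∎
    where open ≡-Reasoning

  backDes-ascent : ∀ (a : Fin n) w → above a w ≡ false → backDes (a ∷ w) ≡ backDes w
  backDes-ascent a []      h = refl
  backDes-ascent a (b ∷ w) h rewrite h = refl

  backNoDD-ascent : ∀ (a : Fin n) w → above a w ≡ false → backNoDD (a ∷ w) ≡ backNoDD w
  backNoDD-ascent a []          h = refl
  backNoDD-ascent a (b ∷ [])    h = refl
  backNoDD-ascent a (b ∷ c ∷ w) h rewrite h = cong (λ z → not z ∧ backNoDD (b ∷ c ∷ w)) (Boolₚ.∧-zeroʳ (b <ᶠ c))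

  -- No descent leads into `b`, so neither triple containing that step can be a double descent.
  backNoDD-valley : ∀ (a b : Fin n) w → above b w ≡ false → backNoDD (a ∷ b ∷ w) ≡ backNoDD w
  backNoDD-valley a b []      h = refl
  backNoDD-valley a b (c ∷ w) h = trans (cong (λ z → not (z ∧ (a <ᶠ b)) ∧ backNoDD (b ∷ c ∷ w)) h) (backNoDD-ascent b (c ∷ w) h)

  backNoDD-double : ∀ (a b : Fin n) w → a <ᶠ b ≡ true → above b w ≡ true → backNoDD (a ∷ b ∷ w) ≡ false
  backNoDD-double a b (c ∷ w) h k rewrite h | k = refl

  -- Without double descents every descent occupies two letters shared with no other descent. This
  -- bounds the degree of the γ-polynomial and keeps the exponent in `monomial` from being
  -- truncated.
  2*backDes≤ : ∀ (w : List (Fin n)) → backNoDD w ≡ true → 2 ℕ.* backDes w ℕ.≤ length w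
  2*backDes≤ []          = λ _ → z≤n
  2*backDes≤ (a ∷ [])    = λ _ → z≤n
  2*backDes≤ (a ∷ b ∷ w) = step (2*backDes≤ (b ∷ w)) (2*backDes≤ w)
    where
    step : (backNoDD (b ∷ w) ≡ true → 2 ℕ.* backDes (b ∷ w) ℕ.≤ length (b ∷ w)) → (backNoDD w ≡ true → 2 ℕ.* backDes w ℕ.≤ length w) →
           backNoDD (a ∷ b ∷ w) ≡ true → 2 ℕ.* backDes (a ∷ b ∷ w) ℕ.≤ length (a ∷ b ∷ w)
    step ih₁ ih₂ h with a <ᶠ b in lt
    ... | false = ℕₚ.m≤n⇒m≤1+n (ih₁ (trans (sym (backNoDD-ascent a (b ∷ w) lt)) h))
    ... | true with above b w in ab
    ... | true  = case trans (sym h) (backNoDD-double a b w lt ab) of λ ()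
    ... | false =
        subst (ℕ._≤ suc (suc (length w))) (sym (trans (cong (λ d → 2 ℕ.* suc d) (backDes-ascent b w ab)) (ℕₚ.*-suc 2 (backDes w))))
                    (s≤s (s≤s (ih₂ (trans (sym (backNoDD-valley a b w ab)) h))))

  module _ (x : ℤ) where

    open Runs x

    monomial : ℕ → ℕ → ℤ
    monomial m d = x ^ d * (1ℤ + x) ^ (m ℕ.∸ 2 ℕ.* d)

    runWeight-des-step : ∀ (a b : Fin n) w →
      runWeight (b ∷ w) ≡ when (backNoDD (b ∷ w)) (monomial (length (b ∷ w)) (backDes (b ∷ w))) →
      runWeight w ≡ when (backNoDD w) (monomial (length w) (backDes w)) →
      runWeight (a ∷ b ∷ w) ≡ when (backNoDD (a ∷ b ∷ w)) (monomial (length (a ∷ b ∷ w)) (backDes (a ∷ b ∷ w)))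
    runWeight-des-step a b w ih₁ ih₂ with a <ᶠ b in lt
    ... | false = begin
      (1ℤ + x) * runWeight (b ∷ w) ≡⟨ cong ((1ℤ + x) *_) ih₁ ⟩
      (1ℤ + x) * when (backNoDD (b ∷ w)) (monomial (suc (length w)) (backDes (b ∷ w)))
        ≡⟨ when-* (backNoDD (b ∷ w)) (1ℤ + x) (monomial (suc (length w)) (backDes (b ∷ w))) ⟨
      when (backNoDD (b ∷ w)) ((1ℤ + x) * monomial (suc (length w)) (backDes (b ∷ w)))
        ≡⟨ when-cong (backNoDD (b ∷ w)) (λ h → trans (ring (1ℤ + x) (x ^ backDes (b ∷ w)) ((1ℤ + x) ^ (suc (length w) ℕ.∸ 2 ℕ.* backDes
            (b ∷ w))))
             (cong (λ k → x ^ backDes (b ∷ w) * (1ℤ + x) ^ k) (sym (ℕₚ.+-∸-assoc 1 (2*backDes≤ (b ∷ w) h))))) ⟩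
      when (backNoDD (b ∷ w)) (monomial (suc (suc (length w))) (backDes (b ∷ w)))
        ≡⟨ cong (λ c → when c (monomial (suc (suc (length w))) (backDes (b ∷ w)))) (backNoDD-ascent a (b ∷ w) lt) ⟨
      when (backNoDD (a ∷ b ∷ w)) (monomial (suc (suc (length w))) (backDes (b ∷ w))) ∎
      where
      open ≡-Reasoning
      ring : ∀ a b c → a * (b * c) ≡ b * (a * c)
      ring = solve-∀
    ... | true with above b w in ab
    ... | true  = sym (cong (λ c → when c (monomial (suc (suc (length w))) (suc (backDes (b ∷ w))))) (backNoDD-double a b w lt ab))
    ... | false = begin
      x * runWeight w ≡⟨ cong (x *_) ih₂ ⟩
      x * when (backNoDD w) (monomial (length w) (backDes w)) ≡⟨ when-* (backNoDD w) x (monomial (length w) (backDes w)) ⟨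
      when (backNoDD w) (x * monomial (length w) (backDes w)) ≡⟨ cong₂ when (sym (backNoDD-valley a b w ab)) power ⟩
      when (backNoDD (a ∷ b ∷ w)) (monomial (suc (suc (length w))) (suc (backDes (b ∷ w)))) ∎
      where
      open ≡-Reasoning
      power : x * monomial (length w) (backDes w) ≡ monomial (suc (suc (length w))) (suc (backDes (b ∷ w)))
      power = begin
        x * (x ^ backDes w * (1ℤ + x) ^ (length w ℕ.∸ 2 ℕ.* backDes w)) ≡⟨ ℤₚ.*-assoc x _ _ ⟨
        x ^ suc (backDes w) * (1ℤ + x) ^ (suc (suc (length w)) ℕ.∸ (2 ℕ.+ 2 ℕ.* backDes w))
          ≡⟨ cong (λ k → x ^ suc (backDes w) * (1ℤ + x) ^ (suc (suc (length w)) ℕ.∸ k)) (ℕₚ.*-suc 2 (backDes w)) ⟨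
        monomial (suc (suc (length w))) (suc (backDes w))
          ≡⟨ cong (λ d → monomial (suc (suc (length w))) (suc d)) (backDes-ascent b w ab) ⟨
        monomial (suc (suc (length w))) (suc (backDes (b ∷ w))) ∎

    -- Without double descents the runs have one or two letters. The two-letter runs correspond to
    -- the descents and give `x` each; all remaining letters are runs by themselves and give
    -- `1ℤ + x`.
    runWeight-des : ∀ (w : List (Fin n)) → runWeight w ≡ when (backNoDD w) (monomial (length w) (backDes w))
    runWeight-des []       = refl
    runWeight-des (a ∷ []) = sym (trans (ℤₚ.*-identityˡ _) (ℤₚ.*-identityʳ (1ℤ + x)))
    runWeight-des (a ∷ b ∷ w) = runWeight-des-step a b w (runWeight-des (b ∷ w)) (runWeight-des w)

  filterᵇ-accept : ∀ (p : A → Bool) a as → p a ≡ true → filterᵇ p (a ∷ as) ≡ a ∷ filterᵇ p as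
  filterᵇ-accept p a as h = Listₚ.filter-accept (Boolₚ.T? ∘ p) (subst T (sym h) _)

  filterᵇ-none : ∀ (p : A → Bool) as → (∀ {a} → a ∈ₗ as → p a ≡ false) → filterᵇ p as ≡ []
  filterᵇ-none p as h = Listₚ.filter-none (Boolₚ.T? ∘ p) (All.tabulate (λ m → subst T (h m)))

  tabulate-applyUpTo : ∀ (f : ℕ → A) n → tabulate {n = n} (f ∘ toℕ) ≡ applyUpTo f n
  tabulate-applyUpTo f zero    = refl
  tabulate-applyUpTo f (suc n) = cong (f 0 ∷_) (tabulate-applyUpTo (f ∘ suc) n)

  letters : ∀ n → map suc (upTo (suc n)) ≡ map val (allFin n) ++ suc n ∷ []
  letters n = begin
    map suc (upTo (suc n)) ≡⟨ cong (map suc) (Listₚ.upTo-∷ʳ n) ⟨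
    map suc (upTo n ++ n ∷ []) ≡⟨ Listₚ.map-++ suc (upTo n) (n ∷ []) ⟩
    map suc (upTo n) ++ suc n ∷ [] ≡⟨ cong (_++ suc n ∷ []) (Listₚ.map-upTo suc n) ⟩
    applyUpTo suc n ++ suc n ∷ [] ≡⟨ cong (_++ suc n ∷ []) (tabulate-applyUpTo suc n) ⟨
    tabulate (suc ∘ toℕ) ++ suc n ∷ [] ≡⟨ cong (_++ suc n ∷ []) (Listₚ.map-tabulate {n = n} (λ z → z) val) ⟨
    map val (allFin n) ++ suc n ∷ [] ∎
    where open ≡-Reasoning

  missing : List (Fin n) → ℕ → Bool
  missing w y = not (elemᵇ ℕ._≡ᵇ_ y (map val w))

  φ-shape : ∀ (w : List (Fin n)) → φ w ≡ map val w ++ suc n ∷ filterᵇ (missing w) (map suc (downFrom n))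
  φ-shape {n} w = cong (map val w ++_) (filterᵇ-accept (missing w) (suc n) (map suc (downFrom n)) fresh)
    where
    fresh : missing w (suc n) ≡ true
    fresh with elemᵇ ℕ._≡ᵇ_ (suc n) (map val w) in eq
    ... | false = refl
    ... | true  = let (y , m , k) = any⁻ _ (map val w) eq in ⊥-elim (∉-vals w (subst (_∈ₗ map val w) (sym (≡ᵇ-sound {suc n} k)) m))

  tail-decreasing : ∀ (w : List (Fin n)) → AllPairs ℕ._>_ (suc n ∷ filterᵇ (missing w) (map suc (downFrom n)))
  tail-decreasing {n} w = head ∷ AllPairsₚ.filter⁺ (Boolₚ.T? ∘ missing w) (subst (AllPairs ℕ._>_) (sym (Listₚ.map-downFrom suc n))
      (AllPairsₚ.applyDownFrom⁺₁ suc n (λ j<i _ → s≤s j<i)))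
    where
    head : All (suc n ℕ.>_) (filterᵇ (missing w) (map suc (downFrom n)))
    head =
        All.tabulate (λ m → case ∈-map⁻ suc (proj₁ (∈-filterᵇ⁻ (missing w) {as =
            map suc (downFrom n)} m)) of λ { (i , k , refl) → s≤s (∈-downFrom⁻ k) })

  snoc-cancel : ∀ (w v : List (Fin n)) {r} → map val w ++ suc n ∷ r ≡ map val v ++ suc n ∷ [] → w ≡ v
  snoc-cancel []      []      eq = refl
  snoc-cancel {n} [] (b ∷ v)  eq = ⊥-elim (∉-vals (b ∷ v) (here (Listₚ.∷-injectiveˡ eq)))
  snoc-cancel {n} (a ∷ w) []  eq = ⊥-elim (∉-vals (a ∷ w) (here (sym (Listₚ.∷-injectiveˡ eq))))
  snoc-cancel (a ∷ w) (b ∷ v) eq = cong₂ _∷_ (val-injective (Listₚ.∷-injectiveˡ eq)) (snoc-cancel w v (Listₚ.∷-injectiveʳ eq))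

  toSubset-reverse : ∀ (w : List (Fin n)) → toSubset (reverse w) ≡ toSubset w
  toSubset-reverse w = ⊆-antisym (λ k → ∈-toSubset⁺ {w = w} (Anyₚ.reverse⁻ (∈-toSubset⁻ (reverse w) k)))
                                 (λ k → ∈-toSubset⁺ {w = reverse w} (Anyₚ.reverse⁺ (∈-toSubset⁻ w k)))

  noFinalDescent-completed : ∀ (v : List (Fin n)) → noFinalDescentᵇ (map val v ++ suc n ∷ []) ≡ true
  noFinalDescent-completed {n} v =
      subst (λ v → noFinalDescentᵇ (map val v ++ suc n ∷ []) ≡ true) (Listₚ.reverse-involutive v) (go (reverse v))
    where
    go : ∀ w → noFinalDescentᵇ (forward w ++ suc n ∷ []) ≡ true
    go []      = refl
    go (a ∷ w) = trans (cong noFinalDescentᵇ (forward-snoc a w (suc n ∷ [])))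
      (trans (noFinalDescent-++ (forward w) (val a) (suc n) []) (<ᵇ-true (s≤s (val≤n a))))

  -- Permutations without double or final descent, as words on [n]

  module Permutations (𝓑 : Collection n) where

    inSquare⁻ : ∀ {u} → inSquareᵇ 𝓑 u ≡ true → ∃ λ w → isPartialPermᵇ 𝓑 w ≡ true × φ w ≡ u
    inSquare⁻ {u} h = let (w , m , k) = any⁻ (λ w → eqList (φ w) u) (partialPerms 𝓑) h in
      w , proj₂ (∈-filterᵇ⁻ (isPartialPermᵇ 𝓑) {as = concatMap (words (allFin n)) (upTo (suc n))} m) , eqList-sound k

    inSquare⁺ : ∀ w → isPartialPermᵇ 𝓑 w ≡ true → inSquareᵇ 𝓑 (φ w) ≡ true
    inSquare⁺ w h = any⁺ (λ v → eqList (φ v) (φ w)) (∈-filterᵇ⁺ (isPartialPermᵇ 𝓑) (∈-concatMap⁺ (words (allFin n))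
        (lose (∈-upTo⁺ (s≤s (ℕₚ.≤ᵇ⇒≤ (length w) n (subst T (sym (proj₁ (∧-true h))) _)))) (∈-words (allFin n) ∈-allFin w))) h)
      (eqList-refl (φ w))

    -- In `φ w` the letter `suc n` is followed by the missing letters in decreasing order. If any
    -- letter were missing, the permutation would end in a descent.
    hat-square-shape : ∀ {u} → inHatᵇ u ∧ inSquareᵇ 𝓑 u ≡ true → ∃ λ w → isPartialPermᵇ 𝓑 w ≡ true × u ≡ map val w ++ suc n ∷ []
    hat-square-shape {u} h with inSquare⁻ (proj₂ (∧-true {inHatᵇ u} h))
    ... | w , pp , refl = w , pp , trans (φ-shape w) (cong (λ r → map val w ++ suc n ∷ r) (empty _ refl))
      where
      empty : ∀ r → filterᵇ (missing w) (map suc (downFrom n)) ≡ r → r ≡ []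
      empty []      eq = refl
      empty (y ∷ r) eq = case trans (sym (proj₂ (∧-true {noDoubleDescentᵇ (φ w)} (proj₁ (∧-true {inHatᵇ (φ w)} h))))) final of λ ()
        where
        final : noFinalDescentᵇ (φ w) ≡ false
        final = trans (cong noFinalDescentᵇ (trans (φ-shape w) (cong (λ r → map val w ++ suc n ∷ r) eq)))
          (trans (noFinalDescent-++ (map val w) (suc n) y r) (decreasing-finalDescent (subst (λ r → AllPairs ℕ._>_ (suc n ∷ r)) eq
              (tail-decreasing w))))

    hat-square-des : ∀ {u} → inHatᵇ u ∧ inSquareᵇ 𝓑 u ≡ true → 2 ℕ.* des u ℕ.≤ n
    hat-square-des {u} h with hat-square-shape {u} h
    ... | w , pp , eq = begin
      2 ℕ.* des u ≡⟨ cong (2 ℕ.*_) (trans (cong des (trans eq unreverse)) (des-completed (reverse w))) ⟩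
      2 ℕ.* backDes (reverse w) ≤⟨ 2*backDes≤ (reverse w) (trans (sym (noDD-completed (reverse w)))
          (trans (cong noDoubleDescentᵇ (sym (trans eq unreverse))) (proj₁ (∧-true (proj₁ (∧-true {inHatᵇ u} h)))))) ⟩
      length (reverse w) ≡⟨ Listₚ.length-reverse w ⟩
      length w ≤⟨ ℕₚ.≤ᵇ⇒≤ (length w) n (subst T (sym (proj₁ (∧-true pp))) _) ⟩
      n ∎
      where
      open ℕₚ.≤-Reasoning
      unreverse : map val w ++ suc n ∷ [] ≡ forward (reverse w) ++ suc n ∷ []
      unreverse = cong (λ v → map val v ++ suc n ∷ []) (sym (Listₚ.reverse-involutive w))

    counted : List ℕ → Bool
    counted u = distinctᵇ ℕ._≡ᵇ_ u ∧ (inHatᵇ u ∧ inSquareᵇ 𝓑 u)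

    counted-last : ∀ u y → y ≢ suc n → counted (u ++ y ∷ []) ≡ false
    counted-last u y y≢ with counted (u ++ y ∷ []) in eq
    ... | false = refl
    ... | true with hat-square-shape {u ++ y ∷ []} (proj₂ (∧-true {distinctᵇ ℕ._≡ᵇ_ (u ++ y ∷ [])} eq))
    ... | w , _ , k = ⊥-elim (y≢ (Listₚ.∷ʳ-injectiveʳ u (map val w) k))

    counted-repeat : ∀ u → suc n ∈ₗ u → counted (u ++ suc n ∷ []) ≡ false
    counted-repeat u m with counted (u ++ suc n ∷ []) in eq
    ... | false = refl
    ... | true  = ⊥-elim (lem u m (distinct⁻ ℕ._≡ᵇ_ ≡ᵇ-true (u ++ suc n ∷ []) (proj₁ (∧-true eq))))
      where
      lem : ∀ {y : ℕ} u → y ∈ₗ u → ¬ Unique (u ++ y ∷ [])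
      lem (y ∷ u) (here refl) (h ∷ _) = All.lookup h (∈-++⁺ʳ u (here refl)) refl
      lem (z ∷ u) (there m)   (_ ∷ un) = lem u m un

    -- Once the letter set of `v` is everything, distinctness follows by counting, `φ` only appends
    -- `suc n`, and the final step is an ascent. Conversely `snoc-cancel` identifies `v` with the
    -- partial permutation that produces the word.
    counted-complete : ∀ v → length v ≡ n → counted (map val v ++ suc n ∷ []) ≡
      does (toSubset v ≟ₛ ⊤) ∧ (ppCondᵇ 𝓑 [] v ∧ noDoubleDescentᵇ (map val v ++ suc n ∷ []))
    counted-complete v len = bool-⇔ to from
      where
      u = map val v ++ suc n ∷ []
      to : counted u ≡ true → does (toSubset v ≟ₛ ⊤) ∧ (ppCondᵇ 𝓑 [] v ∧ noDoubleDescentᵇ u) ≡ true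
      to h with ∧-true {distinctᵇ ℕ._≡ᵇ_ u} h
      ... | _ , hs with hat-square-shape {u} hs
      ... | w , pp , eq with snoc-cancel v w eq
      ... | refl with ∧-true {length v ℕ.≤ᵇ n} pp
      ... | _ , pp′ with ∧-true {distinctᵇ eqFin v} pp′
      ... | dis , cond =
          ∧-intro (dec-true (toSubset v ≟ₛ ⊤) (∣p∣≡n⇒p≡⊤ (trans (unique⇒∣toSubset∣ (distinct⁻ eqFin eqFin-complete v dis)) len)))
                                 (∧-intro cond (proj₁ (∧-true (proj₁ (∧-true {inHatᵇ u} hs)))))
      from : does (toSubset v ≟ₛ ⊤) ∧ (ppCondᵇ 𝓑 [] v ∧ noDoubleDescentᵇ u) ≡ true → counted u ≡ true
      from h with ∧-true {does (toSubset v ≟ₛ ⊤)} h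
      ... | full′ , h′ with does-true (toSubset v ≟ₛ ⊤) full′ | ∧-true {ppCondᵇ 𝓑 [] v} h′
      ... | full | cond , ndd = ∧-intro (distinct⁺ ℕ._≡ᵇ_ ≡ᵇ-sound unique-u) (∧-intro (∧-intro ndd (noFinalDescent-completed v))
          (subst (λ u → inSquareᵇ 𝓑 u ≡ true) φv≡u (inSquare⁺ v (∧-intro (≤ᵇ-true (ℕₚ.≤-reflexive len)) (∧-intro
              (distinct⁺ eqFin eqFin-sound unique-v) cond)))))
        where
        ≤ᵇ-true : ∀ {i j} → i ℕ.≤ j → (i ℕ.≤ᵇ j) ≡ true
        ≤ᵇ-true le = Equivalence.to Boolₚ.T-≡ (ℕₚ.≤⇒≤ᵇ le)
        unique-v : Unique v
        unique-v = ∣toSubset∣⇒unique v (ℕₚ.≤-reflexive (trans len (sym (trans (cong ∣_∣ full) (∣⊤∣≡n n)))))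
        unique-u : Unique u
        unique-u = Uniqueₚ.++⁺ (Uniqueₚ.map⁺ val-injective unique-v) ([] ∷ []) (λ { (m , here refl) → ∉-vals v m })
        present : ∀ {y} → y ∈ₗ map suc (downFrom n) → missing v y ≡ false
        present m with ∈-map⁻ suc m
        ... | i , k , refl = cong not (any⁺ (suc i ℕ.≡ᵇ_) (∈-map⁺ val (∈-toSubset⁻ v (subst (fromℕ< (∈-downFrom⁻ k) ∈_) (sym full) ∈⊤)))
                               (≡ᵇ-true {i} (sym (Finₚ.toℕ-fromℕ< (∈-downFrom⁻ k)))))
        φv≡u : φ v ≡ u
        φv≡u = trans (φ-shape v) (cong (λ r → map val v ++ suc n ∷ r) (filterᵇ-none (missing v) (map suc (downFrom n)) present))

    module _ (building : IsBuildingSet 𝓑) where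

      open BackwardWords 𝓑 building

      -- The last letter is peeled off and must be `suc n` by `counted-last`; no other position may
      -- hold it by `counted-repeat`, so the alphabet shrinks to [n]. Reversal then gives backward
      -- words.
      ∑-permutations : ∀ (g : ℕ → ℤ) → ∑ (λ u → when (inHatᵇ u ∧ inSquareᵇ 𝓑 u) (g (des u))) (perms (suc n))
        ≡ ∑ (λ w → [ toSubset w ≟ₛ ⊤ ] when (admissible w) (when (backNoDD w) (g (backDes w)))) (words (allFin n) n)
      ∑-permutations g = begin
        ∑ (λ u → when (inHatᵇ u ∧ inSquareᵇ 𝓑 u) (g (des u))) (perms (suc n)) ≡⟨ ∑-filter _ (distinctᵇ ℕ._≡ᵇ_) (words Y (suc n)) ⟩
        ∑ (λ u → when (distinctᵇ ℕ._≡ᵇ_ u) (when (inHatᵇ u ∧ inSquareᵇ 𝓑 u) (g (des u)))) (words Y (suc n))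
          ≡⟨ ∑-cong (λ u → sym (when-∧ (distinctᵇ ℕ._≡ᵇ_ u) (inHatᵇ u ∧ inSquareᵇ 𝓑 u) (g (des u)))) (words Y (suc n)) ⟩
        ∑ H (words Y (suc n)) ≡⟨ cong (λ Z → ∑ H (words Z (suc n))) (letters n) ⟩
        ∑ H (words (V ++ suc n ∷ []) (suc n)) ≡⟨ ∑-words-snoc H (V ++ suc n ∷ []) n ⟩
        ∑ (λ y → ∑ (λ u → H (u ++ y ∷ [])) (words (V ++ suc n ∷ []) n)) (V ++ suc n ∷ []) ≡⟨ ∑-++ _ V (suc n ∷ []) ⟩
        ∑ (λ y → ∑ (λ u → H (u ++ y ∷ [])) (words (V ++ suc n ∷ []) n)) V + (∑ (λ u → H (u ++ suc n ∷ [])) (words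
            (V ++ suc n ∷ []) n) + 0ℤ)
          ≡⟨ cong₂ (λ y z → y + (z + 0ℤ))
               (∑-zero V (λ {y} m → ∑-zero (words (V ++ suc n ∷ []) n) (λ {u} _ → cong (λ b → when b (g (des (u ++ y ∷ []))))
                 (counted-last u y (λ eq → ∉-vals (allFin n) (subst (_∈ₗ V) eq m))))))
               (∑-words-avoid (λ u → H (u ++ suc n ∷ [])) V (suc n) (λ u m → cong (λ b → when b (g (des (u ++ suc n ∷ []))))
                   (counted-repeat u m)) n) ⟩
        0ℤ + (∑ (λ u → H (u ++ suc n ∷ [])) (words V n) + 0ℤ) ≡⟨ trans (ℤₚ.+-identityˡ _) (ℤₚ.+-identityʳ _) ⟩
        ∑ (λ u → H (u ++ suc n ∷ [])) (words V n) ≡⟨ cong (∑ (λ u → H (u ++ suc n ∷ []))) (words-map val (allFin n) n) ⟩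
        ∑ (λ u → H (u ++ suc n ∷ [])) (map (map val) (words (allFin n) n)) ≡⟨ ∑-map _ (map val) (words (allFin n) n) ⟩
        ∑ (λ v → H (map val v ++ suc n ∷ [])) (words (allFin n) n) ≡⟨ ∑-words-reverse _ (allFin n) n ⟩
        ∑ (λ w → H (forward w ++ suc n ∷ [])) (words (allFin n) n)
          ≡⟨ ∑-cong-∈ (words (allFin n) n) (λ {w} m → pointwise w (words-length (allFin n) n m)) ⟩
        ∑ (λ w → [ toSubset w ≟ₛ ⊤ ] when (admissible w) (when (backNoDD w) (g (backDes w)))) (words (allFin n) n) ∎
        where
        open ≡-Reasoning
        Y = map suc (upTo (suc n))
        V = map val (allFin n)
        H : List ℕ → ℤ
        H u = when (counted u) (g (des u))
        pointwise : ∀ w → length w ≡ n → H (forward w ++ suc n ∷ [])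
            ≡ [ toSubset w ≟ₛ ⊤ ] when (admissible w) (when (backNoDD w) (g (backDes w)))
        pointwise w len = begin
          H (forward w ++ suc n ∷ [])
            ≡⟨ cong₂ when (trans (counted-complete (reverse w) (trans (Listₚ.length-reverse w) len))
                 (cong₂ _∧_ (cong (λ S → does (S ≟ₛ ⊤)) (toSubset-reverse w)) (cong₂ _∧_ (ppCond-reverse w) (noDD-completed w))))
                     (cong g (des-completed w)) ⟩
          when (does (toSubset w ≟ₛ ⊤) ∧ (admissible w ∧ backNoDD w)) (g (backDes w))
            ≡⟨ trans (when-∧ (does (toSubset w ≟ₛ ⊤)) _ _) (cong (when (does (toSubset w ≟ₛ ⊤))) (when-∧ (admissible w) (backNoDD w) _)) ⟩
          [ toSubset w ≟ₛ ⊤ ] when (admissible w) (when (backNoDD w) (g (backDes w))) ∎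

      open Words 𝓑 building

      ∑-permutations-monomial : ∀ x → ∑ (λ u → when (inHatᵇ u ∧ inSquareᵇ 𝓑 u) (monomial x n (des u))) (perms (suc n))
          ≡ 𝒱 ⊤ (Runs.runWeight x)
      ∑-permutations-monomial x = begin
        ∑ (λ u → when (inHatᵇ u ∧ inSquareᵇ 𝓑 u) (monomial x n (des u))) (perms (suc n)) ≡⟨ ∑-permutations (monomial x n) ⟩
        ∑ (λ w → [ toSubset w ≟ₛ ⊤ ] when (admissible w) (when (backNoDD w) (monomial x n (backDes w)))) (words (allFin n) n)
          ≡⟨ ∑-cong-∈ (words (allFin n) n) (λ {w} m → cong (λ z → [ toSubset w ≟ₛ ⊤ ] when (admissible w) z)
               (trans (cong (λ k → when (backNoDD w) (monomial x k (backDes w))) (sym (words-length (allFin n) n m))) (sym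
                   (runWeight-des x w)))) ⟩
        ∑ (λ w → [ toSubset w ≟ₛ ⊤ ] when (admissible w) (Runs.runWeight x w)) (words (allFin n) n)
          ≡⟨ 𝒲-words n ⊤ (Runs.runWeight x) (∣⊤∣≡n n) ⟨
        𝒲 n ⊤ (Runs.runWeight x) ≡⟨ cong (λ k → 𝒲 k ⊤ (Runs.runWeight x)) (∣⊤∣≡n n) ⟨
        𝒱 ⊤ (Runs.runWeight x) ∎
        where open ≡-Reasoning

  -- Polynomials

  open import Data.Nat.Combinatorics using (_C_; nCk+nC[k+1]≡[n+1]C[k+1]; k>n⇒nCk≡0)

  sumℤ-cong : ∀ N {f g : ℕ → ℤ} → (∀ {i} → i ℕ.< N → f i ≡ g i) → sumℤ N f ≡ sumℤ N g
  sumℤ-cong zero    h = refl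
  sumℤ-cong (suc N) h = cong₂ _+_ (sumℤ-cong N (λ lt → h (ℕₚ.m<n⇒m<1+n lt))) (h (ℕₚ.n<1+n N))

  sumℤ-zero : ∀ N {f : ℕ → ℤ} → (∀ {i} → i ℕ.< N → f i ≡ 0ℤ) → sumℤ N f ≡ 0ℤ
  sumℤ-zero zero    h = refl
  sumℤ-zero (suc N) h = cong₂ _+_ (sumℤ-zero N (λ lt → h (ℕₚ.m<n⇒m<1+n lt))) (h (ℕₚ.n<1+n N))

  sumℤ-+ : ∀ N f g → sumℤ N (λ i → f i + g i) ≡ sumℤ N f + sumℤ N g
  sumℤ-+ zero    f g = refl
  sumℤ-+ (suc N) f g = trans (cong (_+ (f N + g N)) (sumℤ-+ N f g)) (interchange (sumℤ N f) (sumℤ N g) (f N) (g N))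

  sumℤ-* : ∀ N c f → sumℤ N (λ i → c * f i) ≡ c * sumℤ N f
  sumℤ-* zero    c f = sym (ℤₚ.*-zeroʳ c)
  sumℤ-* (suc N) c f = trans (cong (_+ c * f N) (sumℤ-* N c f)) (sym (ℤₚ.*-distribˡ-+ c (sumℤ N f) (f N)))

  sumℤ-swap : ∀ N M (f : ℕ → ℕ → ℤ) → sumℤ N (λ i → sumℤ M (f i)) ≡ sumℤ M (λ j → sumℤ N (λ i → f i j))
  sumℤ-swap zero    M f = sym (sumℤ-zero M (λ _ → refl))
  sumℤ-swap (suc N) M f = trans (cong (_+ sumℤ M (f N)) (sumℤ-swap N M f)) (sym (sumℤ-+ M (λ j → sumℤ N (λ i → f i j)) (f N)))

  sumℤ-offset : ∀ k N f → sumℤ (k ℕ.+ N) f ≡ sumℤ k f + sumℤ N (λ i → f (k ℕ.+ i))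
  sumℤ-offset k zero    f = trans (cong (λ m → sumℤ m f) (ℕₚ.+-identityʳ k)) (sym (ℤₚ.+-identityʳ (sumℤ k f)))
  sumℤ-offset k (suc N) f = trans (cong (λ m → sumℤ m f) (ℕₚ.+-suc k N)) (trans (cong (_+ f (k ℕ.+ N)) (sumℤ-offset k N f))
    (ℤₚ.+-assoc (sumℤ k f) (sumℤ N (λ i → f (k ℕ.+ i))) (f (k ℕ.+ N))))

  sumℤ-head : ∀ N f → sumℤ (suc N) f ≡ f 0 + sumℤ N (f ∘ suc)
  sumℤ-head N f = trans (sumℤ-offset 1 N f) (cong (_+ sumℤ N (f ∘ suc)) (ℤₚ.+-identityˡ (f 0)))

  ≡ᵇ-false : ∀ i j → i ≢ j → (i ℕ.≡ᵇ j) ≡ false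
  ≡ᵇ-false i j neq with i ℕ.≡ᵇ j in eq
  ... | false = refl
  ... | true  = ⊥-elim (neq (≡ᵇ-sound {i} {j} eq))

  sumℤ-single : ∀ N {d} (g : ℕ → ℤ) → d ℕ.< N → sumℤ N (λ i → when (d ℕ.≡ᵇ i) (g i)) ≡ g d
  sumℤ-single (suc N) {d} g d<N with d ℕₚ.≟ N
  ... | yes refl = trans (cong₂ _+_ (sumℤ-zero N (λ {i} lt → cong (λ b → when b (g i)) (≡ᵇ-false d i (λ { refl → ℕₚ.<-irrefl refl lt }))))
                                    (cong (λ b → when b (g d)) (≡ᵇ-true {d} refl))) (ℤₚ.+-identityˡ (g d))
  ... | no d≢N =
      trans (cong₂ _+_ (sumℤ-single N g (ℕₚ.≤∧≢⇒< (ℕ.s≤s⁻¹ d<N) d≢N)) (cong (λ b → when b (g N)) (≡ᵇ-false d N d≢N))) (ℤₚ.+-identityʳ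
          (g d))

  pos-sumℕ : ∀ N g → pos (sumℕ N g) ≡ sumℤ N (pos ∘ g)
  pos-sumℕ zero    g = refl
  pos-sumℕ (suc N) g = trans (ℤₚ.pos-+ (sumℕ N g) (g N)) (cong (_+ pos (g N)) (pos-sumℕ N g))

  -- Groups the elements of `L` by the statistic `d`, so that a generating polynomial becomes a sum
  -- over objects. The separate test `r` absorbs the different Boolean shapes of `fVec` and
  -- `descentCount`.
  sumℤ-count : ∀ N (r : A → ℕ → Bool) (p : A → Bool) (d : A → ℕ) (g : ℕ → ℤ) L →
    (∀ {a} → a ∈ₗ L → p a ≡ true → d a ℕ.< N) → (∀ {a i} → a ∈ₗ L → i ℕ.< N → r a i ≡ p a ∧ (d a ℕ.≡ᵇ i)) →
    sumℤ N (λ i → pos (length (filterᵇ (λ a → r a i) L)) * g i) ≡ ∑ (λ a → when (p a) (g (d a))) L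
  sumℤ-count N r p d g []      bound h = sumℤ-zero N (λ _ → refl)
  sumℤ-count N r p d g (a ∷ L) bound h = begin
    sumℤ N (λ i → pos (length (filterᵇ (λ a → r a i) (a ∷ L))) * g i) ≡⟨ sumℤ-cong N (λ {i} lt → head i lt) ⟩
    sumℤ N (λ i → when (p a) (when (d a ℕ.≡ᵇ i) (g i)) + pos (length (filterᵇ (λ a → r a i) L)) * g i) ≡⟨ sumℤ-+ N _ _ ⟩
    sumℤ N (λ i → when (p a) (when (d a ℕ.≡ᵇ i) (g i))) + sumℤ N (λ i → pos (length (filterᵇ (λ a → r a i) L)) * g i)
      ≡⟨ cong₂ _+_ (first (p a) refl) (sumℤ-count N r p d g L (bound ∘ there) (h ∘ there)) ⟩
    when (p a) (g (d a)) + ∑ (λ a → when (p a) (g (d a))) L ∎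
    where
    open ≡-Reasoning
    first : ∀ b → p a ≡ b → sumℤ N (λ i → when b (when (d a ℕ.≡ᵇ i) (g i))) ≡ when b (g (d a))
    first true  eq = sumℤ-single N g (bound (here refl) eq)
    first false eq = sumℤ-zero N (λ _ → refl)
    ring : ∀ m g → (1ℤ + m) * g ≡ g + m * g
    ring = solve-∀
    head : ∀ i → i ℕ.< N → pos (length (filterᵇ (λ a → r a i) (a ∷ L))) * g i
        ≡ when (p a) (when (d a ℕ.≡ᵇ i) (g i)) + pos (length (filterᵇ (λ a → r a i) L)) * g i
    head i lt =
        trans lem (cong (_+ pos (length (filterᵇ (λ a → r a i) L)) * g i) (trans (cong (λ b → when b (g i)) (h (here refl) lt)) (when-∧
            (p a) (d a ℕ.≡ᵇ i) (g i))))
      where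
      lem : pos (length (filterᵇ (λ a → r a i) (a ∷ L))) * g i ≡ when (r a i) (g i) + pos (length (filterᵇ (λ a → r a i) L)) * g i
      lem with r a i
      ... | true  =
          trans (cong (_* g i) (ℤₚ.pos-+ 1 (length (filterᵇ (λ a → r a i) L)))) (ring (pos (length (filterᵇ (λ a → r a i) L))) (g i))
      ... | false = sym (ℤₚ.+-identityˡ _)

  binomial : ∀ x y i N → i ℕ.< N → sumℤ N (λ j → pos (i C j) * y ^ (i ℕ.∸ j) * x ^ j) ≡ (x + y) ^ i
  binomial x y zero    (suc N) _ =
      trans (sumℤ-head N _) (trans (cong (1ℤ * 1ℤ * 1ℤ +_) (sumℤ-zero N (λ {j} _ → cong (λ c → pos c * 1ℤ * x ^ suc j)
          (k>n⇒nCk≡0 {0} {suc j} (s≤s z≤n))))) refl)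
  binomial x y (suc i) (suc N) (s≤s i<N) = begin
    sumℤ (suc N) (b (suc i)) ≡⟨ sumℤ-head N (b (suc i)) ⟩
    b (suc i) 0 + sumℤ N (λ j → b (suc i) (suc j)) ≡⟨ cong (b (suc i) 0 +_) (sumℤ-cong N (λ {j} _ → pascal j)) ⟩
    b (suc i) 0 + sumℤ N (λ j → x * b i j + y * b i (suc j))
      ≡⟨ cong (b (suc i) 0 +_) (trans (sumℤ-+ N _ _) (cong₂ _+_ (sumℤ-* N x (b i)) (sumℤ-* N y (b i ∘ suc)))) ⟩
    b (suc i) 0 + (x * sumℤ N (b i) + y * sumℤ N (b i ∘ suc)) ≡⟨ ring₀ y (y ^ i) (x * sumℤ N (b i)) (sumℤ N (b i ∘ suc)) ⟩
    x * sumℤ N (b i) + y * (b i 0 + sumℤ N (b i ∘ suc)) ≡⟨ cong (λ z → x * sumℤ N (b i) + y * z) (sumℤ-head N (b i)) ⟨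
    x * sumℤ N (b i) + y * sumℤ (suc N) (b i)
      ≡⟨ cong₂ (λ u v → x * u + y * v) (binomial x y i N i<N) (binomial x y i (suc N) (ℕₚ.m<n⇒m<1+n i<N)) ⟩
    x * (x + y) ^ i + y * (x + y) ^ i ≡⟨ ℤₚ.*-distribʳ-+ ((x + y) ^ i) x y ⟨
    (x + y) ^ suc i ∎
    where
    open ≡-Reasoning
    b : ℕ → ℕ → ℤ
    b i j = pos (i C j) * y ^ (i ℕ.∸ j) * x ^ j
    ring₀ : ∀ y z u v → 1ℤ * (y * z) * 1ℤ + (u + y * v) ≡ u + y * (1ℤ * z * 1ℤ + v)
    ring₀ = solve-∀
    ring₁ : ∀ c d e x X → (c + d) * e * (x * X) ≡ x * (c * e * X) + (d * e) * (x * X)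
    ring₁ = solve-∀
    ring₂ : ∀ y d e X → (d * (y * e)) * X ≡ y * (d * e * X)
    ring₂ = solve-∀
    lower : ∀ j → pos (i C suc j) * y ^ (i ℕ.∸ j) * x ^ suc j ≡ y * b i (suc j)
    lower j with j ℕₚ.<? i
    ... | yes j<i =
        trans (cong (λ k → pos (i C suc j) * y ^ k * x ^ suc j) (ℕₚ.+-∸-assoc 1 j<i)) (ring₂ y (pos (i C suc j)) (y ^ (i ℕ.∸ suc j))
            (x ^ suc j))
    -- Here the exponent `i ∸ j` is truncated and no longer one more than `i ∸ suc j`, but the
    -- binomial coefficient vanishes.
    ... | no j≮i rewrite k>n⇒nCk≡0 {i} {suc j} (s≤s (ℕₚ.≮⇒≥ j≮i)) = sym (ℤₚ.*-zeroʳ y)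
    pascal : ∀ j → b (suc i) (suc j) ≡ x * b i j + y * b i (suc j)
    pascal j = begin
      pos (suc i C suc j) * y ^ (i ℕ.∸ j) * x ^ suc j
        ≡⟨ cong (λ c → c * y ^ (i ℕ.∸ j) * x ^ suc j) (trans (cong pos (sym (nCk+nC[k+1]≡[n+1]C[k+1] i j))) (ℤₚ.pos-+ (i C j)
            (i C suc j))) ⟩
      (pos (i C j) + pos (i C suc j)) * y ^ (i ℕ.∸ j) * x ^ suc j ≡⟨ ring₁ (pos (i C j)) (pos (i C suc j)) (y ^ (i ℕ.∸ j)) x (x ^ j) ⟩
      x * b i j + pos (i C suc j) * y ^ (i ℕ.∸ j) * x ^ suc j ≡⟨ cong (x * b i j +_) (lower j) ⟩
      x * b i j + y * b i (suc j) ∎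

  -- The equation makes `a` a multiple of a number larger than its absolute value. The offset 2
  -- keeps the evaluation point among those where values are known.
  zero-of-multiple : ∀ (a s : ℤ) → a + pos (2 ℕ.+ ℤ.∣ a ∣) * s ≡ 0ℤ → a ≡ 0ℤ
  zero-of-multiple a s eq = ℤₚ.∣i∣≡0⇒i≡0 (small ℤ.∣ s ∣ abs)
    where
    X = pos (2 ℕ.+ ℤ.∣ a ∣)
    abs : ℤ.∣ a ∣ ≡ (2 ℕ.+ ℤ.∣ a ∣) ℕ.* ℤ.∣ s ∣
    abs = begin
      ℤ.∣ a ∣ ≡⟨ ℤₚ.∣-i∣≡∣i∣ a ⟨
      ℤ.∣ - a ∣ ≡⟨ cong ℤ.∣_∣ (trans (ring a (X * s)) (trans (cong (_+ - a) eq) (ℤₚ.+-identityˡ (- a)))) ⟨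
      ℤ.∣ X * s ∣ ≡⟨ ℤₚ.abs-* X s ⟩
      (2 ℕ.+ ℤ.∣ a ∣) ℕ.* ℤ.∣ s ∣ ∎
      where
      open ≡-Reasoning
      ring : ∀ a b → b ≡ (a + b) + - a
      ring = solve-∀
    small : ∀ {m} k → m ≡ (2 ℕ.+ m) ℕ.* k → m ≡ 0
    small {m} zero    eq = trans eq (ℕₚ.*-zeroʳ (2 ℕ.+ m))
    small {m} (suc k) eq =
        ⊥-elim (ℕₚ.<-irrefl refl (ℕₚ.<-≤-trans (ℕₚ.m<n⇒m<1+n (ℕₚ.n<1+n m)) (ℕₚ.≤-trans (ℕₚ.m≤m*n (2 ℕ.+ m) (suc k)) (ℕₚ.≤-reflexive
            (sym eq)))))

  -- The constant term is divisible by every evaluation point, and the point `2 + ∣ a 0 ∣` forces it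
  -- to be 0. Dividing by the nonzero point then lowers the degree, with all evaluation points still
  -- available.
  polynomial-zero : ∀ N (a : ℕ → ℤ) → (∀ k → sumℤ N (λ j → a j * pos (2 ℕ.+ k) ^ j) ≡ 0ℤ) → ∀ {j} → j ℕ.< N → a j ≡ 0ℤ
  polynomial-zero (suc N) a h {j} j<N = go j j<N
    where
    open ≡-Reasoning
    rest : ℕ → ℤ
    rest k = sumℤ N (λ j → a (suc j) * pos (2 ℕ.+ k) ^ j)
    ring : ∀ a x X → a * (x * X) ≡ x * (a * X)
    ring = solve-∀
    split : ∀ k → a 0 + pos (2 ℕ.+ k) * rest k ≡ 0ℤ
    split k = begin
      a 0 + X * rest k ≡⟨ cong₂ _+_ (sym (ℤₚ.*-identityʳ (a 0))) (sym (sumℤ-* N X (λ j → a (suc j) * X ^ j))) ⟩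
      a 0 * 1ℤ + sumℤ N (λ j → X * (a (suc j) * X ^ j)) ≡⟨ cong (a 0 * 1ℤ +_) (sumℤ-cong N (λ {j} _ → sym (ring (a (suc j)) X (X ^ j)))) ⟩
      a 0 * 1ℤ + sumℤ N (λ j → a (suc j) * X ^ suc j) ≡⟨ sumℤ-head N (λ j → a j * X ^ j) ⟨
      sumℤ (suc N) (λ j → a j * X ^ j) ≡⟨ h k ⟩
      0ℤ ∎
      where X = pos (2 ℕ.+ k)
    a0≡0 : a 0 ≡ 0ℤ
    a0≡0 = zero-of-multiple (a 0) (rest ℤ.∣ a 0 ∣) (split ℤ.∣ a 0 ∣)
    rest≡0 : ∀ k → rest k ≡ 0ℤ
    rest≡0 k =
        ℤₚ.*-cancelˡ-≡ (pos (2 ℕ.+ k)) (rest k) 0ℤ (trans (sym (ℤₚ.+-identityˡ _)) (trans (cong (_+ pos (2 ℕ.+ k) * rest k) (sym a0≡0))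
            (trans (split k) (sym (ℤₚ.*-zeroʳ (pos (2 ℕ.+ k)))))))
    go : ∀ j → j ℕ.< suc N → a j ≡ 0ℤ
    go zero    _         = a0≡0
    go (suc j) (s≤s j<N) = polynomial-zero N (a ∘ suc) rest≡0 j<N

  sign-power : ∀ k → sign k ≡ (- 1ℤ) ^ k
  sign-power zero    = refl
  sign-power (suc k) = trans (cong -_ (sign-power k)) (sym (ℤₚ.-1*i≡-i ((- 1ℤ) ^ k)))

  ∑-coeff : ∀ x i m N → i ℕ.+ m ℕ.< N → sumℤ N (λ j → pos (coeffTiOnePlusT i m j) * x ^ j) ≡ x ^ i * (1ℤ + x) ^ m
  ∑-coeff x i m N lt = begin
    sumℤ N f ≡⟨ cong (λ k → sumℤ k f) (ℕₚ.m+[n∸m]≡n i≤N) ⟨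
    sumℤ (i ℕ.+ (N ℕ.∸ i)) f ≡⟨ sumℤ-offset i (N ℕ.∸ i) f ⟩
    sumℤ i f + sumℤ (N ℕ.∸ i) (λ j → f (i ℕ.+ j))
      ≡⟨ cong₂ _+_ (sumℤ-zero i (λ {j} j<i → cong (λ b → pos (if b then 0 else m C (j ℕ.∸ i)) * x ^ j) (<ᵇ-true j<i))) (sumℤ-cong
          (N ℕ.∸ i) (λ {j} _ → shifted j)) ⟩
    0ℤ + sumℤ (N ℕ.∸ i) (λ j → x ^ i * (pos (m C j) * 1ℤ ^ (m ℕ.∸ j) * x ^ j)) ≡⟨ ℤₚ.+-identityˡ _ ⟩
    sumℤ (N ℕ.∸ i) (λ j → x ^ i * (pos (m C j) * 1ℤ ^ (m ℕ.∸ j) * x ^ j)) ≡⟨ sumℤ-* (N ℕ.∸ i) (x ^ i) _ ⟩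
    x ^ i * sumℤ (N ℕ.∸ i) (λ j → pos (m C j) * 1ℤ ^ (m ℕ.∸ j) * x ^ j)
      ≡⟨ cong (x ^ i *_) (trans (binomial x 1ℤ m (N ℕ.∸ i) (ℕₚ.m+n≤o⇒m≤o∸n (suc m) (subst (λ k → suc k ℕ.≤ N) (ℕₚ.+-comm i m) lt)))
          (cong (_^ m) (ℤₚ.+-comm x 1ℤ))) ⟩
    x ^ i * (1ℤ + x) ^ m ∎
    where
    open ≡-Reasoning
    f : ℕ → ℤ
    f j = pos (coeffTiOnePlusT i m j) * x ^ j
    i≤N : i ℕ.≤ N
    i≤N = ℕₚ.≤-trans (ℕₚ.m≤m+n i m) (ℕₚ.<⇒≤ lt)
    ring : ∀ c X Y → c * (X * Y) ≡ X * (c * 1ℤ * Y)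
    ring = solve-∀
    shifted : ∀ j → f (i ℕ.+ j) ≡ x ^ i * (pos (m C j) * 1ℤ ^ (m ℕ.∸ j) * x ^ j)
    shifted j = begin
      f (i ℕ.+ j) ≡⟨ cong (λ b → pos (if b then 0 else m C (i ℕ.+ j ℕ.∸ i)) * x ^ (i ℕ.+ j)) (<ᵇ-false (ℕₚ.m≤m+n i j)) ⟩
      pos (m C (i ℕ.+ j ℕ.∸ i)) * x ^ (i ℕ.+ j) ≡⟨ cong₂ (λ k z → pos (m C k) * z) (ℕₚ.m+n∸m≡n i j) (ℤₚ.^-distribˡ-+-* x i j) ⟩
      pos (m C j) * (x ^ i * x ^ j) ≡⟨ ring (pos (m C j)) (x ^ i) (x ^ j) ⟩
      x ^ i * (pos (m C j) * 1ℤ * x ^ j) ≡⟨ cong (λ z → x ^ i * (pos (m C j) * z * x ^ j)) (ℤₚ.^-zeroˡ (m ℕ.∸ j)) ⟨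
      x ^ i * (pos (m C j) * 1ℤ ^ (m ℕ.∸ j) * x ^ j) ∎

  -- Evaluation at integers and comparison of coefficients

  module Assembly (𝓑 : Collection n) (building : IsBuildingSet 𝓑) (chordal : IsChordal 𝓑) where

    open Permutations 𝓑
    open Words 𝓑 building

    descentCount-bound : ∀ i → n ℕ.< 2 ℕ.* i → descentCount 𝓑 i ≡ 0
    descentCount-bound i lt = cong length (filterᵇ-none _ (perms (suc n)) (λ {u} _ → none u))
      where
      none : ∀ u → inHatᵇ u ∧ inSquareᵇ 𝓑 u ∧ (des u ℕ.≡ᵇ i) ≡ false
      none u with inHatᵇ u ∧ inSquareᵇ 𝓑 u ∧ (des u ℕ.≡ᵇ i) in eq
      ... | false = refl
      ... | true  = let (hs , d) = ∧-true {inHatᵇ u ∧ inSquareᵇ 𝓑 u} (trans (Boolₚ.∧-assoc (inHatᵇ u) _ _) eq) in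
        ⊥-elim (ℕₚ.<⇒≱ lt (subst (λ k → 2 ℕ.* k ℕ.≤ n) (≡ᵇ-sound {des u} {i} d) (hat-square-des {u} hs)))

    half : ℕ
    half = suc (n ℕ./ 2)

    des<half : ∀ {d} → 2 ℕ.* d ℕ.≤ n → d ℕ.< half
    des<half {d} le = s≤s (subst (ℕ._≤ n ℕ./ 2) (DivMod.m*n/n≡m d 2) (DivMod./-monoˡ-≤ 2 (subst (ℕ._≤ n) (ℕₚ.*-comm 2 d) le)))

    γCoefficient : ℕ → ℕ
    γCoefficient j = sumℕ half (λ i → descentCount 𝓑 i ℕ.* coeffTiOnePlusT i (n ℕ.∸ 2 ℕ.* i) j)

    -- The degree of t^i (1 + t)^(n - 2i) is at most `n`, so an evaluation over the indices 0 to `n`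
    -- misses no coefficient.
    index-bound : ∀ {i} → i ℕ.< half → i ℕ.+ (n ℕ.∸ 2 ℕ.* i) ℕ.< suc n
    index-bound {i} (s≤s i≤) =
        s≤s (ℕₚ.≤-trans (ℕₚ.+-monoʳ-≤ i (ℕₚ.∸-monoʳ-≤ n (ℕₚ.m≤m+n i _))) (ℕₚ.≤-reflexive (ℕₚ.m+[n∸m]≡n (ℕₚ.≤-trans i≤
            (DivMod.m/n≤m n 2)))))

    γ-value : ∀ x → sumℤ (suc n) (λ j → pos (γCoefficient j) * x ^ j) ≡ 𝒱 ⊤ (Runs.runWeight x)
    γ-value x = begin
      sumℤ (suc n) (λ j → pos (γCoefficient j) * x ^ j) ≡⟨ sumℤ-cong (suc n) (λ {j} _ → expand j) ⟩
      sumℤ (suc n) (λ j → sumℤ half (λ i → D i * (pos (c i j) * x ^ j))) ≡⟨ sumℤ-swap (suc n) half (λ j i → D i * (pos (c i j) * x ^ j)) ⟩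
      sumℤ half (λ i → sumℤ (suc n) (λ j → D i * (pos (c i j) * x ^ j)))
        ≡⟨ sumℤ-cong half (λ {i} lt → trans (sumℤ-* (suc n) (D i) (λ j → pos (c i j) * x ^ j)) (cong (D i *_) (∑-coeff x i
            (n ℕ.∸ 2 ℕ.* i) (suc n) (index-bound lt)))) ⟩
      sumℤ half (λ i → D i * monomial x n i)
        ≡⟨ sumℤ-count half (λ u i → inHatᵇ u ∧ inSquareᵇ 𝓑 u ∧ (des u ℕ.≡ᵇ i)) (λ u → inHatᵇ u ∧ inSquareᵇ 𝓑 u) des (monomial x n)
            (perms (suc n))
             (λ {u} _ h → des<half (hat-square-des {u} h)) (λ {u} {i} _ _ → sym (Boolₚ.∧-assoc (inHatᵇ u) (inSquareᵇ 𝓑 u)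
                 (des u ℕ.≡ᵇ i))) ⟩
      ∑ (λ u → when (inHatᵇ u ∧ inSquareᵇ 𝓑 u) (monomial x n (des u))) (perms (suc n)) ≡⟨ ∑-permutations-monomial building x ⟩
      𝒱 ⊤ (Runs.runWeight x) ∎
      where
      open ≡-Reasoning
      D : ℕ → ℤ
      D i = pos (descentCount 𝓑 i)
      c : ℕ → ℕ → ℕ
      c i j = coeffTiOnePlusT i (n ℕ.∸ 2 ℕ.* i) j
      ring : ∀ X d c → X * (d * c) ≡ d * (c * X)
      ring = solve-∀
      expand : ∀ j → pos (γCoefficient j) * x ^ j ≡ sumℤ half (λ i → D i * (pos (c i j) * x ^ j))
      expand j = begin
        pos (γCoefficient j) * x ^ j ≡⟨ cong (_* x ^ j) (pos-sumℕ half _) ⟩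
        sumℤ half (λ i → pos (descentCount 𝓑 i ℕ.* c i j)) * x ^ j ≡⟨ ℤₚ.*-comm _ (x ^ j) ⟩
        x ^ j * sumℤ half (λ i → pos (descentCount 𝓑 i ℕ.* c i j)) ≡⟨ sumℤ-* half (x ^ j) _ ⟨
        sumℤ half (λ i → x ^ j * pos (descentCount 𝓑 i ℕ.* c i j))
          ≡⟨ sumℤ-cong half (λ {i} _ → trans (cong (x ^ j *_) (ℤₚ.pos-* (descentCount 𝓑 i) (c i j))) (ring (x ^ j) (D i) (pos (c i j)))) ⟩
        sumℤ half (λ i → D i * (pos (c i j) * x ^ j)) ∎

    -- Summing over `j` first turns the alternating binomial sums of `hVec` into powers of x - 1 by
    -- the binomial theorem; a collection of cardinality c then contributes (x - 1)^(n - c).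
    h-value : ∀ x → sumℤ (suc n) (λ j → hVec 𝓑 j * x ^ j) ≡ ∑ (λ NX →
        (x + - 1ℤ) ^ (n ℕ.∸ (length (proj₁ NX) ℕ.+ ∣ proj₂ NX ∣))) (allENC 𝓑)
    h-value x = begin
      sumℤ (suc n) (λ j → hVec 𝓑 j * x ^ j) ≡⟨ sumℤ-cong (suc n) (λ {j} _ → expand j) ⟩
      sumℤ (suc n) (λ j → sumℤ (suc n) (λ i → F i * b i j)) ≡⟨ sumℤ-swap (suc n) (suc n) (λ j i → F i * b i j) ⟩
      sumℤ (suc n) (λ i → sumℤ (suc n) (b′ i))
        ≡⟨ sumℤ-cong (suc n) (λ {i} lt → trans (sumℤ-* (suc n) (F i) (b i)) (cong (F i *_) (binomial x (- 1ℤ) i (suc n) lt))) ⟩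
      sumℤ (suc n) (λ i → F i * (x + - 1ℤ) ^ i)
        ≡⟨ sumℤ-count (suc n) (λ NX i → card NX ℕ.≡ᵇ (n ℕ.∸ i)) (λ _ → true) (λ NX → n ℕ.∸ card NX) ((x + - 1ℤ) ^_) (allENC 𝓑)
             -- Passing from c = n ∸ i to n ∸ c = i requires c ≤ n, which `ENC-card` supplies. That
             -- bound does not involve t, so 0 is an arbitrary choice.
             (λ {NX} _ _ → s≤s (ℕₚ.m∸n≤m n (card NX))) (λ {NX} m lt → complement (NestedSum.ENC-card 𝓑 building 0ℤ m) (ℕ.s≤s⁻¹ lt)) ⟩
      ∑ (λ NX → (x + - 1ℤ) ^ (n ℕ.∸ card NX)) (allENC 𝓑) ∎
      where
      open ≡-Reasoning
      card : List (Subset n) × Subset n → ℕ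
      card NX = length (proj₁ NX) ℕ.+ ∣ proj₂ NX ∣
      F : ℕ → ℤ
      F i = pos (fVec 𝓑 i)
      b : ℕ → ℕ → ℤ
      b i j = pos (i C j) * (- 1ℤ) ^ (i ℕ.∸ j) * x ^ j
      b′ : ℕ → ℕ → ℤ
      b′ i j = F i * b i j
      complement : ∀ {c i} → c ℕ.≤ n → i ℕ.≤ n → (c ℕ.≡ᵇ n ℕ.∸ i) ≡ (n ℕ.∸ c ℕ.≡ᵇ i)
      complement {c} {i} c≤n i≤n = bool-⇔
        (λ h → ≡ᵇ-true (trans (cong (n ℕ.∸_) (≡ᵇ-sound {c} h)) (ℕₚ.m∸[m∸n]≡n i≤n)))
        (λ h → ≡ᵇ-true {c} (trans (sym (ℕₚ.m∸[m∸n]≡n c≤n)) (cong (n ℕ.∸_) (≡ᵇ-sound {n ℕ.∸ c} h))))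
      ring : ∀ X s c f → X * (s * (c * f)) ≡ f * (c * s * X)
      ring = solve-∀
      expand : ∀ j → hVec 𝓑 j * x ^ j ≡ sumℤ (suc n) (λ i → F i * b i j)
      expand j = begin
        hVec 𝓑 j * x ^ j ≡⟨ ℤₚ.*-comm (hVec 𝓑 j) (x ^ j) ⟩
        x ^ j * hVec 𝓑 j ≡⟨ sumℤ-* (suc n) (x ^ j) _ ⟨
        sumℤ (suc n) (λ i → x ^ j * (sign (i ℕ.∸ j) * pos ((i C j) ℕ.* fVec 𝓑 i)))
          ≡⟨ sumℤ-cong (suc n) (λ {i} _ → trans (cong₂ (λ s z → x ^ j * (s * z)) (sign-power (i ℕ.∸ j)) (ℤₚ.pos-* (i C j) (fVec 𝓑 i)))
              (ring (x ^ j) ((- 1ℤ) ^ (i ℕ.∸ j)) (pos (i C j)) (F i))) ⟩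
        sumℤ (suc n) (λ i → F i * b i j) ∎

    -- The point x = 2 + k corresponds to t = 1 + k, which is visibly nonzero, and x - 1 reduces to
    -- t by computation.
    values-agree : ∀ k → sumℤ (suc n) (λ j → hVec 𝓑 j * pos (2 ℕ.+ k) ^ j) ≡ sumℤ (suc n) (λ j → pos (γCoefficient j) * pos (2 ℕ.+ k) ^ j)
    values-agree k =
        trans (h-value (pos (2 ℕ.+ k))) (trans (Comparison.∑-ENC≡Γ 𝓑 building chordal (pos (suc k))) (sym (γ-value (pos (2 ℕ.+ k)))))

    hVec≡γ : ∀ j → hVec 𝓑 j ≡ pos (γCoefficient j)
    hVec≡γ j with j ℕₚ.<? suc n
    ... | yes j<n =
        ℤₚ.i-j≡0⇒i≡j (hVec 𝓑 j) (pos (γCoefficient j)) (polynomial-zero (suc n) (λ j → hVec 𝓑 j + - pos (γCoefficient j)) difference j<n)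
      where
      open ≡-Reasoning
      ring : ∀ h g X → (h + - g) * X ≡ h * X + - 1ℤ * (g * X)
      ring = solve-∀
      ring′ : ∀ z → z + - 1ℤ * z ≡ 0ℤ
      ring′ = solve-∀
      difference : ∀ k → sumℤ (suc n) (λ j → (hVec 𝓑 j + - pos (γCoefficient j)) * pos (2 ℕ.+ k) ^ j) ≡ 0ℤ
      difference k = begin
        sumℤ (suc n) (λ j → (hVec 𝓑 j + - pos (γCoefficient j)) * X ^ j)
          ≡⟨ sumℤ-cong (suc n) (λ {j} _ → ring (hVec 𝓑 j) (pos (γCoefficient j)) (X ^ j)) ⟩
        sumℤ (suc n) (λ j → hVec 𝓑 j * X ^ j + - 1ℤ * (pos (γCoefficient j) * X ^ j)) ≡⟨ sumℤ-+ (suc n) _ _ ⟩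
        sumℤ (suc n) (λ j → hVec 𝓑 j * X ^ j) + sumℤ (suc n) (λ j → - 1ℤ * (pos (γCoefficient j) * X ^ j))
          ≡⟨ cong₂ _+_ (values-agree k) (sumℤ-* (suc n) (- 1ℤ) (λ j → pos (γCoefficient j) * X ^ j)) ⟩
        sumℤ (suc n) (λ j → pos (γCoefficient j) * X ^ j) + - 1ℤ * sumℤ (suc n) (λ j → pos (γCoefficient j) * X ^ j)
          ≡⟨ ring′ (sumℤ (suc n) (λ j → pos (γCoefficient j) * X ^ j)) ⟩
        0ℤ ∎
        where X = pos (2 ℕ.+ k)
    -- Above degree `n` both sides are 0, because every binomial coefficient involved has its lower
    -- index larger than its upper one.
    ... | no j≮n =
        trans (sumℤ-zero (suc n) (λ {i} lt → trans (cong (λ c → sign (i ℕ.∸ j) * pos (c ℕ.* fVec 𝓑 i)) (k>n⇒nCk≡0 {i} {j}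
            (ℕₚ.<-≤-trans lt n<j))) (ℤₚ.*-zeroʳ (sign (i ℕ.∸ j)))))
                   (sym (trans (pos-sumℕ half _) (sumℤ-zero half (λ {i} lt → cong pos (vanish i lt)))))
      where
      n<j : suc n ℕ.≤ j
      n<j = ℕₚ.≮⇒≥ j≮n
      vanish : ∀ i → i ℕ.< half → descentCount 𝓑 i ℕ.* coeffTiOnePlusT i (n ℕ.∸ 2 ℕ.* i) j ≡ 0
      vanish i lt = trans (cong (descentCount 𝓑 i ℕ.*_) (trans
          (cong (λ b → if b then 0 else (n ℕ.∸ 2 ℕ.* i) C (j ℕ.∸ i)) (<ᵇ-false (ℕₚ.≤-trans (ℕₚ.m≤m+n i _) (ℕₚ.<⇒≤ i+m<j))))
          (k>n⇒nCk≡0 (ℕₚ.m+n≤o⇒m≤o∸n (suc (n ℕ.∸ 2 ℕ.* i)) (subst (λ k → suc k ℕ.≤ j) (ℕₚ.+-comm i _) i+m<j)))))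
        (ℕₚ.*-zeroʳ (descentCount 𝓑 i))
        where
        i+m<j : i ℕ.+ (n ℕ.∸ 2 ℕ.* i) ℕ.< j
        i+m<j = ℕₚ.<-≤-trans (index-bound lt) n<j

open import Data.Nat using (ℕ; suc; _*_; _∸_; _<_; _/_)
open import Data.Integer using (+_)
open import Data.Product using (_×_; _,_)
open import Relation.Binary.PropositionalEquality using (_≡_)

theorem6p34 : (n : ℕ) (𝓑 : Collection n) →
    IsBuildingSet 𝓑 → IsConnected 𝓑 → IsChordal 𝓑 →
    (∀ i → n < 2 * i → descentCount 𝓑 i ≡ 0) ×
    (∀ j → hVec 𝓑 j ≡ + sumℕ (suc (n / 2)) (λ i → descentCount 𝓑 i * coeffTiOnePlusT i (n ∸ 2 * i) j))
theorem6p34 n 𝓑 building connected chordal = descentCount-bound , hVec≡γ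
  where open Assembly 𝓑 building chordal
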